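{- On the set of all mesh patterns of length $2$, i.e. the mesh patterns $(12,R)$ and $(21,R)$ with $R\subseteq\{0,1,2\}\times\{0,1,2\}$, the relation of Wilf-equivalence under $231$ (that is, $p_1\sim p_2$ if and only if $|\mathrm{Av}_n(\{231,p_1\})|=|\mathrm{Av}_n(\{231,p_2\})|$ for all $n\ge0$) has exactly $23$ equivalence classes.
   Context: Write $[n]=\{1,\dots,n\}$. A permutation of length $n$ is a bijection of $[n]$, written in one-line notation; $G(\pi)=\{(i,\pi(i)) : i\in[n]\}$ is its plot. A mesh pattern of length $k$ is a pair $p=(\tau,R)$ with $\tau$ a permutation of length $k$ and $R\subseteq\{0,\dots,k\}^2$. An occurrence of $p$ in a permutation $\pi$ of length $n$ is a subset $\omega\subseteq G(\pi)$ for which there are order-preserving injections $\alpha,\beta:[k]\to[n]$ such that (i) $\omega=\{(\alpha(i),\beta(j)):(i,j)\in G(\tau)\}$, and (ii) with $\alpha(0)=\beta(0)=0$, $\alpha(k+1)=\beta(k+1)=n+1$ and $R_{ij}=[\alpha(i)+1,\alpha(i+1)-1]\times[\beta(j)+1,\beta(j+1)-1]$, one has $R_{ij}\cap G(\pi)=\emptyset$ for every $(i,j)\in R$. A permutation avoids $p$ if it has no occurrence of $p$. A classical pattern $\pi$ is identified with the mesh pattern $(\pi,\emptyset)$. $\mathrm{Av}_n(S)$ is the set of all permutations of length $n$ avoiding every pattern in $S$. -}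

module Defs where

open import Data.Fin.Base using (Fin; suc; toℕ; inject₁; _≤_)
open import Data.Fin.Patterns using (0F; 1F; 2F)
open import Data.Fin.Permutation using (Permutation′; permutation; _⟨$⟩ʳ_; _≈_)
open import Data.Fin.Subset as Sub using (Subset)
open import Data.List.Base using (List; []; _∷_)
open import Data.List.Relation.Unary.All using (All)
open import Data.Nat.Base as ℕ using (ℕ; suc)
open import Data.Product.Base using (Σ-syntax; ∃; ∃₂; ∃-syntax; _×_; _,_; proj₁)
open import Data.Vec.Base as Vec using (Vec; lookup; tabulate; _∷ʳ_)
open import Function.Base using (_∘_)
open import Function.Bundles using (Bijection)
open import Function.Definitions using (Injective)
open import Level as Level using (Level; 0ℓ; _⊔_)
open import Relation.Binary.Bundles using (Setoid)
open import Relation.Binary.Core using (Rel; _Preserves_⟶_)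
open import Relation.Binary.Structures using (IsEquivalence)
open import Relation.Binary.PropositionalEquality using (_≡_; refl; sym; trans; setoid)
open import Relation.Nullary.Negation using (¬_)
open import Relation.Unary using (Pred; _⊆_; _∩_; _≐_; Empty)

private
  variable
    a ℓ : Level
    k n : ℕ

-- The set [n] = {1,…,n} is represented by Fin n; pos recovers the actual integer.
pos : Fin n → ℕ
pos i = suc (toℕ i)

G : Permutation′ n → Pred (Fin n × Fin n) 0ℓ
G π (i , j) = π ⟨$⟩ʳ i ≡ j

-- Subsets of the finite grid {0,…,k}² are represented by their columns, so that
-- membership is decidable: the set of mesh patterns of length k is finite.
Shading : ℕ → Set
Shading k = Vec (Subset (suc k)) (suc k)

infix 4 _∈ˢ_

_∈ˢ_ : Fin (suc k) × Fin (suc k) → Shading k → Set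
(i , j) ∈ˢ R = j Sub.∈ lookup R i

record MeshPattern (k : ℕ) : Set where
  constructor mesh
  field
    perm    : Permutation′ k
    shading : Shading k

classical : Permutation′ k → MeshPattern k
classical τ = mesh τ (Vec.replicate _ Sub.⊥)

OrderPreservingInjection : (Fin k → Fin n) → Set
OrderPreservingInjection α = Injective _≡_ _≡_ α × α Preserves _≤_ ⟶ _≤_

-- The values α(0) = 0, α(1), …, α(k), α(k+1) = n+1, as integers.
extend : (Fin k → Fin n) → Fin (suc (suc k)) → ℕ
extend {n = n} α = lookup (0 Vec.∷ (tabulate (pos ∘ α) ∷ʳ suc n))

-- The integers in [α(i)+1, α(i+1)-1], for 0 ≤ i ≤ k.
Gap : (Fin k → Fin n) → Fin (suc k) → Pred (Fin n) 0ℓ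
Gap α i x = extend α (inject₁ i) ℕ.< pos x × pos x ℕ.< extend α (suc i)

Region : (α β : Fin k → Fin n) → Fin (suc k) → Fin (suc k) → Pred (Fin n × Fin n) 0ℓ
Region α β i j (x , y) = Gap α i x × Gap β j y

Image : (α β : Fin k → Fin n) → Pred (Fin k × Fin k) 0ℓ → Pred (Fin n × Fin n) 0ℓ
Image α β S (x , y) = ∃₂ λ i j → S (i , j) × x ≡ α i × y ≡ β j

record IsOccurrence (p : MeshPattern k) (π : Permutation′ n)
                    (ω : Pred (Fin n × Fin n) 0ℓ) : Set where
  open MeshPattern p
  field
    ω⊆G     : ω ⊆ G π
    α β     : Fin k → Fin n
    α-mono  : OrderPreservingInjection α
    β-mono  : OrderPreservingInjection β
    ω≐image : ω ≐ Image α β (G perm)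
    empty   : ∀ i j → (i , j) ∈ˢ shading → Empty (Region α β i j ∩ G π)

Avoids : Permutation′ n → MeshPattern k → Set₁
Avoids π p = ∀ ω → ¬ IsOccurrence p π ω

-- Two elements are equal when they are equal as functions; the proofs of
-- bijectivity and of avoidance play no role.
Av : (n : ℕ) → List (∃ MeshPattern) → Setoid (Level.suc 0ℓ) 0ℓ
Av n S = record
  { Carrier       = Σ[ π ∈ Permutation′ n ] All (λ (_ , p) → Avoids π p) S
  ; _≈_           = λ σ ρ → proj₁ σ ≈ proj₁ ρ
  ; isEquivalence = record
    { refl  = λ _ → refl
    ; sym   = λ e i → sym (e i)
    ; trans = λ e f i → trans (e i) (f i)
    }
  }

infix 4 ∣_∣≡_

∣_∣≡_ : Setoid a ℓ → ℕ → Set (a ⊔ ℓ)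
∣ A ∣≡ m = Bijection A (setoid (Fin m))

-- ∣Avₙ({q, p₁})∣ = ∣Avₙ({q, p₂})∣ for all n.
WilfEquivalentUnder : ∀ {l} → MeshPattern l → Rel (MeshPattern k) (Level.suc 0ℓ)
WilfEquivalentUnder q p₁ p₂ = ∀ n → ∃[ m ]
  ∣ Av n ((_ , q) ∷ (_ , p₁) ∷ []) ∣≡ m ×
  ∣ Av n ((_ , q) ∷ (_ , p₂) ∷ []) ∣≡ m

-- The set of equivalence classes is the quotient, i.e. A with _∼_ as its equality.
HasExactlyClasses : {A : Set a} → Rel A ℓ → ℕ → Set (a ⊔ ℓ)
HasExactlyClasses _∼_ N =
  Σ[ e ∈ IsEquivalence _∼_ ] ∣ record { isEquivalence = e } ∣≡ N

-- One-line notation 231, with values shifted down by one.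
perm231 : Permutation′ 3
perm231 = permutation
  (λ { 0F → 1F ; 1F → 2F ; 2F → 0F })
  (λ { 0F → 2F ; 1F → 0F ; 2F → 1F })
  (λ { 0F → refl ; 1F → refl ; 2F → refl })
  (λ { 0F → refl ; 1F → refl ; 2F → refl })

{-# OPTIONS --safe #-}
module Submission where

-- Cut a 231-avoiding permutation at its maximum: every value on the left is smaller than every
-- value on the right. So these permutations are binary trees, with positions read in inorder and
-- values in postorder. Whether a mesh pattern of length 2 occurs in a tree is computed from five
-- bits of information about each of the two subtrees, which makes the avoiders of each pattern the
-- language of a bottom-up tree automaton. The 1024 automata have only 95 different languages, by
-- bisimulation with 95 representatives. The generating functions of the states of an automaton
-- solve a quadratic system. For each class that contains several languages, the solution is a
-- rational function of a series t with t = x (1 + t)² or t = x (1 + t + t²), so that languages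
-- of the same class are compared by identities between polynomials in t. The 23 classes are
-- separated by their numbers of avoiders of length 6.

open import Defs

open import Data.Bool.Base using (Bool; true; false; _∧_; _∨_; not; if_then_else_; T)
open import Data.Bool.ListAction using (all)
open import Data.Bool.Properties using (T?; ∧-assoc; ∧-comm; ∧-identityʳ; ∧-zeroʳ; ∨-zeroʳ)
open import Data.Empty using (⊥)
open import Data.Fin.Base as Fin using (Fin; zero; suc; toℕ; fromℕ<)
open import Data.Fin using (#_)
open import Data.Fin.Patterns using (0F; 1F; 2F)
open import Data.Fin.Permutation as Perm using (Permutation′; permutation; _⟨$⟩ʳ_; _≈_)
open import Data.Fin.Properties as Fin using (toℕ-fromℕ<; fromℕ<-toℕ; toℕ-injective; toℕ<n)
open import Data.Fin.Subset as Sub using ()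
open import Data.Fin.Subset.Properties using (∉⊥)
open import Data.List.Base as List using
  (List; []; _∷_; map; _++_; cartesianProductWith; filterᵇ; length; concatMap)
open import Data.List.Membership.Propositional using (_∈_)
open import Data.List.Membership.Propositional.Properties using
  (∈-++⁺ˡ; ∈-++⁺ʳ; ∈-++⁻; ∈-cartesianProductWith⁺; ∈-cartesianProductWith⁻; ∈-filter⁺; ∈-filter⁻; ∈-lookup)
open import Data.List.Relation.Binary.Disjoint.Propositional using (Disjoint)
open import Data.List.Relation.Unary.All as All using (All; []; _∷_)
open import Data.List.Relation.Unary.All.Properties using (all⁺)
open import Data.List.Relation.Unary.AllPairs using ([]; _∷_)
open import Data.List.Relation.Unary.Any as Any using (here; there)
open import Data.List.Relation.Unary.Any.Properties using (lookup-index)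
open import Data.List.Relation.Unary.Unique.Propositional using (Unique)
import Data.List.Relation.Unary.Unique.Propositional.Properties as Unique
open import Data.Maybe.Base using (Maybe; just; nothing)
open import Data.Nat.Base using
  (ℕ; zero; suc; _+_; _*_; _/_; _%_; _≤_; _<_; z≤n; s≤s; z<s; s<s; s<s⁻¹; _≡ᵇ_)
open import Data.Nat.Properties
open import Data.Nat.Tactic.RingSolver using (solve-∀)
open import Data.Product.Base using (Σ-syntax; ∃; _×_; _,_; proj₁; proj₂)
open import Data.Sum.Base using (_⊎_; inj₁; inj₂)
open import Data.Unit.Base using (tt)
open import Data.Vec.Base as Vec using (Vec; []; _∷_; lookup)
open import Data.Vec.Properties using ([]=⇒lookup; lookup⇒[]=; lookup-replicate; lookup∘tabulate)
import Data.Vec.Relation.Unary.AllPairs as AllPairs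
import Data.Vec.Relation.Unary.Unique.Propositional as UniqueVec
open import Data.Vec.Relation.Unary.Unique.Propositional.Properties using (lookup-injective)
open import Function.Base using (_∘_; id)
open import Function.Bundles using (Injection; Bijection)
open import Function.Properties.Inverse using (↔⇒↣)
open import Relation.Binary.Bundles using (Setoid)
open import Relation.Binary.Definitions using (tri<; tri≈; tri>)
open import Relation.Binary.PropositionalEquality using
  (_≡_; _≢_; _≗_; refl; sym; trans; cong; cong₂; subst; subst₂; module ≡-Reasoning)
open import Relation.Binary.Structures using (IsEquivalence)
open import Relation.Nullary.Decidable using (yes; no; ⌊_⌋; ¬?; from-yes)
open import Relation.Nullary.Negation using (¬_; contradiction)

-- Formal power series

-- Few bits suffice because the direction between two nodes that are not in the same subtree of a
-- node does not depend on where in their subtrees they are. Seen from a point outside, a whole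
-- subtree lies in one direction. Mesh patterns bring an obstacle that classical ones do not have: a
-- further node can fall into a shaded box and destroy an occurrence. Containing an occurrence is
-- thus no absorbing property, and states with an occurrence may still lead to accepting ones. Since
-- x = t / Φ (t) is rational in t, the parameter t removes the square root that a quadratic equation
-- over x brings, and an equality of algebraic series becomes a cross-multiplication. All of this
-- stays in ℕ: a rational function is kept as an equation with its denominator cleared, and
-- denominators have constant term 1, so that they can be cancelled. The tables are certificates.
-- The lemmas about the tests hold for arbitrary tables and arbitrary lists of states; only a few
-- closed Boolean tests are evaluated.

Series : Set
Series = ℕ → ℕ

infixl 6 _⊕_
infixl 7 _⊛_
infixr 8 _·_

_⊕_ : Series → Series → Series
(f ⊕ g) n = f n + g n

_·_ : ℕ → Series → Series
(c · f) n = c * f n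

-- The Cauchy product, computed by shifting the left factor only. `conv` and `convTotal` recurse in
-- the same way, so that enumerating trees by their two subtrees gives a product without any
-- reindexing.
_⊛_ : Series → Series → Series
(f ⊛ g) zero    = f 0 * g 0
(f ⊛ g) (suc n) = f 0 * g (suc n) + (f ∘ suc ⊛ g) n

const : ℕ → Series
const c zero    = c
const c (suc n) = 0

X· : Series → Series
X· f zero    = 0
X· f (suc n) = f n

infix 4 _≈[_]_

_≈[_]_ : Series → ℕ → Series → Set
f ≈[ n ] g = ∀ {i} → i < n → f i ≡ g i

⊛-cong-≤ : ∀ {f f′ g g′} n → (∀ {i} → i ≤ n → f i ≡ f′ i) → (∀ {i} → i ≤ n → g i ≡ g′ i) →
           (f ⊛ g) n ≡ (f′ ⊛ g′) n
⊛-cong-≤ zero    p q = cong₂ _*_ (p z≤n) (q z≤n)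
⊛-cong-≤ (suc n) p q = cong₂ _+_ (cong₂ _*_ (p z≤n) (q ≤-refl))
  (⊛-cong-≤ n (p ∘ s≤s) (q ∘ m≤n⇒m≤1+n))

⊛-cong : ∀ {f f′ g g′} → f ≗ f′ → g ≗ g′ → f ⊛ g ≗ f′ ⊛ g′
⊛-cong p q n = ⊛-cong-≤ n (λ {i} _ → p i) (λ {i} _ → q i)

⊛-congₙ : ∀ {f f′ g g′ n} → f ≈[ n ] f′ → g ≈[ n ] g′ → f ⊛ g ≈[ n ] f′ ⊛ g′
⊛-congₙ p q {i} i<n = ⊛-cong-≤ i (λ j≤i → p (≤-<-trans j≤i i<n)) (λ j≤i → q (≤-<-trans j≤i i<n))

-- The factor x gains one coefficient of precision. This drives both inductions on precision: the
-- construction of `param` and the solution of the quadratic system.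
X·-congₙ : ∀ {f g n} → f ≈[ n ] g → X· f ≈[ suc n ] X· g
X·-congₙ p {zero}  _         = refl
X·-congₙ p {suc i} (s≤s i<n) = p i<n

⊛-distribʳ : ∀ f g h → (f ⊕ g) ⊛ h ≗ (f ⊛ h) ⊕ (g ⊛ h)
⊛-distribʳ f g h zero    = *-distribʳ-+ (h 0) (f 0) (g 0)
⊛-distribʳ f g h (suc n) =
  trans (cong ((f 0 + g 0) * h (suc n) +_) (⊛-distribʳ (f ∘ suc) (g ∘ suc) h n))
        (lem (f 0) (g 0) (h (suc n)) ((f ∘ suc ⊛ h) n) ((g ∘ suc ⊛ h) n))
  where lem : ∀ a b c x y → (a + b) * c + (x + y) ≡ a * c + x + (b * c + y)
        lem = solve-∀

⊛-scaleˡ : ∀ c f g → (c · f) ⊛ g ≗ c · (f ⊛ g)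
⊛-scaleˡ c f g zero    = *-assoc c (f 0) (g 0)
⊛-scaleˡ c f g (suc n) =
  trans (cong (c * f 0 * g (suc n) +_) (⊛-scaleˡ c (f ∘ suc) g n))
        (lem c (f 0) (g (suc n)) ((f ∘ suc ⊛ g) n))
  where lem : ∀ c a b x → c * a * b + c * x ≡ c * (a * b + x)
        lem = solve-∀

⊛-assoc : ∀ f g h → (f ⊛ g) ⊛ h ≗ f ⊛ (g ⊛ h)
⊛-assoc f g h zero    = *-assoc (f 0) (g 0) (h 0)
⊛-assoc f g h (suc n) = begin
  -- By definition, the shift of `f ⊛ g` is `f 0 · (g ∘ suc) ⊕ f ∘ suc ⊛ g`.
  f 0 * g 0 * h (suc n) + ((f 0 · (g ∘ suc) ⊕ f ∘ suc ⊛ g) ⊛ h) n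
    ≡⟨ cong (f 0 * g 0 * h (suc n) +_) (⊛-distribʳ (f 0 · (g ∘ suc)) (f ∘ suc ⊛ g) h n) ⟩
  f 0 * g 0 * h (suc n) + ((f 0 · (g ∘ suc) ⊛ h) n + ((f ∘ suc ⊛ g) ⊛ h) n)
    ≡⟨ cong₂ (λ x y → f 0 * g 0 * h (suc n) + (x + y)) (⊛-scaleˡ (f 0) (g ∘ suc) h n)
             (⊛-assoc (f ∘ suc) g h n) ⟩
  f 0 * g 0 * h (suc n) + (f 0 * (g ∘ suc ⊛ h) n + (f ∘ suc ⊛ (g ⊛ h)) n)
    ≡⟨ lem (f 0) (g 0) (h (suc n)) _ _ ⟩
  f 0 * (g 0 * h (suc n) + (g ∘ suc ⊛ h) n) + (f ∘ suc ⊛ (g ⊛ h)) n ∎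
  where open ≡-Reasoning
        lem : ∀ a b c x y → a * b * c + (a * x + y) ≡ a * (b * c + x) + y
        lem = solve-∀

-- The mirror image of the defining recursion, which shifts the right factor; commutativity follows
-- by comparing the two.
⊛-sucʳ : ∀ f g n → (f ⊛ g) (suc n) ≡ f (suc n) * g 0 + (f ⊛ g ∘ suc) n
⊛-sucʳ f g zero    = +-comm (f 0 * g 1) (f 1 * g 0)
⊛-sucʳ f g (suc n) =
  trans (cong (f 0 * g (2 + n) +_) (⊛-sucʳ (f ∘ suc) g n))
        (lem (f 0 * g (2 + n)) (f (2 + n) * g 0) ((f ∘ suc ⊛ g ∘ suc) n))
  where lem : ∀ a b c → a + (b + c) ≡ b + (a + c)
        lem = solve-∀

⊛-comm : ∀ f g → f ⊛ g ≗ g ⊛ f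
⊛-comm f g zero    = *-comm (f 0) (g 0)
⊛-comm f g (suc n) = trans (cong₂ _+_ (*-comm (f 0) (g (suc n))) (⊛-comm (f ∘ suc) g n))
                           (sym (⊛-sucʳ g f n))

⊛-distribˡ : ∀ f g h → f ⊛ (g ⊕ h) ≗ (f ⊛ g) ⊕ (f ⊛ h)
⊛-distribˡ f g h n = begin
  (f ⊛ (g ⊕ h)) n       ≡⟨ ⊛-comm f (g ⊕ h) n ⟩
  ((g ⊕ h) ⊛ f) n       ≡⟨ ⊛-distribʳ g h f n ⟩
  (g ⊛ f) n + (h ⊛ f) n ≡⟨ cong₂ _+_ (⊛-comm g f n) (⊛-comm h f n) ⟩
  (f ⊛ g) n + (f ⊛ h) n ∎
  where open ≡-Reasoning

𝟘 : Series
𝟘 _ = 0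

⊛-zeroˡ : ∀ g → 𝟘 ⊛ g ≗ 𝟘
⊛-zeroˡ g zero    = refl
⊛-zeroˡ g (suc n) = ⊛-zeroˡ g n

⊛-zeroʳ : ∀ g → g ⊛ 𝟘 ≗ 𝟘
⊛-zeroʳ g n = trans (⊛-comm g 𝟘 n) (⊛-zeroˡ g n)

const-⊛ : ∀ c g → const c ⊛ g ≗ c · g
const-⊛ c g zero    = refl
const-⊛ c g (suc n) = trans (cong (c * g (suc n) +_) (⊛-zeroˡ g n)) (+-identityʳ _)

X·-⊛ : ∀ f g → X· f ⊛ g ≗ X· (f ⊛ g)
X·-⊛ f g zero    = refl
X·-⊛ f g (suc n) = refl

⊛-X· : ∀ f g → f ⊛ X· g ≗ X· (f ⊛ g)
⊛-X· f g n = trans (⊛-comm f (X· g) n) (trans (X·-⊛ g f n) (X·-comm n))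
  where X·-comm : X· (g ⊛ f) ≗ X· (f ⊛ g)
        X·-comm zero    = refl
        X·-comm (suc n) = ⊛-comm g f n

-- Replaces division. As d has constant term 1, the coefficient of `d ⊛ f` at n is `f n` plus a
-- combination of earlier coefficients of f, which already agree with those of g.
⊛-cancelˡ : ∀ {d f g} n → d 0 ≡ 1 → d ⊛ f ≈[ n ] d ⊛ g → f ≈[ n ] g
⊛-cancelˡ {d} {f} {g} (suc n) d₀ p {i} i<1+n with m<1+n⇒m<n∨m≡n i<1+n
... | inj₁ i<n  = ⊛-cancelˡ n d₀ (p ∘ m<n⇒m<1+n) i<n
... | inj₂ refl = top n (p ≤-refl) (⊛-cancelˡ n d₀ (p ∘ m<n⇒m<1+n))
  where
  unit : ∀ {a b} → d 0 * a ≡ d 0 * b → a ≡ b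
  unit {a} {b} e = begin
    a       ≡⟨ *-identityˡ a ⟨
    1 * a   ≡⟨ cong (_* a) d₀ ⟨
    d 0 * a ≡⟨ e ⟩
    d 0 * b ≡⟨ cong (_* b) d₀ ⟩
    1 * b   ≡⟨ *-identityˡ b ⟩
    b       ∎
    where open ≡-Reasoning
  top : ∀ n → (d ⊛ f) n ≡ (d ⊛ g) n → f ≈[ n ] g → f n ≡ g n
  top zero    e _ = unit e
  top (suc n) e q = unit (+-cancelʳ-≡ _ _ _ (trans e (cong (d 0 * g (suc n) +_)
    (sym (⊛-cong-≤ {d ∘ suc} n (λ _ → refl) (q ∘ s≤s))))))

⊛-cancelˡ-≗ : ∀ {d f g} → d 0 ≡ 1 → d ⊛ f ≗ d ⊛ g → f ≗ g
⊛-cancelˡ-≗ d₀ p n = ⊛-cancelˡ (suc n) d₀ (λ {i} _ → p i) ≤-refl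

when : Bool → Series → Series
when true  f = f
when false f = 𝟘

module _ {A : Set} where

  ∑ : List A → (A → Series) → Series
  ∑ []       f = 𝟘
  ∑ (a ∷ as) f = f a ⊕ ∑ as f

  ∑-congₙ : ∀ as {f g : A → Series} {n} → All (λ a → f a ≈[ n ] g a) as → ∑ as f ≈[ n ] ∑ as g
  ∑-congₙ []       []       i<n = refl
  ∑-congₙ (a ∷ as) (p ∷ ps) i<n = cong₂ _+_ (p i<n) (∑-congₙ as ps i<n)

  ⊛-∑ : ∀ d as (f : A → Series) → d ⊛ ∑ as f ≗ ∑ as (λ a → d ⊛ f a)
  ⊛-∑ d []       f n = ⊛-zeroʳ d n
  ⊛-∑ d (a ∷ as) f n = trans (⊛-distribˡ d (f a) (∑ as f) n) (cong ((d ⊛ f a) n +_) (⊛-∑ d as f n))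

-- Polynomials and their values at a series

-- The constant term comes first.
Poly : Set
Poly = List ℕ

infixl 6 _⊞_
infixl 7 _⊠_

_⊞_ : Poly → Poly → Poly
[]      ⊞ q       = q
(a ∷ p) ⊞ []      = a ∷ p
(a ∷ p) ⊞ (b ∷ q) = a + b ∷ p ⊞ q

_⊠_ : Poly → Poly → Poly
[]      ⊠ q = []
(a ∷ p) ⊠ q = map (a *_) q ⊞ (0 ∷ p ⊠ q)

isZero : Poly → Bool
isZero []            = true
isZero (zero  ∷ p)   = isZero p
isZero (suc _ ∷ p)   = false

-- Ignores trailing zeros, which sums and products of lists may leave behind.
_==_ : Poly → Poly → Bool
[]      == q       = isZero q
(a ∷ p) == []      = isZero (a ∷ p)
(a ∷ p) == (b ∷ q) = (a ≡ᵇ b) ∧ (p == q)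

whenᵖ : Bool → Poly → Poly
whenᵖ true  p = p
whenᵖ false p = []

∑ᵖ : ∀ {A : Set} → List A → (A → Poly) → Poly
∑ᵖ []       f = []
∑ᵖ (a ∷ as) f = f a ⊞ ∑ᵖ as f

⟦_⟧ : Poly → Series → Series
⟦ []    ⟧ u = 𝟘
⟦ c ∷ p ⟧ u = const c ⊕ u ⊛ ⟦ p ⟧ u

∧-split : ∀ {a b} → T (a ∧ b) → T a × T b
∧-split {true} {true} _ = _ , _

module _ (u : Series) where

  ⟦⟧-⊞ : ∀ p q → ⟦ p ⊞ q ⟧ u ≗ ⟦ p ⟧ u ⊕ ⟦ q ⟧ u
  ⟦⟧-⊞ []      q       n = refl
  ⟦⟧-⊞ (a ∷ p) []      n = sym (+-identityʳ _)
  ⟦⟧-⊞ (a ∷ p) (b ∷ q) n = begin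
    const (a + b) n + (u ⊛ ⟦ p ⊞ q ⟧ u) n
      ≡⟨ cong₂ _+_ (const-+ n) (⊛-cong {u} (λ _ → refl) (⟦⟧-⊞ p q) n) ⟩
    (const a n + const b n) + (u ⊛ (⟦ p ⟧ u ⊕ ⟦ q ⟧ u)) n
      ≡⟨ cong (const a n + const b n +_) (⊛-distribˡ u (⟦ p ⟧ u) (⟦ q ⟧ u) n) ⟩
    (const a n + const b n) + ((u ⊛ ⟦ p ⟧ u) n + (u ⊛ ⟦ q ⟧ u) n)
      ≡⟨ lem (const a n) (const b n) _ _ ⟩
    (const a n + (u ⊛ ⟦ p ⟧ u) n) + (const b n + (u ⊛ ⟦ q ⟧ u) n) ∎
    where
    open ≡-Reasoning
    const-+ : const (a + b) ≗ const a ⊕ const b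
    const-+ zero    = refl
    const-+ (suc _) = refl
    lem : ∀ a b c d → (a + b) + (c + d) ≡ (a + c) + (b + d)
    lem = solve-∀

  ⟦⟧-map : ∀ c q → ⟦ map (c *_) q ⟧ u ≗ c · ⟦ q ⟧ u
  ⟦⟧-map c []      n = sym (*-zeroʳ c)
  ⟦⟧-map c (b ∷ q) n = begin
    const (c * b) n + (u ⊛ ⟦ map (c *_) q ⟧ u) n
      ≡⟨ cong₂ _+_ (const-* n) (⊛-cong {u} (λ _ → refl) (⟦⟧-map c q) n) ⟩
    c * const b n + (u ⊛ c · ⟦ q ⟧ u) n
      ≡⟨ cong (c * const b n +_) (trans (⊛-comm u _ n) (trans (⊛-scaleˡ c (⟦ q ⟧ u) u n)
           (cong (c *_) (⊛-comm (⟦ q ⟧ u) u n)))) ⟩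
    c * const b n + c * (u ⊛ ⟦ q ⟧ u) n
      ≡⟨ *-distribˡ-+ c (const b n) _ ⟨
    c * (const b n + (u ⊛ ⟦ q ⟧ u) n) ∎
    where
    open ≡-Reasoning
    const-* : const (c * b) ≗ c · const b
    const-* zero    = refl
    const-* (suc _) = sym (*-zeroʳ c)

  ⟦⟧-shift : ∀ p → ⟦ 0 ∷ p ⟧ u ≗ u ⊛ ⟦ p ⟧ u
  ⟦⟧-shift p zero    = refl
  ⟦⟧-shift p (suc n) = refl

  ⟦⟧-const : ∀ c → ⟦ c ∷ [] ⟧ u ≗ const c
  ⟦⟧-const c n = trans (cong (const c n +_) (⊛-zeroʳ u n)) (+-identityʳ _)

  ⟦⟧-⊠ : ∀ p q → ⟦ p ⊠ q ⟧ u ≗ ⟦ p ⟧ u ⊛ ⟦ q ⟧ u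
  ⟦⟧-⊠ []      q n = sym (⊛-zeroˡ (⟦ q ⟧ u) n)
  ⟦⟧-⊠ (a ∷ p) q n = begin
    ⟦ map (a *_) q ⊞ (0 ∷ p ⊠ q) ⟧ u n
      ≡⟨ ⟦⟧-⊞ (map (a *_) q) (0 ∷ p ⊠ q) n ⟩
    ⟦ map (a *_) q ⟧ u n + ⟦ 0 ∷ p ⊠ q ⟧ u n
      ≡⟨ cong₂ _+_ (trans (⟦⟧-map a q n) (sym (const-⊛ a (⟦ q ⟧ u) n))) (trans (⟦⟧-shift (p ⊠ q) n)
           (trans (⊛-cong {u} (λ _ → refl) (⟦⟧-⊠ p q) n) (sym (⊛-assoc u (⟦ p ⟧ u) (⟦ q ⟧ u) n)))) ⟩
    (const a ⊛ ⟦ q ⟧ u) n + (u ⊛ ⟦ p ⟧ u ⊛ ⟦ q ⟧ u) n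
      ≡⟨ ⊛-distribʳ (const a) (u ⊛ ⟦ p ⟧ u) (⟦ q ⟧ u) n ⟨
    (⟦ a ∷ p ⟧ u ⊛ ⟦ q ⟧ u) n ∎
    where open ≡-Reasoning

  isZero-sound : ∀ p → T (isZero p) → ⟦ p ⟧ u ≗ 𝟘
  isZero-sound []         _ n = refl
  isZero-sound (zero ∷ p) z n = trans (⟦⟧-shift p n)
    (trans (⊛-cong {u} (λ _ → refl) (isZero-sound p z) n) (⊛-zeroʳ u n))

  ==-sound : ∀ p q → T (p == q) → ⟦ p ⟧ u ≗ ⟦ q ⟧ u
  ==-sound []      q       e n = sym (isZero-sound q e n)
  ==-sound (a ∷ p) []      e n = isZero-sound (a ∷ p) e n
  ==-sound (a ∷ p) (b ∷ q) e n with ∧-split {a ≡ᵇ b} e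
  ... | e₁ , e₂ = cong₂ _+_ (cong (λ c → const c n) (≡ᵇ⇒≡ a b e₁))
                            (⊛-cong {u} (λ _ → refl) (==-sound p q e₂) n)

  ⟦⟧-when : ∀ b p → ⟦ whenᵖ b p ⟧ u ≗ when b (⟦ p ⟧ u)
  ⟦⟧-when true  p n = refl
  ⟦⟧-when false p n = refl

  ⟦⟧-∑ : ∀ {A : Set} (as : List A) f → ⟦ ∑ᵖ as f ⟧ u ≗ ∑ as (λ a → ⟦ f a ⟧ u)
  ⟦⟧-∑ []       f n = refl
  ⟦⟧-∑ (a ∷ as) f n = trans (⟦⟧-⊞ (f a) (∑ᵖ as f) n) (cong (⟦ f a ⟧ u n +_) (⟦⟧-∑ as f n))

⟦⟧-congₙ : ∀ p {u v n} → u ≈[ n ] v → ⟦ p ⟧ u ≈[ n ] ⟦ p ⟧ v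
⟦⟧-congₙ []      e i<n = refl
⟦⟧-congₙ (c ∷ p) e {i} i<n = cong (const c i +_) (⊛-congₙ e (⟦⟧-congₙ p e) i<n)

isOne : Poly → Bool
isOne (1 ∷ _) = true
isOne _       = false

-- The series t with t = x Φ (t)

module Inversion (Φ : Poly) where

  -- Fixed-point iteration: the factor x makes the first k coefficients of `approx k` final. Hence
  -- the diagonal `param` is well approximated by every `approx k`, and it inherits the equation.
  approx : ℕ → Series
  approx zero    = 𝟘
  approx (suc k) = X· (⟦ Φ ⟧ (approx k))

  approx-suc : ∀ k → approx k ≈[ k ] approx (suc k)
  approx-suc zero    ()
  approx-suc (suc k) = X·-congₙ (⟦⟧-congₙ Φ (approx-suc k))

  param : Series
  param n = approx (suc n) n

  param-approx : ∀ k → param ≈[ k ] approx k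
  param-approx (suc k) {i} i<1+k with m<1+n⇒m<n∨m≡n i<1+k
  ... | inj₁ i<k  = trans (param-approx k i<k) (approx-suc k i<k)
  ... | inj₂ refl = refl

  param-eq : X· (⟦ Φ ⟧ param) ≗ param
  param-eq n = trans (X·-congₙ (⟦⟧-congₙ Φ (param-approx n)) (≤-refl {suc n}))
                     (sym (param-approx (suc n) ≤-refl))

  eval : Poly → Series
  eval p = ⟦ p ⟧ param

  unital : ∀ p → T (isOne p) → eval p 0 ≡ 1
  unital (suc zero ∷ p) _ = refl

-- The system F q = c q + x ∑ F a F b, summed over the pairs with e a b q, has the solution
-- F q = N q (t) / D (t), where t = x Φ (t). Multiplying by D² Φ and using x Φ = t turns this into
-- an identity between polynomials in t.
module RationalSolution {A : Set} (N : List (A × Poly)) (c : A → ℕ) (e : A → A → A → Bool) (Φ D : Poly) where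
  open Inversion Φ

  rhs : A → Poly
  rhs q = ∑ᵖ N λ (a , p) → ∑ᵖ N λ (b , r) → whenᵖ (e a b q) (p ⊠ r)

  balanced : A × Poly → Bool
  balanced (q , p) = (Φ ⊠ (D ⊠ (D ⊠ (c q ∷ []))) ⊞ (0 ∷ rhs q)) == (Φ ⊠ (D ⊠ p))

  valid : Bool
  valid = isOne Φ ∧ isOne D ∧ all balanced N

  module _ (F : A → Series) where

    quadratic : A → Series
    quadratic q = ∑ N λ (a , _) → ∑ N λ (b , _) → when (e a b q) (F a ⊛ F b)

    module _ (ok : T valid) (system : All (λ (q , _) → F q ≗ const (c q) ⊕ X· (quadratic q)) N) where
      private
        d φ : Series
        d = eval D
        φ = eval Φ
        okΦ = proj₁ (∧-split {isOne Φ} ok)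
        okD = proj₁ (∧-split {isOne D} (proj₂ (∧-split {isOne Φ} ok)))
        okN = all⁺ balanced N (proj₂ (∧-split {isOne D} (proj₂ (∧-split {isOne Φ} ok))))
        _∙_ = trans
        infixr 4 _∙_

      eval-rhs : ∀ q → eval (rhs q) ≗ ∑ N λ (a , p) → ∑ N λ (b , r) → when (e a b q) (eval p ⊛ eval r)
      eval-rhs q n = ⟦⟧-∑ param N _ n ∙ ∑-congₙ N (All.tabulate λ {(a , p)} _ {i} _ →
        ⟦⟧-∑ param N _ i ∙ ∑-congₙ N (All.tabulate λ {(b , r)} _ {j} _ →
        ⟦⟧-when param (e a b q) (p ⊠ r) j ∙ when-cong (e a b q) (⟦⟧-⊠ param p r) j) (≤-refl {suc i})) (≤-refl {suc n})
        where
        when-cong : ∀ b {f g} → f ≗ g → when b f ≗ when b g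
        when-cong true  p n = p n
        when-cong false p n = refl

      regroup : ∀ f g → d ⊛ (d ⊛ (f ⊛ g)) ≗ (d ⊛ f) ⊛ (d ⊛ g)
      regroup f g n =
        ⊛-cong {d} (λ _ → refl) (λ i → sym (⊛-assoc d f g i) ∙ ⊛-cong (⊛-comm d f) (λ _ → refl) i ∙ ⊛-assoc f d g i) n
        ∙ sym (⊛-assoc d f (d ⊛ g) n)

      quadratic-step : ∀ {n} → All (λ (q , p) → d ⊛ F q ≈[ n ] eval p) N →
                       ∀ q → d ⊛ (d ⊛ quadratic q) ≈[ n ] eval (rhs q)
      quadratic-step {n} ih q {i} i<n =
        ⊛-cong {d} (λ _ → refl) (⊛-∑ d N _) i ∙ ⊛-∑ d N _ i ∙
        ∑-congₙ N (All.map (λ {(a , p)} da {j} j<n →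
          ⊛-cong {d} (λ _ → refl) (⊛-∑ d N _) j ∙ ⊛-∑ d N _ j ∙
          ∑-congₙ N (All.map (λ {(b , r)} db {k} k<n → gated (e a b q) da db k<n) ih) j<n) ih) i<n
        ∙ sym (eval-rhs q i)
        where
        gated : ∀ b {f g f′ g′} → d ⊛ f ≈[ n ] f′ → d ⊛ g ≈[ n ] g′ →
                d ⊛ (d ⊛ when b (f ⊛ g)) ≈[ n ] when b (f′ ⊛ g′)
        gated true  {f} {g} p r {k} k<n = regroup f g k ∙ ⊛-congₙ p r k<n
        gated false p r {k} k<n = ⊛-cong {d} (λ _ → refl) (⊛-zeroʳ d) k ∙ ⊛-zeroʳ d k

      balance : ∀ q p → T (balanced (q , p)) →
                φ ⊛ (d ⊛ (d ⊛ const (c q))) ⊕ param ⊛ eval (rhs q) ≗ φ ⊛ (d ⊛ eval p)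
      balance q p b n =
        cong₂ _+_ (sym (⟦⟧-⊠ param Φ _ n ∙ ⊛-cong {φ} (λ _ → refl) (λ i → ⟦⟧-⊠ param D _ i ∙
                     ⊛-cong {d} (λ _ → refl) (λ j → ⟦⟧-⊠ param D _ j ∙
                     ⊛-cong {d} (λ _ → refl) (⟦⟧-const param (c q)) j) i) n))
                  (sym (⟦⟧-shift param (rhs q) n))
        ∙ sym (⟦⟧-⊞ param (Φ ⊠ (D ⊠ (D ⊠ (c q ∷ [])))) (0 ∷ rhs q) n)
        ∙ ==-sound param (Φ ⊠ (D ⊠ (D ⊠ (c q ∷ []))) ⊞ (0 ∷ rhs q)) (Φ ⊠ (D ⊠ p)) b n
        ∙ ⟦⟧-⊠ param Φ _ n ∙ ⊛-cong {φ} (λ _ → refl) (⟦⟧-⊠ param D p) n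

      -- The quadratic part has a factor x, so the system computes coefficient n from the earlier
      -- ones, and a candidate that balances must agree with F one coefficient further. To compare
      -- them, both sides are multiplied by Φ D, and these factors are cancelled again at the same
      -- precision.
      step : ∀ {n} → All (λ (q , p) → d ⊛ F q ≈[ n ] eval p) N →
             ∀ {q p} → F q ≗ const (c q) ⊕ X· (quadratic q) → T (balanced (q , p)) →
             d ⊛ F q ≈[ suc n ] eval p
      step {n} ih {q} {p} sys bal =
        ⊛-cancelˡ (suc n) (unital D okD) (⊛-cancelˡ (suc n) (unital Φ okΦ) λ {i} i<1+n →
        ⊛-cong {φ} (λ _ → refl) (λ j →
            ⊛-cong {d} (λ _ → refl) (λ k → ⊛-cong {d} (λ _ → refl) sys k ∙ ⊛-distribˡ d _ _ k) j
            ∙ ⊛-distribˡ d _ _ j) i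
        ∙ ⊛-distribˡ φ _ _ i
        ∙ cong ((φ ⊛ (d ⊛ (d ⊛ const (c q)))) i +_)
            (⊛-cong {φ} (λ _ → refl) (λ j → ⊛-cong {d} (λ _ → refl) (⊛-X· d _) j ∙ ⊛-X· d _ j) i
            ∙ ⊛-congₙ {φ} (λ _ → refl) (X·-congₙ (quadratic-step ih q)) i<1+n
            -- The factor x moves over to Φ, where x Φ (t) is t.
            ∙ ⊛-X· φ _ i ∙ sym (X·-⊛ φ _ i)
            ∙ ⊛-cong param-eq (λ _ → refl) i)
        ∙ balance q p bal i)

      solved : ∀ n → All (λ (q , p) → d ⊛ F q ≈[ n ] eval p) N
      solved zero    = All.tabulate λ _ ()
      solved (suc n) = All.zipWith (λ {(q , p)} (sys , bal) {i} → step (solved n) {q} {p} sys bal {i}) (system , okN)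

      solution : All (λ (q , p) → d ⊛ F q ≗ eval p) N
      solution = All.tabulate λ {(q , p)} m n → All.lookup (solved (suc n)) m {n} ≤-refl

-- Binary trees and tree automata

data Tree : Set where
  leaf : Tree
  node : Tree → Tree → Tree

-- The summands are in inorder: left subtree, root, right subtree. Bounds on inorder numbers then
-- reduce to monotonicity of addition.
size : Tree → ℕ
size leaf       = 0
size (node l r) = size l + suc (size r)

node-injective : ∀ {l r l′ r′} → node l r ≡ node l′ r′ → l ≡ l′ × r ≡ r′
node-injective refl = refl , refl

conv : (f g : ℕ → List Tree) → ℕ → List Tree
conv f g zero    = cartesianProductWith node (f 0) (g 0)
conv f g (suc n) = cartesianProductWith node (f 0) (g (suc n)) ++ conv (f ∘ suc) g n

-- The first argument is fuel, sufficient when it exceeds the size.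
treesᶠ : ℕ → ℕ → List Tree
treesᶠ zero    _       = []
treesᶠ (suc k) zero    = leaf ∷ []
treesᶠ (suc k) (suc n) = conv (treesᶠ k) (treesᶠ k) n

trees : ℕ → List Tree
trees n = treesᶠ (suc n) n

conv-cong : ∀ {f f′ g g′} n → (∀ {i} → i ≤ n → f i ≡ f′ i) → (∀ {i} → i ≤ n → g i ≡ g′ i) →
            conv f g n ≡ conv f′ g′ n
conv-cong zero    p q = cong₂ (cartesianProductWith node) (p z≤n) (q z≤n)
conv-cong (suc n) p q = cong₂ _++_ (cong₂ (cartesianProductWith node) (p z≤n) (q ≤-refl))
                                   (conv-cong n (p ∘ s≤s) (q ∘ m≤n⇒m≤1+n))

treesᶠ-fuel : ∀ {k k′ n} → n < k → n < k′ → treesᶠ k n ≡ treesᶠ k′ n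
treesᶠ-fuel {suc k} {suc k′} {zero}  _ _ = refl
treesᶠ-fuel {suc k} {suc k′} {suc n} (s≤s p) (s≤s q) =
  conv-cong n (λ i≤n → treesᶠ-fuel (≤-<-trans i≤n p) (≤-<-trans i≤n q))
              (λ i≤n → treesᶠ-fuel (≤-<-trans i≤n p) (≤-<-trans i≤n q))

trees-suc : ∀ n → trees (suc n) ≡ conv trees trees n
trees-suc n = conv-cong n (λ i≤n → treesᶠ-fuel (s≤s i≤n) ≤-refl) (λ i≤n → treesᶠ-fuel (s≤s i≤n) ≤-refl)

∈-conv⁺ : ∀ {f g l r} i {j} → l ∈ f i → r ∈ g j → node l r ∈ conv f g (i + j)
∈-conv⁺ zero    {zero}  p q = ∈-cartesianProductWith⁺ node p q
∈-conv⁺ zero    {suc j} p q = ∈-++⁺ˡ (∈-cartesianProductWith⁺ node p q)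
∈-conv⁺ {f} {g} (suc i) p q = ∈-++⁺ʳ (cartesianProductWith node (f 0) (g _)) (∈-conv⁺ {f ∘ suc} i p q)

record ConvSplit (f g : ℕ → List Tree) (n : ℕ) (t : Tree) : Set where
  constructor split
  field
    {i j} : ℕ
    {l r} : Tree
    i+j≡n : i + j ≡ n
    t≡lr  : t ≡ node l r
    l∈    : l ∈ f i
    r∈    : r ∈ g j

∈-conv⁻ : ∀ {f g} n {t} → t ∈ conv f g n → ConvSplit f g n t
∈-conv⁻ {f} {g} zero    m with ∈-cartesianProductWith⁻ node (f 0) (g 0) m
... | l , r , l∈ , r∈ , e = split refl e l∈ r∈
∈-conv⁻ {f} {g} (suc n) m with ∈-++⁻ (cartesianProductWith node (f 0) (g (suc n))) m
... | inj₁ m′ with ∈-cartesianProductWith⁻ node (f 0) (g (suc n)) m′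
...   | l , r , l∈ , r∈ , e = split refl e l∈ r∈
∈-conv⁻ {f} {g} (suc n) m | inj₂ m′ with ∈-conv⁻ n m′
...   | split e e′ l∈ r∈ = split (cong suc e) e′ l∈ r∈

∈-treesᶠ⇒size : ∀ k {n t} → t ∈ treesᶠ k n → size t ≡ n
∈-treesᶠ⇒size (suc k) {zero}  (here refl) = refl
∈-treesᶠ⇒size (suc k) {suc n} m with ∈-conv⁻ n m
... | split {l = l} {r} e refl l∈ r∈ = trans (+-suc (size l) (size r))
  (cong suc (trans (cong₂ _+_ (∈-treesᶠ⇒size k l∈) (∈-treesᶠ⇒size k r∈)) e))

∈-trees⇒size : ∀ {n t} → t ∈ trees n → size t ≡ n
∈-trees⇒size {n} = ∈-treesᶠ⇒size (suc n)

∈-trees : ∀ t → t ∈ trees (size t)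
∈-trees leaf       = here refl
∈-trees (node l r) rewrite +-suc (size l) (size r) | trees-suc (size l + size r) =
  ∈-conv⁺ (size l) (∈-trees l) (∈-trees r)

-- Different summands of the convolution share no tree, because the left subtree determines the
-- index of its list; the last hypothesis provides this, and for trees the index is the size.
conv-unique : ∀ {f g} n → (∀ i → Unique (f i)) → (∀ i → Unique (g i)) →
              (∀ {i j t} → t ∈ f i → t ∈ f j → i ≡ j) → Unique (conv f g n)
conv-unique zero    uf ug _ = Unique.cartesianProductWith⁺ node node-injective (uf 0) (ug 0)
conv-unique {f} {g} (suc n) uf ug d =
  Unique.++⁺ (Unique.cartesianProductWith⁺ node node-injective (uf 0) (ug (suc n)))
             (conv-unique n (uf ∘ suc) ug (λ p q → suc-injective (d p q))) disjoint
  where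
  disjoint : Disjoint (cartesianProductWith node (f 0) (g (suc n))) (conv (f ∘ suc) g n)
  disjoint (m₁ , m₂) with ∈-cartesianProductWith⁻ node (f 0) (g (suc n)) m₁ | ∈-conv⁻ n m₂
  ... | _ , _ , l∈ , _ , refl | split _ refl l∈′ _ with () ← d l∈ l∈′

treesᶠ-unique : ∀ k n → Unique (treesᶠ k n)
treesᶠ-unique zero    n       = []
treesᶠ-unique (suc k) zero    = [] ∷ []
treesᶠ-unique (suc k) (suc n) = conv-unique n (treesᶠ-unique k) (treesᶠ-unique k)
  (λ p q → trans (sym (∈-treesᶠ⇒size k p)) (∈-treesᶠ⇒size k q))

trees-unique : ∀ n → Unique (trees n)
trees-unique n = treesᶠ-unique (suc n) n

-- Weighted enumeration

total : ∀ {A : Set} → (A → ℕ) → List A → ℕ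
total w []       = 0
total w (x ∷ xs) = w x + total w xs

gf : (Tree → ℕ) → Series
gf w n = total w (trees n)

module _ {A : Set} where

  total-cong : ∀ {v w : A → ℕ} → v ≗ w → total v ≗ total w
  total-cong p []       = refl
  total-cong p (x ∷ xs) = cong₂ _+_ (p x) (total-cong p xs)

  total-++ : ∀ (w : A → ℕ) xs ys → total w (xs ++ ys) ≡ total w xs + total w ys
  total-++ w []       ys = refl
  total-++ w (x ∷ xs) ys = trans (cong (w x +_) (total-++ w xs ys)) (sym (+-assoc (w x) _ _))

  total-zero : ∀ (xs : List A) → total (λ _ → 0) xs ≡ 0
  total-zero []       = refl
  total-zero (_ ∷ xs) = total-zero xs

  total-+ : ∀ (v w : A → ℕ) xs → total (λ x → v x + w x) xs ≡ total v xs + total w xs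
  total-+ v w []       = refl
  total-+ v w (x ∷ xs) = trans (cong (v x + w x +_) (total-+ v w xs)) (lem (v x) (w x) _ _)
    where lem : ∀ a b c d → a + b + (c + d) ≡ a + c + (b + d)
          lem = solve-∀

  total-* : ∀ c (w : A → ℕ) xs → total (λ x → c * w x) xs ≡ c * total w xs
  total-* c w []       = sym (*-zeroʳ c)
  total-* c w (x ∷ xs) = trans (cong (c * w x +_) (total-* c w xs)) (sym (*-distribˡ-+ c (w x) _))

  total-total : ∀ {B : Set} (w : B → A → ℕ) bs xs →
                total (λ x → total (λ b → w b x) bs) xs ≡ total (λ b → total (w b) xs) bs
  total-total w []       xs = total-zero xs
  total-total w (b ∷ bs) xs = trans (total-+ (w b) _ xs) (cong (total (w b) xs +_) (total-total w bs xs))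

  ∑≗total : ∀ as (f : A → Series) n → ∑ as f n ≡ total (λ a → f a n) as
  ∑≗total []       f n = refl
  ∑≗total (a ∷ as) f n = cong (f a n +_) (∑≗total as f n)

total-map : ∀ {A B : Set} (w : B → ℕ) (h : A → B) xs → total w (map h xs) ≡ total (w ∘ h) xs
total-map w h []       = refl
total-map w h (x ∷ xs) = cong (w (h x) +_) (total-map w h xs)

pairs : (Tree → Tree → ℕ) → List Tree → List Tree → ℕ
pairs w ls rs = total (λ l → total (w l) rs) ls

total-cartesian : ∀ w ls rs → total w (cartesianProductWith node ls rs) ≡ pairs (λ l r → w (node l r)) ls rs
total-cartesian w []       rs = refl
total-cartesian w (l ∷ ls) rs = trans (total-++ w (map (node l) rs) _)
  (cong₂ _+_ (total-map w (node l) rs) (total-cartesian w ls rs))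

-- The weight of a pair of subtrees need not be a product. The weight used later, whether the two
-- runs combine to a given state, is first written as a sum over pairs of states (`convTotal-∑`),
-- and each summand is a product (`convTotal-⊛`).
convTotal : (Tree → Tree → ℕ) → (f g : ℕ → List Tree) → Series
convTotal w f g zero    = pairs w (f 0) (g 0)
convTotal w f g (suc n) = pairs w (f 0) (g (suc n)) + convTotal w (f ∘ suc) g n

total-conv : ∀ w f g n → total w (conv f g n) ≡ convTotal (λ l r → w (node l r)) f g n
total-conv w f g zero    = total-cartesian w (f 0) (g 0)
total-conv w f g (suc n) = trans (total-++ w (cartesianProductWith node (f 0) (g (suc n))) _)
  (cong₂ _+_ (total-cartesian w (f 0) (g (suc n))) (total-conv w (f ∘ suc) g n))

convTotal-cong : ∀ {v w : Tree → Tree → ℕ} → (∀ l r → v l r ≡ w l r) → ∀ f g → convTotal v f g ≗ convTotal w f g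
convTotal-cong p f g zero    = total-cong (λ l → total-cong (p l) (g 0)) (f 0)
convTotal-cong p f g (suc n) = cong₂ _+_ (total-cong (λ l → total-cong (p l) (g (suc n))) (f 0))
                                         (convTotal-cong p (f ∘ suc) g n)

pairs-∑ : ∀ {A : Set} (w : A → Tree → Tree → ℕ) as ls rs →
          pairs (λ l r → total (λ a → w a l r) as) ls rs ≡ total (λ a → pairs (w a) ls rs) as
pairs-∑ w as ls rs = trans (total-cong (λ l → total-total (λ a → w a l) as rs) ls)
                           (total-total (λ a l → total (w a l) rs) as ls)

convTotal-∑ : ∀ {A : Set} (w : A → Tree → Tree → ℕ) as f g →
              convTotal (λ l r → total (λ a → w a l r) as) f g ≗ ∑ as (λ a → convTotal (w a) f g)
convTotal-∑ w as f g zero    = trans (pairs-∑ w as (f 0) (g 0)) (sym (∑≗total as _ 0))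
convTotal-∑ w as f g (suc n) = begin
  pairs (λ l r → total (λ a → w a l r) as) (f 0) (g (suc n)) + convTotal _ (f ∘ suc) g n
    ≡⟨ cong₂ _+_ (pairs-∑ w as (f 0) (g (suc n)))
         (trans (convTotal-∑ w as (f ∘ suc) g n) (∑≗total as _ n)) ⟩
  total (λ a → pairs (w a) (f 0) (g (suc n))) as + total (λ a → convTotal (w a) (f ∘ suc) g n) as
    ≡⟨ total-+ _ _ as ⟨
  total (λ a → convTotal (w a) f g (suc n)) as
    ≡⟨ ∑≗total as _ (suc n) ⟨
  ∑ as (λ a → convTotal (w a) f g) (suc n) ∎
  where open ≡-Reasoning

pairs-⊛ : ∀ (u v : Tree → ℕ) ls rs → pairs (λ l r → u l * v r) ls rs ≡ total u ls * total v rs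
pairs-⊛ u v ls rs = begin
  total (λ l → total (λ r → u l * v r) rs) ls ≡⟨ total-cong (λ l → total-* (u l) v rs) ls ⟩
  total (λ l → u l * total v rs) ls           ≡⟨ total-cong (λ l → *-comm (u l) _) ls ⟩
  total (λ l → total v rs * u l) ls           ≡⟨ total-* (total v rs) u ls ⟩
  total v rs * total u ls                     ≡⟨ *-comm (total v rs) _ ⟩
  total u ls * total v rs                     ∎
  where open ≡-Reasoning

convTotal-⊛ : ∀ (u v : Tree → ℕ) f g → convTotal (λ l r → u l * v r) f g ≗ (total u ∘ f) ⊛ (total v ∘ g)
convTotal-⊛ u v f g zero    = pairs-⊛ u v (f 0) (g 0)
convTotal-⊛ u v f g (suc n) = cong₂ _+_ (pairs-⊛ u v (f 0) (g (suc n))) (convTotal-⊛ u v (f ∘ suc) g n)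

gf-cong : ∀ {v w} → v ≗ w → gf v ≗ gf w
gf-cong p n = total-cong p (trees n)

gf-total : ∀ {A : Set} (w : A → Tree → ℕ) as → gf (λ t → total (λ a → w a t) as) ≗ ∑ as (λ a → gf (w a))
gf-total w as n = trans (total-total w as (trees n)) (sym (∑≗total as _ n))

gf-node : ∀ w → gf w ≗ const (w leaf) ⊕ X· (convTotal (λ l r → w (node l r)) trees trees)
gf-node w zero    = refl
gf-node w (suc n) = trans (cong (total w) (trees-suc n)) (total-conv w trees trees n)

ind : Bool → ℕ
ind true  = 1
ind false = 0

length-filterᵇ : ∀ {A : Set} (p : A → Bool) xs → length (filterᵇ p xs) ≡ total (ind ∘ p) xs
length-filterᵇ p []       = refl
length-filterᵇ p (x ∷ xs) with p x
... | true  = cong suc (length-filterᵇ p xs)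
... | false = length-filterᵇ p xs

-- Bottom-up tree automata

record Automaton (S : Set) : Set where
  constructor automaton
  field
    init : S
    δ    : S → S → S

  run : Tree → S
  run leaf       = init
  run (node l r) = δ (run l) (run r)

infixr 5 _⊗_

_⊗_ : ∀ {S S′} → Automaton S → Automaton S′ → Automaton (S × S′)
automaton i δ ⊗ automaton i′ δ′ =
  automaton (i , i′) λ (s , s′) (t , t′) → δ s t , δ′ s′ t′

run-⊗ : ∀ {S S′} (A : Automaton S) (B : Automaton S′) t →
        Automaton.run (A ⊗ B) t ≡ (Automaton.run A t , Automaton.run B t)
run-⊗ A B leaf       = refl
run-⊗ A B (node l r) rewrite run-⊗ A B l | run-⊗ A B r = refl

module Reachability {S : Set} (_==ˢ_ : S → S → Bool) (sound : ∀ {s t} → T (s ==ˢ t) → s ≡ t)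
                    (A : Automaton S) where
  open Automaton A

  member : S → List S → Bool
  member s []       = false
  member s (t ∷ ts) = if s ==ˢ t then true else member s ts

  member-sound : ∀ s ts → T (member s ts) → s ∈ ts
  member-sound s (t ∷ ts) m with s ==ˢ t in eq
  ... | true  = here (sound (subst T (sym eq) tt))
  ... | false = there (member-sound s ts m)

  saturate : ℕ → List S → List S → List S
  saturate zero    todo       seen = seen
  saturate (suc k) []         seen = seen
  saturate (suc k) (s ∷ todo) seen =
    if member s seen then saturate k todo seen
    else saturate k (concatMap (λ t → δ s t ∷ δ t s ∷ []) (s ∷ seen) ++ todo) (s ∷ seen)

  -- The fuel bounds the number of transitions out of pairs of reachable states.
  opaque
    states : List S
    states = saturate 400 (init ∷ []) []

  closed : List S → Bool
  closed L = member init L ∧ all (λ a → all (λ b → member (δ a b) L) L) L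

  -- Closure is tested on the finished list, so that nothing has to be proved about the search that
  -- produced it.
  run∈ : ∀ L → T (closed L) → ∀ t → run t ∈ L
  run∈ L c leaf       = member-sound init L (proj₁ (∧-split {member init L} c))
  run∈ L c (node l r) = member-sound _ L
    (All.lookup (all⁺ _ L (All.lookup (all⁺ _ L (proj₂ (∧-split {member init L} c))) (run∈ L c l))) (run∈ L c r))

-- Generating functions of the states of an automaton

module StateSeries {S : Set} (_==ˢ_ : S → S → Bool) (A : Automaton S) (acc : S → Bool)
                   (N : List (S × Poly)) (Φ D : Poly) where
  open Automaton A
  open RationalSolution N (λ q → ind (init ==ˢ q)) (λ a b q → δ a b ==ˢ q) Φ D public using (valid; quadratic; solution)
  open Inversion Φ

  -- On reachable states that pass `covering`, this is the indicator of δ s t being q, written as a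
  -- sum over the listed states a and b alone. It makes the system quadratic in the listed series,
  -- with no contribution from omitted states.
  splits : S → S → S → ℕ
  splits s t q = total (λ (a , _) → total (λ (b , _) →
    ind ((s ==ˢ a) ∧ ((t ==ˢ b) ∧ (δ a b ==ˢ q)))) N) N

  accepts : S → ℕ
  accepts s = total (λ (a , _) → ind ((s ==ˢ a) ∧ acc a)) N

  -- Every state outside N leads only to states outside N, and is not accepting.
  covering : List S → Bool
  covering L = all (λ s → (ind (acc s) ≡ᵇ accepts s) ∧
             all (λ t → all (λ (q , _) → ind (δ s t ==ˢ q) ≡ᵇ splits s t q) N) L) L

  numerator : Poly
  numerator = ∑ᵖ N (λ (a , p) → whenᵖ (acc a) p)

  module _ (L : List S) (run∈ : ∀ t → run t ∈ L) (ok : T (covering L)) where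

    F : S → Series
    F q = gf (λ t → ind (run t ==ˢ q))

    cov : ∀ {s} → s ∈ L → T (ind (acc s) ≡ᵇ accepts s) ×
          T (all (λ t → all (λ (q , _) → ind (δ s t ==ˢ q) ≡ᵇ splits s t q) N) L)
    cov {s} s∈ = ∧-split {ind (acc s) ≡ᵇ accepts s} (All.lookup (all⁺ _ L ok) s∈)

    splits-≡ : ∀ {s t q p} → s ∈ L → t ∈ L → (q , p) ∈ N → ind (δ s t ==ˢ q) ≡ splits s t q
    splits-≡ s∈ t∈ q∈ = ≡ᵇ⇒≡ _ _ (All.lookup (all⁺ _ N (All.lookup (all⁺ _ L (proj₂ (cov s∈))) t∈)) q∈)

    gated : ∀ x y z → ind (x ∧ (y ∧ z)) ≡ (if z then ind x * ind y else 0)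
    gated false _     false = refl
    gated false _     true  = refl
    gated true  false false = refl
    gated true  false true  = refl
    gated true  true  false = refl
    gated true  true  true  = refl

    system : ∀ {q p} → (q , p) ∈ N → F q ≗ const (ind (init ==ˢ q)) ⊕ X· (quadratic F q)
    system {q} q∈ n = trans (gf-node _ n) (cong (const (ind (init ==ˢ q)) n +_) (shifted n))
      where
      summand : ∀ a b → convTotal (λ l r → ind ((run l ==ˢ a) ∧ ((run r ==ˢ b) ∧ (δ a b ==ˢ q)))) trees trees
                ≗ when (δ a b ==ˢ q) (F a ⊛ F b)
      summand a b m with δ a b ==ˢ q
      ... | true  = trans (convTotal-cong (λ l r → gated (run l ==ˢ a) (run r ==ˢ b) true) trees trees m)
                          (convTotal-⊛ _ _ trees trees m)
      -- The zero weight is a sum over the empty list, and so is its series.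
      ... | false = trans (convTotal-cong (λ l r → gated (run l ==ˢ a) (run r ==ˢ b) false) trees trees m)
                          (convTotal-∑ (λ (_ : Tree) _ _ → 0) [] trees trees m)
      body : convTotal (λ l r → ind (δ (run l) (run r) ==ˢ q)) trees trees ≗ quadratic F q
      body m = trans (convTotal-cong (λ l r → splits-≡ (run∈ l) (run∈ r) q∈) trees trees m)
        (trans (convTotal-∑ _ N trees trees m) (∑-congₙ N (All.tabulate λ {(a , _)} _ {i} _ →
          trans (convTotal-∑ _ N trees trees i)
                (∑-congₙ N (All.tabulate λ {(b , _)} _ {j} _ → summand a b j) (≤-refl {suc i}))) (≤-refl {suc m})))
      shifted : X· (convTotal (λ l r → ind (δ (run l) (run r) ==ˢ q)) trees trees) ≗ X· (quadratic F q)
      shifted zero    = refl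
      shifted (suc m) = body m

    accepted : gf (ind ∘ acc ∘ run) ≗ ∑ N (λ (a , _) → when (acc a) (F a))
    accepted n = trans (gf-cong (λ t → ≡ᵇ⇒≡ _ _ (proj₁ (cov (run∈ t)))) n)
      (trans (gf-total _ N n) (∑-congₙ N (All.tabulate λ {(a , _)} _ {i} _ → gate a i) (≤-refl {suc n})))
      where
      gate : ∀ a → gf (λ t → ind ((run t ==ˢ a) ∧ acc a)) ≗ when (acc a) (F a)
      gate a i with acc a
      ... | true  = gf-cong (λ t → cong ind (∧-true (run t ==ˢ a))) i
        where ∧-true : ∀ b → b ∧ true ≡ b
              ∧-true true  = refl
              ∧-true false = refl
      ... | false = trans (gf-cong (λ t → cong ind (∧-false (run t ==ˢ a))) i) (total-zero (trees i))
        where ∧-false : ∀ b → b ∧ false ≡ false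
              ∧-false true  = refl
              ∧-false false = refl

    accepted-rational : T valid → eval D ⊛ gf (ind ∘ acc ∘ run) ≗ eval numerator
    accepted-rational v n = begin
      (eval D ⊛ gf (ind ∘ acc ∘ run)) n                  ≡⟨ ⊛-cong {eval D} (λ _ → refl) accepted n ⟩
      (eval D ⊛ ∑ N (λ (a , _) → when (acc a) (F a))) n  ≡⟨ ⊛-∑ (eval D) N _ n ⟩
      ∑ N (λ (a , _) → eval D ⊛ when (acc a) (F a)) n    ≡⟨ ∑-congₙ N (All.map (λ {(a , p)} e {i} _ → gate a p e i)
                                                              (solution F v (All.tabulate λ {(q , p)} q∈ → system q∈))) (≤-refl {suc n}) ⟩
      ∑ N (λ (a , p) → eval (whenᵖ (acc a) p)) n         ≡⟨ ⟦⟧-∑ param N _ n ⟨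
      eval numerator n ∎
      where
      open ≡-Reasoning
      gate : ∀ a p → eval D ⊛ F a ≗ eval p → eval D ⊛ when (acc a) (F a) ≗ eval (whenᵖ (acc a) p)
      gate a p e i with acc a
      ... | true  = e i
      ... | false = ⊛-zeroʳ (eval D) i

-- Cross-multiplication of f = P / D and g = P′ / D′, both functions of the same parameter t.
rational-unique : ∀ Φ {D D′ P P′} {f g : Series} → let open Inversion Φ in
                  eval D ⊛ f ≗ eval P → eval D′ ⊛ g ≗ eval P′ →
                  T (isOne D ∧ (isOne D′ ∧ ((D′ ⊠ P) == (D ⊠ P′)))) → f ≗ g
rational-unique Φ {D} {D′} {P} {P′} {f} {g} p q ok =
  ⊛-cancelˡ-≗ (unital D okD) (⊛-cancelˡ-≗ (unital D′ okD′) λ n → begin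
    (eval D′ ⊛ (eval D ⊛ f)) n  ≡⟨ ⊛-cong {eval D′} (λ _ → refl) p n ⟩
    (eval D′ ⊛ eval P) n        ≡⟨ ⟦⟧-⊠ param D′ P n ⟨
    eval (D′ ⊠ P) n             ≡⟨ ==-sound param (D′ ⊠ P) (D ⊠ P′) ok= n ⟩
    eval (D ⊠ P′) n             ≡⟨ ⟦⟧-⊠ param D P′ n ⟩
    (eval D ⊛ eval P′) n        ≡⟨ ⊛-cong {eval D} (λ _ → refl) q n ⟨
    (eval D ⊛ (eval D′ ⊛ g)) n  ≡⟨ ⊛-assoc (eval D) (eval D′) g n ⟨
    (eval D ⊛ eval D′ ⊛ g) n    ≡⟨ ⊛-cong (⊛-comm (eval D) (eval D′)) (λ _ → refl) n ⟩
    (eval D′ ⊛ eval D ⊛ g) n    ≡⟨ ⊛-assoc (eval D′) (eval D) g n ⟩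
    (eval D′ ⊛ (eval D ⊛ g)) n  ∎)
  where
  open ≡-Reasoning
  open Inversion Φ
  okD  = proj₁ (∧-split {isOne D} ok)
  okD′ = proj₁ (∧-split {isOne D′} (proj₂ (∧-split {isOne D} ok)))
  ok=  = proj₂ (∧-split {isOne D′} (proj₂ (∧-split {isOne D} ok)))

-- Occurrences of a mesh pattern of length 2 in a tree

data Node : Tree → Set where
  inL  : ∀ {l r} → Node l → Node (node l r)
  root : ∀ {l r} → Node (node l r)
  inR  : ∀ {l r} → Node r → Node (node l r)

data Direction : Set where
  same sw nw se ne : Direction

-- Where the second node lies as seen from the first, in the plot of the permutation whose
-- positions are given by inorder and whose values are given by postorder.
direction : ∀ {t} → Node t → Node t → Direction
direction (inL x) (inL y) = direction x y
direction (inL x) root    = ne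
direction (inL x) (inR y) = ne
direction root    (inL y) = sw
direction root    root    = same
direction root    (inR y) = se
direction (inR x) (inL y) = sw
direction (inR x) root    = nw
direction (inR x) (inR y) = direction x y

data Order : Set where
  lt eq gt : Order

horizontal vertical : Direction → Order
horizontal same = eq
horizontal sw   = lt
horizontal nw   = lt
horizontal se   = gt
horizontal ne   = gt
vertical same = eq
vertical sw   = lt
vertical nw   = gt
vertical se   = lt
vertical ne   = gt

data Kind : Set where
  asc desc : Kind

-- Which of the three gaps between two coordinates m < n contains a third one, given its
-- comparison with m and with n.
gap : Order → Order → Maybe (Fin 3)
gap lt _  = just 0F
gap gt lt = just 1F
gap gt gt = just 2F
gap gt eq = nothing
gap eq _  = nothing

-- The first point is always the left one. In a descent it is the upper one, so the rows are bounded
-- by the second point and then the first.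
column row : Kind → Direction → Direction → Maybe (Fin 3)
column _    a b = gap (horizontal a) (horizontal b)
row    asc  a b = gap (vertical a) (vertical b)
row    desc a b = gap (vertical b) (vertical a)

-- The boxes are open: a node that shares a coordinate with one of the two points lies in none of
-- them and cannot violate the shading.
unshaded : Shading 2 → Maybe (Fin 3) → Maybe (Fin 3) → Bool
unshaded R (just i) (just j) = not (lookup (lookup R i) j)
unshaded R (just i) nothing  = true
unshaded R nothing  _        = true

pairDirection : Kind → Direction → Bool
pairDirection asc  ne = true
pairDirection desc se = true
pairDirection _    _  = false

pair-sw : ∀ k → pairDirection k sw ≡ false
pair-sw asc  = refl
pair-sw desc = refl

pair-nw : ∀ k → pairDirection k nw ≡ false
pair-nw asc  = refl
pair-nw desc = refl

pair-same : ∀ k → pairDirection k same ≡ false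
pair-same asc  = refl
pair-same desc = refl

allowed : Kind → Shading 2 → Direction → Direction → Bool
allowed k R a b = unshaded R (column k a b) (row k a b)

some every : ∀ t → (Node t → Bool) → Bool
some leaf       f = false
some (node l r) f = some l (f ∘ inL) ∨ (f root ∨ some r (f ∘ inR))
every leaf       f = true
every (node l r) f = every l (f ∘ inL) ∧ (f root ∧ every r (f ∘ inR))

isLeaf : Tree → Bool
isLeaf leaf       = true
isLeaf (node _ _) = false

some-cong : ∀ t {f g : Node t → Bool} → f ≗ g → some t f ≡ some t g
some-cong leaf       p = refl
some-cong (node l r) p = cong₂ _∨_ (some-cong l (p ∘ inL)) (cong₂ _∨_ (p root) (some-cong r (p ∘ inR)))

-- Seen from points outside, all nodes of a subtree lie in the same direction, so the condition on
-- them is a constant b, vacuous when there are no nodes. This is why a state must record whether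
-- the tree is empty.
every-const : ∀ t b → every t (λ _ → b) ≡ isLeaf t ∨ b
every-const leaf       b     = refl
every-const (node l r) false = ∧-zeroʳ (every l (λ _ → false))
every-const (node l r) true  rewrite every-const l true | every-const r true | ∨-zeroʳ (isLeaf l) = ∨-zeroʳ (isLeaf r)

some-false : ∀ t → some t (λ _ → false) ≡ false
some-false leaf       = refl
some-false (node l r) = cong₂ _∨_ (some-false l) (some-false r)

some-∨ : ∀ t (f g : Node t → Bool) → some t (λ x → f x ∨ g x) ≡ some t f ∨ some t g
some-∨ leaf       f g = refl
some-∨ (node l r) f g rewrite some-∨ l (f ∘ inL) (g ∘ inL) | some-∨ r (f ∘ inR) (g ∘ inR) =
  lem (some l (f ∘ inL)) (some l (g ∘ inL)) (f root) (g root) (some r (f ∘ inR)) (some r (g ∘ inR))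
  where
  lem : ∀ a a′ b b′ c c′ → (a ∨ a′) ∨ ((b ∨ b′) ∨ (c ∨ c′)) ≡ (a ∨ (b ∨ c)) ∨ (a′ ∨ (b′ ∨ c′))
  lem true  a′    b     b′    c     c′ = refl
  lem false true  true  b′    c     c′ = refl
  lem false true  false b′    true  c′ = refl
  lem false true  false true  false c′ = refl
  lem false true  false false false c′ = refl
  lem false false true  b′    c     c′ = refl
  lem false false false true  true  c′ = refl
  lem false false false true  false c′ = refl
  lem false false false false c     c′ = refl

some-∧ : ∀ t (f : Node t → Bool) b → some t (λ x → f x ∧ b) ≡ some t f ∧ b
some-∧ t f true  = trans (some-cong t (∧-identityʳ ∘ f)) (sym (∧-identityʳ _))
some-∧ t f false = trans (some-cong t (∧-zeroʳ ∘ f)) (trans (some-false t) (sym (∧-zeroʳ _)))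

∧-some : ∀ t (f : Node t → Bool) b → some t (λ x → b ∧ f x) ≡ b ∧ some t f
∧-some t f true  = refl
∧-some t f false = some-false t

-- What an occurrence demands of a subtree that contains only one of its two points: the other point
-- sees all nodes in one direction, which is built into g.
point : (Direction → Bool) → Tree → Bool
point g t = some t λ x → every t λ z → g (direction x z)

point-step : (Direction → Bool) → (eL pL eR pR : Bool) → Bool
point-step g eL pL eR pR =
  (pL ∧ (g ne ∧ (eR ∨ g ne))) ∨
  (((eL ∨ g sw) ∧ (g same ∧ (eR ∨ g se))) ∨ (pR ∧ ((eL ∨ g sw) ∧ g nw)))

point-node : ∀ g l r → point g (node l r) ≡ point-step g (isLeaf l) (point g l) (isLeaf r) (point g r)
point-node g l r = cong₂ _∨_
  (trans (some-∧ l _ _) (cong (λ b → point g l ∧ (g ne ∧ b)) (every-const r (g ne))))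
  (cong₂ _∨_
    (cong₂ (λ a b → a ∧ (g same ∧ b)) (every-const l (g sw)) (every-const r (g se)))
    (trans (some-cong r (λ x → lem (every l (λ _ → g sw)) (g nw) _))
      (trans (some-∧ r _ _) (cong (λ a → point g r ∧ (a ∧ g nw)) (every-const l (g sw))))))
  where
  lem : ∀ a b c → a ∧ (b ∧ c) ≡ c ∧ (a ∧ b)
  lem a b c = trans (sym (∧-assoc a b c)) (∧-comm (a ∧ b) c)

module _ (k : Kind) (R : Shading 2) where
  private
    c = pairDirection k
    h = allowed k R

  occurs : Tree → Bool
  occurs t = some t λ x → some t λ y → c (direction x y) ∧ every t λ z → h (direction x z) (direction y z)

  -- p, q and s say whether one of the two points of an occurrence can be chosen, the other
  -- one being outside the left, right or right subtree respectively.
  occurs-step : (eL p oL eR q s oR : Bool) → Bool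
  occurs-step eL p oL eR q s oR =
    ((oL ∧ (h ne ne ∧ (eR ∨ h ne ne))) ∨
      ((p ∧ (h ne same ∧ (eR ∨ h ne se))) ∨ (p ∧ (h ne nw ∧ q)))) ∨
    ((s ∧ ((eL ∨ h sw sw) ∧ h same nw)) ∨ (oR ∧ ((eL ∨ h sw sw) ∧ h nw nw)))

  -- The condition `h` with the view of the outside point fixed. Nodes of the left subtree lie `sw`
  -- of a second point that is the root or in the right subtree; nodes of the right subtree lie `ne`
  -- of a first point in the left subtree, and `se` of a first point at the root.
  below left right : Direction → Bool
  below d = h d sw
  left  d = h ne d
  right d = h se d

  -- Each of the two points is in the left subtree, at the root or in the right subtree. Four of the
  -- nine cases vanish because the second point would not be to the right of the first; the other
  -- five are the summands of `occurs-step`.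
  occurs-node : ∀ l r → occurs (node l r) ≡
    occurs-step (isLeaf l) (c ne ∧ point below l) (occurs l)
                (isLeaf r) (c ne ∧ point left r) (c se ∧ point right r) (occurs r)
  occurs-node l r = cong₂ _∨_ fromLeft (cong₂ _∨_ fromRoot fromRight)
    where
    e : Tree → Bool
    e = isLeaf
    no-c : ∀ {d} → c d ≡ false → ∀ t (f : Node t → Bool) → some t (λ y → c d ∧ f y) ≡ false
    no-c p t f = trans (some-cong t (λ y → cong (_∧ f y) p)) (some-false t)
    swap : ∀ a b d → a ∧ (b ∧ d) ≡ d ∧ (a ∧ b)
    swap a b d = trans (sym (∧-assoc a b d)) (∧-comm (a ∧ b) d)

    RootL RootRoot RootR : Bool
    RootL    = some l λ y → c sw ∧ (every l (λ z → h sw (direction y z)) ∧ (h same ne ∧ every r (λ _ → h se ne)))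
    RootRoot = c same ∧ (every l (λ _ → h sw sw) ∧ (h same same ∧ every r (λ _ → h se se)))
    RootR    = some r λ y → c se ∧ (every l (λ _ → h sw sw) ∧ (h same nw ∧ every r (λ z → h se (direction y z))))
    RL : Node r → Node l → Bool
    RL x y = c sw ∧ (every l (λ z → h sw (direction y z)) ∧ (h nw ne ∧ every r (λ z → h (direction x z) ne)))
    RRoot : Node r → Bool
    RRoot x = c nw ∧ (every l (λ _ → h sw sw) ∧ (h nw same ∧ every r (λ z → h (direction x z) se)))
    RR : Node r → Node r → Bool
    RR x y = c (direction x y) ∧ (every l (λ _ → h sw sw) ∧ (h nw nw ∧ every r (λ z → h (direction x z) (direction y z))))

    fromLeft : some l (λ x →
        some l (λ y → c (direction x y) ∧ (every l (λ z → h (direction x z) (direction y z)) ∧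
                 (h ne ne ∧ every r (λ _ → h ne ne)))) ∨
        ((c ne ∧ (every l (λ z → h (direction x z) sw) ∧ (h ne same ∧ every r (λ _ → h ne se)))) ∨
         some r (λ y → c ne ∧ (every l (λ z → h (direction x z) sw) ∧
                 (h ne nw ∧ every r (λ z → h ne (direction y z)))))))
      ≡ (occurs l ∧ (h ne ne ∧ (e r ∨ h ne ne))) ∨
        (((c ne ∧ point below l) ∧ (h ne same ∧ (e r ∨ h ne se))) ∨
         ((c ne ∧ point below l) ∧ (h ne nw ∧ (c ne ∧ point left r))))
    fromLeft = trans (some-∨ l _ _) (cong₂ _∨_ LL (trans (some-∨ l _ _) (cong₂ _∨_ Lroot LR)))
      where
      LL = trans (some-cong l λ x → trans (some-cong l λ y → sym (∧-assoc (c (direction x y)) _ _)) (some-∧ l _ _))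
        (trans (some-∧ l _ _) (cong (λ b → occurs l ∧ (h ne ne ∧ b)) (every-const r (h ne ne))))
      Lroot = trans (∧-some l _ (c ne)) (trans (cong (c ne ∧_) (some-∧ l _ _))
        (trans (sym (∧-assoc (c ne) _ _)) (cong (λ b → (c ne ∧ point below l) ∧ (h ne same ∧ b)) (every-const r (h ne se)))))
      LR = trans (some-cong l λ x → trans (∧-some r _ (c ne)) (trans (cong (c ne ∧_) (trans (∧-some r _ _)
              (cong (every l (λ z → h (direction x z) sw) ∧_) (∧-some r _ (h ne nw)))))
              (sym (∧-assoc (c ne) _ _))))
        (trans (some-∧ l _ _) (trans (cong (_∧ (h ne nw ∧ point left r)) (∧-some l _ (c ne))) (regate (c ne) (point below l) (h ne nw) _)))
        where
        -- With one point in each subtree, `c ne` arises once, whereas both bits p and q contain it.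
        regate : ∀ a b d f → (a ∧ b) ∧ (d ∧ f) ≡ (a ∧ b) ∧ (d ∧ (a ∧ f))
        regate true  b d f = refl
        regate false b d f = refl

    RootRoot≡false : RootRoot ≡ false
    RootRoot≡false rewrite pair-same k = refl
    RRoot≡false : ∀ x → RRoot x ≡ false
    RRoot≡false x rewrite pair-nw k = refl
    dropped : ∀ {a b} y → a ≡ false → b ≡ false → a ∨ (b ∨ y) ≡ y
    dropped y refl refl = refl

    fromRoot : RootL ∨ (RootRoot ∨ RootR) ≡ (c se ∧ point right r) ∧ ((e l ∨ h sw sw) ∧ h same nw)
    fromRoot = trans (dropped RootR (no-c (pair-sw k) l _) RootRoot≡false)
      (trans (some-cong r λ y → cong (c se ∧_) (swap (every l (λ _ → h sw sw)) (h same nw) (every r (λ z → right (direction y z)))))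
      (trans (∧-some r _ (c se)) (trans (cong (c se ∧_) (some-∧ r _ _))
      (trans (sym (∧-assoc (c se) _ _)) (cong (λ b → (c se ∧ point right r) ∧ (b ∧ h same nw)) (every-const l (h sw sw)))))))

    fromRight : some r (λ x → some l (RL x) ∨ (RRoot x ∨ some r (RR x))) ≡ occurs r ∧ ((e l ∨ h sw sw) ∧ h nw nw)
    fromRight = trans (some-cong r λ x → trans (dropped (some r (RR x)) (no-c (pair-sw k) l _) (RRoot≡false x))
        (trans (some-cong r λ y → trans (cong (c (direction x y) ∧_)
            (swap (every l (λ _ → h sw sw)) (h nw nw) (every r λ z → h (direction x z) (direction y z))))
          (sym (∧-assoc (c (direction x y)) _ _))) (some-∧ r _ _)))
      (trans (some-∧ r _ _) (cong (λ b → occurs r ∧ (b ∧ h nw nw)) (every-const l (h sw sw))))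

-- The automaton of a mesh pattern

record State : Set where
  constructor state
  field
    e p q s o : Bool

iff : Bool → Bool → Bool
iff true  b = b
iff false b = not b

iff-sound : ∀ {a b} → T (iff a b) → a ≡ b
iff-sound {true}  {true}  _ = refl
iff-sound {false} {false} _ = refl

_==ˢ_ : State → State → Bool
state e p q s o ==ˢ state e′ p′ q′ s′ o′ = iff o o′ ∧ (iff p p′ ∧ (iff q q′ ∧ (iff s s′ ∧ iff e e′)))

==ˢ-sound : ∀ {a b} → T (a ==ˢ b) → a ≡ b
==ˢ-sound {state e p q s o} {state e′ p′ q′ s′ o′} t
  with t₁ , t ← ∧-split {iff o o′} t
  with t₂ , t ← ∧-split {iff p p′} t
  with t₃ , t ← ∧-split {iff q q′} t
  with t₄ , t₅ ← ∧-split {iff s s′} t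
  with refl ← iff-sound {o} t₁ | refl ← iff-sound {p} t₂ | refl ← iff-sound {q} t₃
     | refl ← iff-sound {s} t₄ | refl ← iff-sound {e} t₅ = refl

-- The factors `c ne` and `c se` hold p and q at false for descents and s at false for ascents.
-- States are then not told apart by points that no outside point completes to a pair of the right
-- kind.
patternAutomaton : Kind → Shading 2 → Automaton State
patternAutomaton k R = automaton (state true false false false false) λ (state eL pL qL sL oL) (state eR pR qR sR oR) →
  state false
    (c ne ∧ point-step (below k R) eL pL eR pR)
    (c ne ∧ point-step (left k R) eL qL eR qR)
    (c se ∧ point-step (right k R) eL sL eR sR)
    (occurs-step k R eL pL oL eR qR sR oR)
  where c = pairDirection k

gated-point-node : ∀ b g l r →
  b ∧ point-step g (isLeaf l) (b ∧ point g l) (isLeaf r) (b ∧ point g r) ≡ b ∧ point g (node l r)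
gated-point-node true  g l r = sym (point-node g l r)
gated-point-node false g l r = refl

run-pattern : ∀ k R t → let c = pairDirection k in Automaton.run (patternAutomaton k R) t ≡
  state (isLeaf t) (c ne ∧ point (below k R) t) (c ne ∧ point (left k R) t) (c se ∧ point (right k R) t) (occurs k R t)
run-pattern asc  R leaf = refl
run-pattern desc R leaf = refl
run-pattern k R (node l r) rewrite run-pattern k R l | run-pattern k R r
  | occurs-node k R l r | gated-point-node (pairDirection k ne) (below k R) l r
  | gated-point-node (pairDirection k ne) (left k R) l r | gated-point-node (pairDirection k se) (right k R) l r = refl

-- Tables of patterns and generating functions

-- For catalan, t = x (1 + t)², so that 1 + t is the Catalan series; for motzkin, t is x times
-- the Motzkin series.
catalan motzkin : Poly
catalan = 1 ∷ 2 ∷ 1 ∷ []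
motzkin = 1 ∷ 1 ∷ 1 ∷ []

-- The numerators N and the denominator D of the series that count the trees leading to a state,
-- found by fitting rational functions in t to their first coefficients. States from which
-- no accepting state can be reached are omitted, and so is the state of the empty tree.
-- The class of an unsolved language contains no other language.
data Solution : Set where
  unsolved : Solution
  solved   : (Φ D : Poly) → List (ℕ × Poly) → Solution

record Language : Set where
  constructor language
  field
    class    : Fin 23
    kind     : Kind
    code     : ℕ
    solution : Solution

-- Subsets of the grid and states are encoded in binary, the lowest digit first.

odd : ℕ → Bool
odd n = n % 2 ≡ᵇ 1

bits : ∀ n → ℕ → Vec Bool n
bits zero    m = []
bits (suc n) m = odd m ∷ bits n (m / 2)

shadingOf : ℕ → Shading 2
shadingOf m = bits 3 m ∷ bits 3 (m / 8) ∷ bits 3 (m / 64) ∷ []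

codeBits : ∀ {n} → Vec Bool n → ℕ
codeBits []       = 0
codeBits (b ∷ bs) = ind b + 2 * codeBits bs

codeOf : Shading 2 → ℕ
codeOf (a ∷ b ∷ c ∷ []) = codeBits a + 8 * (codeBits b + 8 * codeBits c)

stateOf : ℕ → State
stateOf m = state (odd m) (odd (m / 2)) (odd (m / 4)) (odd (m / 8)) (odd (m / 16))

languages : List Language
languages =
  language (# 0) desc 0 (solved catalan (1 ∷ 1 ∷ 1 ∷ []) ((8 , 0 ∷ 1 ∷ []) ∷ [])) ∷
  language (# 0) asc  0 (solved catalan (1 ∷ 1 ∷ 1 ∷ []) ((6 , 0 ∷ 1 ∷ []) ∷ [])) ∷
  language (# 1) desc 136 (solved motzkin (1 ∷ 1 ∷ []) ((8 , 0 ∷ 1 ∷ []) ∷ (0 , 0 ∷ 0 ∷ 1 ∷ []) ∷ [])) ∷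
  language (# 1) asc  10 (solved motzkin (1 ∷ 1 ∷ []) ((6 , 0 ∷ 1 ∷ []) ∷ (4 , 0 ∷ 0 ∷ 1 ∷ []) ∷ [])) ∷
  language (# 1) asc  160 (solved motzkin (1 ∷ 1 ∷ []) ((6 , 0 ∷ 1 ∷ []) ∷ (2 , 0 ∷ 0 ∷ 1 ∷ []) ∷ [])) ∷
  language (# 2) desc 216 unsolved ∷
  language (# 3) desc 1 (solved catalan (1 ∷ 1 ∷ []) ((8 , 0 ∷ 1 ∷ []) ∷ (24 , 0 ∷ 0 ∷ 1 ∷ []) ∷ [])) ∷
  language (# 3) desc 84 (solved catalan (1 ∷ 7 ∷ 19 ∷ 24 ∷ 13 ∷ 2 ∷ []) ((8 , 0 ∷ 1 ∷ 6 ∷ 12 ∷ 8 ∷ []) ∷ (16 , 0 ∷ 0 ∷ 1 ∷ 4 ∷ 6 ∷ 4 ∷ 1 ∷ []) ∷ (24 , 0 ∷ 0 ∷ 0 ∷ 2 ∷ 7 ∷ 7 ∷ 1 ∷ []) ∷ (0 , 0 ∷ 0 ∷ 0 ∷ 1 ∷ 3 ∷ 2 ∷ []) ∷ [])) ∷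
  language (# 3) desc 256 (solved catalan (1 ∷ 1 ∷ []) ((8 , 0 ∷ 1 ∷ []) ∷ (24 , 0 ∷ 0 ∷ 1 ∷ []) ∷ [])) ∷
  language (# 3) asc  4 (solved catalan (1 ∷ 1 ∷ []) ((6 , 0 ∷ 1 ∷ []) ∷ (22 , 0 ∷ 0 ∷ 1 ∷ []) ∷ [])) ∷
  language (# 3) asc  27 (solved catalan (1 ∷ 2 ∷ 1 ∷ []) ((6 , 0 ∷ 1 ∷ []) ∷ (4 , 0 ∷ 0 ∷ 1 ∷ []) ∷ (20 , 0 ∷ 0 ∷ 1 ∷ 1 ∷ []) ∷ [])) ∷
  language (# 3) asc  161 (solved catalan (1 ∷ 3 ∷ 2 ∷ []) ((6 , 0 ∷ 1 ∷ 1 ∷ []) ∷ (2 , 0 ∷ 0 ∷ 1 ∷ []) ∷ (22 , 0 ∷ 0 ∷ 1 ∷ 1 ∷ []) ∷ (18 , 0 ∷ 0 ∷ 0 ∷ 1 ∷ []) ∷ [])) ∷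
  language (# 3) asc  266 (solved catalan (1 ∷ 3 ∷ 2 ∷ []) ((6 , 0 ∷ 1 ∷ 1 ∷ []) ∷ (4 , 0 ∷ 0 ∷ 1 ∷ []) ∷ (22 , 0 ∷ 0 ∷ 1 ∷ 1 ∷ []) ∷ (20 , 0 ∷ 0 ∷ 0 ∷ 1 ∷ []) ∷ [])) ∷
  language (# 3) asc  432 (solved catalan (1 ∷ 2 ∷ 1 ∷ []) ((6 , 0 ∷ 1 ∷ []) ∷ (2 , 0 ∷ 0 ∷ 1 ∷ []) ∷ (18 , 0 ∷ 0 ∷ 1 ∷ 1 ∷ []) ∷ [])) ∷
  language (# 4) desc 92 (solved catalan (1 ∷ 3 ∷ 4 ∷ 2 ∷ []) ((8 , 0 ∷ 1 ∷ 2 ∷ 1 ∷ []) ∷ (16 , 0 ∷ 0 ∷ 1 ∷ 1 ∷ 1 ∷ []) ∷ (24 , 0 ∷ 0 ∷ 0 ∷ 1 ∷ []) ∷ (0 , 0 ∷ 0 ∷ 0 ∷ 1 ∷ 1 ∷ []) ∷ [])) ∷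
  language (# 4) desc 140 (solved catalan (1 ∷ 5 ∷ 11 ∷ 13 ∷ 8 ∷ 2 ∷ []) ((8 , 0 ∷ 1 ∷ 3 ∷ 5 ∷ 4 ∷ 2 ∷ []) ∷ (24 , 0 ∷ 0 ∷ 1 ∷ 2 ∷ 2 ∷ []) ∷ (0 , 0 ∷ 0 ∷ 1 ∷ 2 ∷ 3 ∷ 2 ∷ 1 ∷ []) ∷ (16 , 0 ∷ 0 ∷ 0 ∷ 2 ∷ 4 ∷ 4 ∷ 1 ∷ []) ∷ [])) ∷
  language (# 4) desc 209 (solved catalan (1 ∷ 3 ∷ 4 ∷ 2 ∷ []) ((8 , 0 ∷ 1 ∷ 2 ∷ 1 ∷ []) ∷ (16 , 0 ∷ 0 ∷ 1 ∷ 1 ∷ 1 ∷ []) ∷ (0 , 0 ∷ 0 ∷ 0 ∷ 1 ∷ 1 ∷ []) ∷ (24 , 0 ∷ 0 ∷ 0 ∷ 1 ∷ []) ∷ [])) ∷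
  language (# 4) desc 212 (solved catalan (1 ∷ 3 ∷ 4 ∷ 2 ∷ []) ((8 , 0 ∷ 1 ∷ 2 ∷ 1 ∷ []) ∷ (16 , 0 ∷ 0 ∷ 1 ∷ 1 ∷ 1 ∷ []) ∷ (0 , 0 ∷ 0 ∷ 0 ∷ 1 ∷ 1 ∷ []) ∷ (24 , 0 ∷ 0 ∷ 0 ∷ 1 ∷ []) ∷ [])) ∷
  language (# 4) desc 344 (solved catalan (1 ∷ 3 ∷ 4 ∷ 2 ∷ []) ((8 , 0 ∷ 1 ∷ 2 ∷ 1 ∷ []) ∷ (16 , 0 ∷ 0 ∷ 1 ∷ 1 ∷ 1 ∷ []) ∷ (24 , 0 ∷ 0 ∷ 0 ∷ 1 ∷ []) ∷ (0 , 0 ∷ 0 ∷ 0 ∷ 1 ∷ 1 ∷ []) ∷ [])) ∷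
  language (# 4) asc  177 (solved catalan (1 ∷ 5 ∷ 11 ∷ 13 ∷ 8 ∷ 2 ∷ []) ((6 , 0 ∷ 1 ∷ 3 ∷ 4 ∷ 2 ∷ []) ∷ (2 , 0 ∷ 0 ∷ 1 ∷ 2 ∷ 2 ∷ 1 ∷ []) ∷ (20 , 0 ∷ 0 ∷ 1 ∷ 2 ∷ 2 ∷ []) ∷ (4 , 0 ∷ 0 ∷ 0 ∷ 1 ∷ 2 ∷ 2 ∷ []) ∷ (18 , 0 ∷ 0 ∷ 0 ∷ 1 ∷ 2 ∷ 1 ∷ []) ∷ (16 , 0 ∷ 0 ∷ 0 ∷ 1 ∷ 2 ∷ 3 ∷ 1 ∷ []) ∷ (0 , 0 ∷ 0 ∷ 0 ∷ 0 ∷ 1 ∷ 1 ∷ 1 ∷ []) ∷ [])) ∷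
  language (# 4) asc  282 (solved catalan (1 ∷ 5 ∷ 11 ∷ 13 ∷ 8 ∷ 2 ∷ []) ((6 , 0 ∷ 1 ∷ 3 ∷ 4 ∷ 2 ∷ []) ∷ (4 , 0 ∷ 0 ∷ 1 ∷ 2 ∷ 2 ∷ 1 ∷ []) ∷ (18 , 0 ∷ 0 ∷ 1 ∷ 2 ∷ 2 ∷ []) ∷ (16 , 0 ∷ 0 ∷ 0 ∷ 1 ∷ 2 ∷ 3 ∷ 1 ∷ []) ∷ (20 , 0 ∷ 0 ∷ 0 ∷ 1 ∷ 2 ∷ 1 ∷ []) ∷ (2 , 0 ∷ 0 ∷ 0 ∷ 1 ∷ 2 ∷ 2 ∷ []) ∷ (0 , 0 ∷ 0 ∷ 0 ∷ 0 ∷ 1 ∷ 1 ∷ 1 ∷ []) ∷ [])) ∷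
  language (# 5) asc  29 (solved catalan (1 ∷ 1 ∷ 1 ∷ []) ((6 , 0 ∷ 1 ∷ []) ∷ (20 , 0 ∷ 0 ∷ 1 ∷ []) ∷ (4 , 0 ∷ 0 ∷ 0 ∷ 1 ∷ []) ∷ [])) ∷
  language (# 5) asc  185 (solved catalan (1 ∷ 4 ∷ 7 ∷ 7 ∷ 4 ∷ 1 ∷ []) ((6 , 0 ∷ 1 ∷ 2 ∷ 2 ∷ 1 ∷ []) ∷ (2 , 0 ∷ 0 ∷ 1 ∷ 1 ∷ []) ∷ (20 , 0 ∷ 0 ∷ 1 ∷ 1 ∷ 1 ∷ []) ∷ (4 , 0 ∷ 0 ∷ 0 ∷ 1 ∷ 1 ∷ 1 ∷ []) ∷ (16 , 0 ∷ 0 ∷ 0 ∷ 2 ∷ 2 ∷ 1 ∷ []) ∷ (0 , 0 ∷ 0 ∷ 0 ∷ 0 ∷ 2 ∷ 2 ∷ 1 ∷ []) ∷ [])) ∷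
  language (# 5) asc  267 (solved catalan (1 ∷ 3 ∷ 4 ∷ 3 ∷ 1 ∷ []) ((6 , 0 ∷ 1 ∷ 1 ∷ 1 ∷ []) ∷ (4 , 0 ∷ 0 ∷ 1 ∷ 1 ∷ 2 ∷ 1 ∷ []) ∷ (22 , 0 ∷ 0 ∷ 1 ∷ 1 ∷ 1 ∷ []) ∷ (20 , 0 ∷ 0 ∷ 0 ∷ 1 ∷ []) ∷ [])) ∷
  language (# 5) asc  273 (solved catalan (1 ∷ 3 ∷ 4 ∷ 3 ∷ 1 ∷ []) ((6 , 0 ∷ 1 ∷ 2 ∷ 1 ∷ 1 ∷ []) ∷ (16 , 0 ∷ 0 ∷ 1 ∷ 1 ∷ 1 ∷ []) ∷ (22 , 0 ∷ 0 ∷ 0 ∷ 1 ∷ []) ∷ (0 , 0 ∷ 0 ∷ 0 ∷ 1 ∷ 1 ∷ 1 ∷ []) ∷ [])) ∷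
  language (# 5) asc  404 (solved catalan (1 ∷ 1 ∷ 1 ∷ []) ((6 , 0 ∷ 1 ∷ []) ∷ (18 , 0 ∷ 0 ∷ 1 ∷ []) ∷ (2 , 0 ∷ 0 ∷ 0 ∷ 1 ∷ []) ∷ [])) ∷
  language (# 5) asc  410 (solved catalan (1 ∷ 4 ∷ 7 ∷ 7 ∷ 4 ∷ 1 ∷ []) ((6 , 0 ∷ 1 ∷ 2 ∷ 2 ∷ 1 ∷ []) ∷ (4 , 0 ∷ 0 ∷ 1 ∷ 1 ∷ []) ∷ (18 , 0 ∷ 0 ∷ 1 ∷ 1 ∷ 1 ∷ []) ∷ (16 , 0 ∷ 0 ∷ 0 ∷ 2 ∷ 2 ∷ 1 ∷ []) ∷ (2 , 0 ∷ 0 ∷ 0 ∷ 1 ∷ 1 ∷ 1 ∷ []) ∷ (0 , 0 ∷ 0 ∷ 0 ∷ 0 ∷ 2 ∷ 2 ∷ 1 ∷ []) ∷ [])) ∷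
  language (# 5) asc  417 (solved catalan (1 ∷ 3 ∷ 4 ∷ 3 ∷ 1 ∷ []) ((6 , 0 ∷ 1 ∷ 1 ∷ 1 ∷ []) ∷ (2 , 0 ∷ 0 ∷ 1 ∷ 1 ∷ 2 ∷ 1 ∷ []) ∷ (22 , 0 ∷ 0 ∷ 1 ∷ 1 ∷ 1 ∷ []) ∷ (18 , 0 ∷ 0 ∷ 0 ∷ 1 ∷ []) ∷ [])) ∷
  language (# 6) desc 204 unsolved ∷
  language (# 7) asc  281 (solved catalan (1 ∷ 3 ∷ 5 ∷ 5 ∷ 3 ∷ 1 ∷ []) ((6 , 0 ∷ 1 ∷ 2 ∷ 2 ∷ 1 ∷ []) ∷ (16 , 0 ∷ 0 ∷ 1 ∷ 1 ∷ 1 ∷ []) ∷ (20 , 0 ∷ 0 ∷ 0 ∷ 1 ∷ []) ∷ (0 , 0 ∷ 0 ∷ 0 ∷ 1 ∷ 2 ∷ 2 ∷ 1 ∷ []) ∷ (4 , 0 ∷ 0 ∷ 0 ∷ 0 ∷ 1 ∷ 1 ∷ []) ∷ [])) ∷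
  language (# 7) asc  401 (solved catalan (1 ∷ 3 ∷ 5 ∷ 5 ∷ 3 ∷ 1 ∷ []) ((6 , 0 ∷ 1 ∷ 2 ∷ 2 ∷ 1 ∷ []) ∷ (16 , 0 ∷ 0 ∷ 1 ∷ 1 ∷ 1 ∷ []) ∷ (18 , 0 ∷ 0 ∷ 0 ∷ 1 ∷ []) ∷ (0 , 0 ∷ 0 ∷ 0 ∷ 1 ∷ 2 ∷ 2 ∷ 1 ∷ []) ∷ (2 , 0 ∷ 0 ∷ 0 ∷ 0 ∷ 1 ∷ 1 ∷ []) ∷ [])) ∷
  language (# 8) asc  409 unsolved ∷
  language (# 9) asc  170 unsolved ∷
  language (# 10) asc  186 unsolved ∷
  language (# 11) desc 85 (solved catalan (1 ∷ 4 ∷ 4 ∷ []) ((8 , 0 ∷ 1 ∷ 3 ∷ 1 ∷ []) ∷ (16 , 0 ∷ 0 ∷ 1 ∷ 1 ∷ []) ∷ (0 , 0 ∷ 0 ∷ 0 ∷ 1 ∷ []) ∷ (24 , 0 ∷ 0 ∷ 0 ∷ 1 ∷ []) ∷ [])) ∷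
  language (# 11) desc 137 (solved catalan (1 ∷ 3 ∷ 2 ∷ []) ((8 , 0 ∷ 1 ∷ 1 ∷ []) ∷ (24 , 0 ∷ 0 ∷ 1 ∷ []) ∷ (0 , 0 ∷ 0 ∷ 1 ∷ 1 ∷ []) ∷ (16 , 0 ∷ 0 ∷ 0 ∷ 1 ∷ []) ∷ [])) ∷
  language (# 11) desc 340 (solved catalan (1 ∷ 4 ∷ 4 ∷ []) ((8 , 0 ∷ 1 ∷ 3 ∷ 1 ∷ []) ∷ (16 , 0 ∷ 0 ∷ 1 ∷ 1 ∷ []) ∷ (24 , 0 ∷ 0 ∷ 0 ∷ 1 ∷ []) ∷ (0 , 0 ∷ 0 ∷ 0 ∷ 1 ∷ []) ∷ [])) ∷
  language (# 11) desc 392 (solved catalan (1 ∷ 3 ∷ 2 ∷ []) ((8 , 0 ∷ 1 ∷ 1 ∷ []) ∷ (24 , 0 ∷ 0 ∷ 1 ∷ []) ∷ (0 , 0 ∷ 0 ∷ 1 ∷ 1 ∷ []) ∷ (16 , 0 ∷ 0 ∷ 0 ∷ 1 ∷ []) ∷ [])) ∷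
  language (# 11) asc  14 (solved catalan (1 ∷ 2 ∷ []) ((6 , 0 ∷ 1 ∷ []) ∷ (4 , 0 ∷ 0 ∷ 1 ∷ []) ∷ (22 , 0 ∷ 0 ∷ 1 ∷ []) ∷ [])) ∷
  language (# 11) asc  164 (solved catalan (1 ∷ 2 ∷ []) ((6 , 0 ∷ 1 ∷ []) ∷ (2 , 0 ∷ 0 ∷ 1 ∷ []) ∷ (22 , 0 ∷ 0 ∷ 1 ∷ []) ∷ [])) ∷
  language (# 11) asc  171 (solved catalan (1 ∷ 5 ∷ 8 ∷ 4 ∷ []) ((6 , 0 ∷ 1 ∷ 3 ∷ 2 ∷ []) ∷ (0 , 0 ∷ 0 ∷ 1 ∷ 2 ∷ 1 ∷ []) ∷ (22 , 0 ∷ 0 ∷ 1 ∷ 2 ∷ []) ∷ (16 , 0 ∷ 0 ∷ 0 ∷ 1 ∷ 1 ∷ []) ∷ (4 , 0 ∷ 0 ∷ 0 ∷ 1 ∷ 1 ∷ []) ∷ (20 , 0 ∷ 0 ∷ 0 ∷ 0 ∷ 1 ∷ []) ∷ [])) ∷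
  language (# 11) asc  426 (solved catalan (1 ∷ 5 ∷ 8 ∷ 4 ∷ []) ((6 , 0 ∷ 1 ∷ 3 ∷ 2 ∷ []) ∷ (0 , 0 ∷ 0 ∷ 1 ∷ 2 ∷ 1 ∷ []) ∷ (22 , 0 ∷ 0 ∷ 1 ∷ 2 ∷ []) ∷ (2 , 0 ∷ 0 ∷ 0 ∷ 1 ∷ 1 ∷ []) ∷ (16 , 0 ∷ 0 ∷ 0 ∷ 1 ∷ 1 ∷ []) ∷ (18 , 0 ∷ 0 ∷ 0 ∷ 0 ∷ 1 ∷ []) ∷ [])) ∷
  language (# 12) desc 93 (solved catalan (1 ∷ 2 ∷ 1 ∷ []) ((8 , 0 ∷ 1 ∷ 1 ∷ []) ∷ (16 , 0 ∷ 0 ∷ 1 ∷ []) ∷ (0 , 0 ∷ 0 ∷ 0 ∷ 1 ∷ []) ∷ [])) ∷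
  language (# 12) desc 141 (solved catalan (1 ∷ 3 ∷ 3 ∷ 1 ∷ []) ((8 , 0 ∷ 1 ∷ 1 ∷ 1 ∷ []) ∷ (24 , 0 ∷ 0 ∷ 1 ∷ []) ∷ (0 , 0 ∷ 0 ∷ 1 ∷ 1 ∷ 1 ∷ []) ∷ (16 , 0 ∷ 0 ∷ 0 ∷ 1 ∷ []) ∷ [])) ∷
  language (# 12) desc 217 (solved catalan (1 ∷ 2 ∷ 1 ∷ []) ((8 , 0 ∷ 1 ∷ []) ∷ (16 , 0 ∷ 0 ∷ 1 ∷ []) ∷ (0 , 0 ∷ 0 ∷ 1 ∷ 1 ∷ []) ∷ [])) ∷
  language (# 12) desc 213 (solved catalan (1 ∷ 4 ∷ 6 ∷ 4 ∷ 1 ∷ []) ((8 , 0 ∷ 1 ∷ 3 ∷ 2 ∷ 1 ∷ []) ∷ (16 , 0 ∷ 0 ∷ 1 ∷ 1 ∷ 1 ∷ []) ∷ (0 , 0 ∷ 0 ∷ 0 ∷ 2 ∷ 2 ∷ 1 ∷ []) ∷ (24 , 0 ∷ 0 ∷ 0 ∷ 1 ∷ []) ∷ [])) ∷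
  language (# 12) desc 257 (solved catalan (1 ∷ 2 ∷ 1 ∷ []) ((8 , 0 ∷ 1 ∷ 1 ∷ 1 ∷ []) ∷ (24 , 0 ∷ 0 ∷ 1 ∷ []) ∷ [])) ∷
  language (# 12) desc 348 (solved catalan (1 ∷ 4 ∷ 6 ∷ 4 ∷ 1 ∷ []) ((8 , 0 ∷ 1 ∷ 3 ∷ 2 ∷ 1 ∷ []) ∷ (16 , 0 ∷ 0 ∷ 1 ∷ 1 ∷ 1 ∷ []) ∷ (24 , 0 ∷ 0 ∷ 0 ∷ 1 ∷ []) ∷ (0 , 0 ∷ 0 ∷ 0 ∷ 2 ∷ 2 ∷ 1 ∷ []) ∷ [])) ∷
  language (# 12) desc 396 (solved catalan (1 ∷ 3 ∷ 3 ∷ 1 ∷ []) ((8 , 0 ∷ 1 ∷ 1 ∷ 1 ∷ []) ∷ (24 , 0 ∷ 0 ∷ 1 ∷ []) ∷ (0 , 0 ∷ 0 ∷ 1 ∷ 1 ∷ 1 ∷ []) ∷ (16 , 0 ∷ 0 ∷ 0 ∷ 1 ∷ []) ∷ [])) ∷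
  language (# 12) desc 472 (solved catalan (1 ∷ 2 ∷ 1 ∷ []) ((8 , 0 ∷ 1 ∷ []) ∷ (16 , 0 ∷ 0 ∷ 1 ∷ []) ∷ (0 , 0 ∷ 0 ∷ 1 ∷ 1 ∷ []) ∷ [])) ∷
  language (# 12) desc 468 (solved catalan (1 ∷ 2 ∷ 1 ∷ []) ((8 , 0 ∷ 1 ∷ 1 ∷ []) ∷ (16 , 0 ∷ 0 ∷ 1 ∷ []) ∷ (0 , 0 ∷ 0 ∷ 0 ∷ 1 ∷ []) ∷ [])) ∷
  language (# 12) asc  15 (solved catalan (1 ∷ 2 ∷ 1 ∷ []) ((6 , 0 ∷ 1 ∷ []) ∷ (4 , 0 ∷ 0 ∷ 1 ∷ 1 ∷ []) ∷ (22 , 0 ∷ 0 ∷ 1 ∷ []) ∷ [])) ∷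
  language (# 12) asc  181 (solved catalan (1 ∷ 3 ∷ 3 ∷ 1 ∷ []) ((6 , 0 ∷ 1 ∷ 1 ∷ []) ∷ (2 , 0 ∷ 0 ∷ 1 ∷ 1 ∷ []) ∷ (20 , 0 ∷ 0 ∷ 1 ∷ []) ∷ (4 , 0 ∷ 0 ∷ 0 ∷ 1 ∷ []) ∷ (16 , 0 ∷ 0 ∷ 0 ∷ 1 ∷ []) ∷ (0 , 0 ∷ 0 ∷ 0 ∷ 0 ∷ 1 ∷ []) ∷ [])) ∷
  language (# 12) asc  187 (solved catalan (1 ∷ 3 ∷ 3 ∷ 1 ∷ []) ((6 , 0 ∷ 1 ∷ 1 ∷ []) ∷ (0 , 0 ∷ 0 ∷ 1 ∷ 1 ∷ 1 ∷ []) ∷ (20 , 0 ∷ 0 ∷ 1 ∷ []) ∷ (4 , 0 ∷ 0 ∷ 0 ∷ 1 ∷ []) ∷ (16 , 0 ∷ 0 ∷ 0 ∷ 1 ∷ []) ∷ [])) ∷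
  language (# 12) asc  277 (solved catalan (1 ∷ 2 ∷ 1 ∷ []) ((6 , 0 ∷ 1 ∷ 1 ∷ []) ∷ (16 , 0 ∷ 0 ∷ 1 ∷ []) ∷ (0 , 0 ∷ 0 ∷ 0 ∷ 1 ∷ []) ∷ [])) ∷
  language (# 12) asc  286 (solved catalan (1 ∷ 3 ∷ 3 ∷ 1 ∷ []) ((6 , 0 ∷ 1 ∷ 1 ∷ []) ∷ (4 , 0 ∷ 0 ∷ 1 ∷ 1 ∷ []) ∷ (18 , 0 ∷ 0 ∷ 1 ∷ []) ∷ (16 , 0 ∷ 0 ∷ 0 ∷ 1 ∷ []) ∷ (2 , 0 ∷ 0 ∷ 0 ∷ 1 ∷ []) ∷ (0 , 0 ∷ 0 ∷ 0 ∷ 0 ∷ 1 ∷ []) ∷ [])) ∷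
  language (# 12) asc  420 (solved catalan (1 ∷ 2 ∷ 1 ∷ []) ((6 , 0 ∷ 1 ∷ []) ∷ (2 , 0 ∷ 0 ∷ 1 ∷ 1 ∷ []) ∷ (22 , 0 ∷ 0 ∷ 1 ∷ []) ∷ [])) ∷
  language (# 12) asc  442 (solved catalan (1 ∷ 3 ∷ 3 ∷ 1 ∷ []) ((6 , 0 ∷ 1 ∷ 1 ∷ []) ∷ (0 , 0 ∷ 0 ∷ 1 ∷ 1 ∷ 1 ∷ []) ∷ (18 , 0 ∷ 0 ∷ 1 ∷ []) ∷ (16 , 0 ∷ 0 ∷ 0 ∷ 1 ∷ []) ∷ (2 , 0 ∷ 0 ∷ 0 ∷ 1 ∷ []) ∷ [])) ∷
  language (# 13) desc 337 unsolved ∷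
  language (# 14) desc 220 unsolved ∷
  language (# 15) desc 205 (solved catalan (1 ∷ 3 ∷ 4 ∷ 3 ∷ 1 ∷ []) ((8 , 0 ∷ 1 ∷ 1 ∷ 1 ∷ []) ∷ (24 , 0 ∷ 0 ∷ 1 ∷ []) ∷ (0 , 0 ∷ 0 ∷ 1 ∷ 2 ∷ 3 ∷ 1 ∷ []) ∷ (16 , 0 ∷ 0 ∷ 0 ∷ 1 ∷ []) ∷ [])) ∷
  language (# 15) desc 345 (solved catalan (1 ∷ 2 ∷ 2 ∷ 1 ∷ []) ((8 , 0 ∷ 1 ∷ 1 ∷ 1 ∷ []) ∷ (16 , 0 ∷ 0 ∷ 1 ∷ []) ∷ (0 , 0 ∷ 0 ∷ 0 ∷ 1 ∷ 1 ∷ []) ∷ [])) ∷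
  language (# 15) desc 460 (solved catalan (1 ∷ 3 ∷ 4 ∷ 3 ∷ 1 ∷ []) ((8 , 0 ∷ 1 ∷ 1 ∷ 1 ∷ []) ∷ (24 , 0 ∷ 0 ∷ 1 ∷ []) ∷ (0 , 0 ∷ 0 ∷ 1 ∷ 2 ∷ 3 ∷ 1 ∷ []) ∷ (16 , 0 ∷ 0 ∷ 0 ∷ 1 ∷ []) ∷ [])) ∷
  language (# 15) desc 465 (solved catalan (1 ∷ 2 ∷ 2 ∷ 1 ∷ []) ((8 , 0 ∷ 1 ∷ 1 ∷ 1 ∷ []) ∷ (16 , 0 ∷ 0 ∷ 1 ∷ []) ∷ (0 , 0 ∷ 0 ∷ 0 ∷ 1 ∷ 1 ∷ []) ∷ [])) ∷
  language (# 15) asc  189 (solved catalan (1 ∷ 4 ∷ 7 ∷ 7 ∷ 4 ∷ 1 ∷ []) ((6 , 0 ∷ 1 ∷ 2 ∷ 2 ∷ 1 ∷ []) ∷ (2 , 0 ∷ 0 ∷ 1 ∷ 1 ∷ []) ∷ (20 , 0 ∷ 0 ∷ 1 ∷ 1 ∷ 1 ∷ []) ∷ (4 , 0 ∷ 0 ∷ 0 ∷ 1 ∷ 1 ∷ 1 ∷ []) ∷ (0 , 0 ∷ 0 ∷ 0 ∷ 1 ∷ 4 ∷ 3 ∷ 1 ∷ []) ∷ (16 , 0 ∷ 0 ∷ 0 ∷ 1 ∷ []) ∷ [])) ∷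
  language (# 15) asc  283 (solved catalan (1 ∷ 4 ∷ 7 ∷ 7 ∷ 4 ∷ 1 ∷ []) ((6 , 0 ∷ 1 ∷ 2 ∷ 2 ∷ 1 ∷ []) ∷ (4 , 0 ∷ 0 ∷ 1 ∷ 1 ∷ 2 ∷ 1 ∷ []) ∷ (16 , 0 ∷ 0 ∷ 1 ∷ 1 ∷ 1 ∷ []) ∷ (20 , 0 ∷ 0 ∷ 0 ∷ 1 ∷ []) ∷ (0 , 0 ∷ 0 ∷ 0 ∷ 2 ∷ 3 ∷ 3 ∷ 1 ∷ []) ∷ [])) ∷
  language (# 15) asc  285 (solved catalan (1 ∷ 2 ∷ 2 ∷ 1 ∷ []) ((6 , 0 ∷ 1 ∷ 1 ∷ []) ∷ (16 , 0 ∷ 0 ∷ 1 ∷ []) ∷ (4 , 0 ∷ 0 ∷ 0 ∷ 1 ∷ []) ∷ (0 , 0 ∷ 0 ∷ 0 ∷ 1 ∷ 1 ∷ []) ∷ [])) ∷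
  language (# 15) asc  405 (solved catalan (1 ∷ 2 ∷ 2 ∷ 1 ∷ []) ((6 , 0 ∷ 1 ∷ 1 ∷ []) ∷ (16 , 0 ∷ 0 ∷ 1 ∷ []) ∷ (2 , 0 ∷ 0 ∷ 0 ∷ 1 ∷ []) ∷ (0 , 0 ∷ 0 ∷ 0 ∷ 1 ∷ 1 ∷ []) ∷ [])) ∷
  language (# 15) asc  414 (solved catalan (1 ∷ 4 ∷ 7 ∷ 7 ∷ 4 ∷ 1 ∷ []) ((6 , 0 ∷ 1 ∷ 2 ∷ 2 ∷ 1 ∷ []) ∷ (4 , 0 ∷ 0 ∷ 1 ∷ 1 ∷ []) ∷ (18 , 0 ∷ 0 ∷ 1 ∷ 1 ∷ 1 ∷ []) ∷ (16 , 0 ∷ 0 ∷ 0 ∷ 1 ∷ []) ∷ (0 , 0 ∷ 0 ∷ 0 ∷ 1 ∷ 4 ∷ 3 ∷ 1 ∷ []) ∷ (2 , 0 ∷ 0 ∷ 0 ∷ 1 ∷ 1 ∷ 1 ∷ []) ∷ [])) ∷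
  language (# 15) asc  427 (solved catalan (1 ∷ 4 ∷ 7 ∷ 7 ∷ 4 ∷ 1 ∷ []) ((6 , 0 ∷ 1 ∷ 2 ∷ 2 ∷ 1 ∷ []) ∷ (0 , 0 ∷ 0 ∷ 1 ∷ 1 ∷ 3 ∷ 2 ∷ 1 ∷ []) ∷ (22 , 0 ∷ 0 ∷ 1 ∷ 1 ∷ 1 ∷ []) ∷ (2 , 0 ∷ 0 ∷ 0 ∷ 1 ∷ 1 ∷ 1 ∷ []) ∷ (16 , 0 ∷ 0 ∷ 0 ∷ 1 ∷ []) ∷ (4 , 0 ∷ 0 ∷ 0 ∷ 1 ∷ 1 ∷ 1 ∷ []) ∷ [])) ∷
  language (# 15) asc  433 (solved catalan (1 ∷ 4 ∷ 7 ∷ 7 ∷ 4 ∷ 1 ∷ []) ((6 , 0 ∷ 1 ∷ 2 ∷ 2 ∷ 1 ∷ []) ∷ (2 , 0 ∷ 0 ∷ 1 ∷ 1 ∷ 2 ∷ 1 ∷ []) ∷ (16 , 0 ∷ 0 ∷ 1 ∷ 1 ∷ 1 ∷ []) ∷ (0 , 0 ∷ 0 ∷ 0 ∷ 2 ∷ 3 ∷ 3 ∷ 1 ∷ []) ∷ (18 , 0 ∷ 0 ∷ 0 ∷ 1 ∷ []) ∷ [])) ∷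
  language (# 16) asc  411 (solved catalan (1 ∷ 4 ∷ 8 ∷ 10 ∷ 8 ∷ 4 ∷ 1 ∷ []) ((6 , 0 ∷ 1 ∷ 2 ∷ 3 ∷ 2 ∷ 1 ∷ []) ∷ (4 , 0 ∷ 0 ∷ 1 ∷ 1 ∷ 1 ∷ []) ∷ (16 , 0 ∷ 0 ∷ 1 ∷ 2 ∷ 1 ∷ []) ∷ (0 , 0 ∷ 0 ∷ 0 ∷ 2 ∷ 6 ∷ 7 ∷ 4 ∷ 1 ∷ []) ∷ [])) ∷
  language (# 16) asc  413 (solved catalan (1 ∷ 2 ∷ 3 ∷ 2 ∷ 1 ∷ []) ((6 , 0 ∷ 1 ∷ 1 ∷ 1 ∷ []) ∷ (16 , 0 ∷ 0 ∷ 1 ∷ []) ∷ (0 , 0 ∷ 0 ∷ 0 ∷ 2 ∷ 2 ∷ 1 ∷ []) ∷ [])) ∷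
  language (# 16) asc  441 (solved catalan (1 ∷ 4 ∷ 8 ∷ 10 ∷ 8 ∷ 4 ∷ 1 ∷ []) ((6 , 0 ∷ 1 ∷ 2 ∷ 3 ∷ 2 ∷ 1 ∷ []) ∷ (2 , 0 ∷ 0 ∷ 1 ∷ 1 ∷ 1 ∷ []) ∷ (16 , 0 ∷ 0 ∷ 1 ∷ 2 ∷ 1 ∷ []) ∷ (0 , 0 ∷ 0 ∷ 0 ∷ 2 ∷ 6 ∷ 7 ∷ 4 ∷ 1 ∷ []) ∷ [])) ∷
  language (# 17) asc  174 unsolved ∷
  language (# 18) asc  190 unsolved ∷
  language (# 19) desc 341 (solved catalan (1 ∷ 3 ∷ 2 ∷ []) ((8 , 0 ∷ 1 ∷ 2 ∷ 1 ∷ []) ∷ (16 , 0 ∷ 0 ∷ 1 ∷ []) ∷ (0 , 0 ∷ 0 ∷ 0 ∷ 1 ∷ []) ∷ [])) ∷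
  language (# 19) asc  175 (solved catalan (1 ∷ 3 ∷ 2 ∷ []) ((6 , 0 ∷ 1 ∷ 1 ∷ []) ∷ (0 , 0 ∷ 0 ∷ 1 ∷ 1 ∷ []) ∷ (22 , 0 ∷ 0 ∷ 1 ∷ []) ∷ (4 , 0 ∷ 0 ∷ 0 ∷ 1 ∷ []) ∷ [])) ∷
  language (# 19) asc  430 (solved catalan (1 ∷ 3 ∷ 2 ∷ []) ((6 , 0 ∷ 1 ∷ 1 ∷ []) ∷ (0 , 0 ∷ 0 ∷ 1 ∷ 1 ∷ []) ∷ (22 , 0 ∷ 0 ∷ 1 ∷ []) ∷ (2 , 0 ∷ 0 ∷ 0 ∷ 1 ∷ []) ∷ [])) ∷
  language (# 20) desc 221 (solved catalan (1 ∷ 3 ∷ 3 ∷ 1 ∷ []) ((8 , 0 ∷ 1 ∷ 1 ∷ []) ∷ (16 , 0 ∷ 0 ∷ 1 ∷ []) ∷ (0 , 0 ∷ 0 ∷ 1 ∷ 3 ∷ 1 ∷ []) ∷ [])) ∷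
  language (# 20) desc 349 (solved catalan (1 ∷ 3 ∷ 3 ∷ 1 ∷ []) ((8 , 0 ∷ 1 ∷ 2 ∷ 1 ∷ []) ∷ (16 , 0 ∷ 0 ∷ 1 ∷ []) ∷ (0 , 0 ∷ 0 ∷ 0 ∷ 2 ∷ 1 ∷ []) ∷ [])) ∷
  language (# 20) desc 393 (solved catalan (1 ∷ 3 ∷ 3 ∷ 1 ∷ []) ((8 , 0 ∷ 1 ∷ 1 ∷ 1 ∷ []) ∷ (24 , 0 ∷ 0 ∷ 1 ∷ []) ∷ (0 , 0 ∷ 0 ∷ 1 ∷ 2 ∷ 1 ∷ []) ∷ [])) ∷
  language (# 20) desc 469 (solved catalan (1 ∷ 3 ∷ 3 ∷ 1 ∷ []) ((8 , 0 ∷ 1 ∷ 2 ∷ 1 ∷ []) ∷ (16 , 0 ∷ 0 ∷ 1 ∷ []) ∷ (0 , 0 ∷ 0 ∷ 0 ∷ 2 ∷ 1 ∷ []) ∷ [])) ∷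
  language (# 20) desc 476 (solved catalan (1 ∷ 3 ∷ 3 ∷ 1 ∷ []) ((8 , 0 ∷ 1 ∷ 1 ∷ []) ∷ (16 , 0 ∷ 0 ∷ 1 ∷ []) ∷ (0 , 0 ∷ 0 ∷ 1 ∷ 3 ∷ 1 ∷ []) ∷ [])) ∷
  language (# 20) asc  191 (solved catalan (1 ∷ 3 ∷ 3 ∷ 1 ∷ []) ((6 , 0 ∷ 1 ∷ 1 ∷ []) ∷ (0 , 0 ∷ 0 ∷ 1 ∷ 2 ∷ 1 ∷ []) ∷ (20 , 0 ∷ 0 ∷ 1 ∷ []) ∷ (4 , 0 ∷ 0 ∷ 0 ∷ 1 ∷ []) ∷ [])) ∷
  language (# 20) asc  287 (solved catalan (1 ∷ 3 ∷ 3 ∷ 1 ∷ []) ((6 , 0 ∷ 1 ∷ 1 ∷ []) ∷ (4 , 0 ∷ 0 ∷ 1 ∷ 1 ∷ []) ∷ (16 , 0 ∷ 0 ∷ 1 ∷ []) ∷ (0 , 0 ∷ 0 ∷ 0 ∷ 2 ∷ 1 ∷ []) ∷ [])) ∷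
  language (# 20) asc  431 (solved catalan (1 ∷ 3 ∷ 3 ∷ 1 ∷ []) ((6 , 0 ∷ 1 ∷ 1 ∷ []) ∷ (0 , 0 ∷ 0 ∷ 1 ∷ 1 ∷ 1 ∷ []) ∷ (22 , 0 ∷ 0 ∷ 1 ∷ []) ∷ (2 , 0 ∷ 0 ∷ 0 ∷ 1 ∷ []) ∷ (4 , 0 ∷ 0 ∷ 0 ∷ 1 ∷ []) ∷ [])) ∷
  language (# 20) asc  437 (solved catalan (1 ∷ 3 ∷ 3 ∷ 1 ∷ []) ((6 , 0 ∷ 1 ∷ 1 ∷ []) ∷ (2 , 0 ∷ 0 ∷ 1 ∷ 1 ∷ []) ∷ (16 , 0 ∷ 0 ∷ 1 ∷ []) ∷ (0 , 0 ∷ 0 ∷ 0 ∷ 2 ∷ 1 ∷ []) ∷ [])) ∷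
  language (# 20) asc  446 (solved catalan (1 ∷ 3 ∷ 3 ∷ 1 ∷ []) ((6 , 0 ∷ 1 ∷ 1 ∷ []) ∷ (0 , 0 ∷ 0 ∷ 1 ∷ 2 ∷ 1 ∷ []) ∷ (18 , 0 ∷ 0 ∷ 1 ∷ []) ∷ (2 , 0 ∷ 0 ∷ 0 ∷ 1 ∷ []) ∷ [])) ∷
  language (# 21) desc 457 (solved catalan (1 ∷ 3 ∷ 4 ∷ 3 ∷ 1 ∷ []) ((8 , 0 ∷ 1 ∷ 1 ∷ 1 ∷ []) ∷ (24 , 0 ∷ 0 ∷ 1 ∷ []) ∷ (0 , 0 ∷ 0 ∷ 1 ∷ 3 ∷ 3 ∷ 1 ∷ []) ∷ [])) ∷
  language (# 21) asc  415 (solved catalan (1 ∷ 3 ∷ 4 ∷ 3 ∷ 1 ∷ []) ((6 , 0 ∷ 1 ∷ 1 ∷ 1 ∷ []) ∷ (4 , 0 ∷ 0 ∷ 1 ∷ []) ∷ (16 , 0 ∷ 0 ∷ 1 ∷ []) ∷ (0 , 0 ∷ 0 ∷ 0 ∷ 3 ∷ 3 ∷ 1 ∷ []) ∷ [])) ∷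
  language (# 21) asc  443 (solved catalan (1 ∷ 3 ∷ 4 ∷ 3 ∷ 1 ∷ []) ((6 , 0 ∷ 1 ∷ 1 ∷ 1 ∷ []) ∷ (0 , 0 ∷ 0 ∷ 1 ∷ 3 ∷ 3 ∷ 1 ∷ []) ∷ (16 , 0 ∷ 0 ∷ 1 ∷ []) ∷ [])) ∷
  language (# 21) asc  445 (solved catalan (1 ∷ 3 ∷ 4 ∷ 3 ∷ 1 ∷ []) ((6 , 0 ∷ 1 ∷ 1 ∷ 1 ∷ []) ∷ (2 , 0 ∷ 0 ∷ 1 ∷ []) ∷ (16 , 0 ∷ 0 ∷ 1 ∷ []) ∷ (0 , 0 ∷ 0 ∷ 0 ∷ 3 ∷ 3 ∷ 1 ∷ []) ∷ [])) ∷
  language (# 22) desc 477 (solved catalan (1 ∷ 4 ∷ 6 ∷ 4 ∷ 1 ∷ []) ((8 , 0 ∷ 1 ∷ 2 ∷ 1 ∷ []) ∷ (16 , 0 ∷ 0 ∷ 1 ∷ []) ∷ (0 , 0 ∷ 0 ∷ 1 ∷ 5 ∷ 4 ∷ 1 ∷ []) ∷ [])) ∷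
  language (# 22) asc  447 (solved catalan (1 ∷ 4 ∷ 6 ∷ 4 ∷ 1 ∷ []) ((6 , 0 ∷ 1 ∷ 2 ∷ 1 ∷ []) ∷ (0 , 0 ∷ 0 ∷ 1 ∷ 5 ∷ 4 ∷ 1 ∷ []) ∷ (16 , 0 ∷ 0 ∷ 1 ∷ []) ∷ [])) ∷ []

-- The position in languages of a pattern with the same avoiders, for each code of a shading.
table : Kind → List ℕ
table desc =
  0 ∷ 6 ∷ 0 ∷ 6 ∷ 0 ∷ 6 ∷ 0 ∷ 6 ∷ 0 ∷ 6 ∷ 0 ∷ 6 ∷ 0 ∷ 6 ∷ 0 ∷ 6 ∷ 0 ∷ 6 ∷ 0 ∷ 6 ∷ 0 ∷ 6 ∷ 0 ∷ 6 ∷ 0 ∷ 6 ∷ 0 ∷ 6 ∷ 0 ∷ 6 ∷ 0 ∷ 6 ∷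
  0 ∷ 6 ∷ 0 ∷ 6 ∷ 0 ∷ 6 ∷ 0 ∷ 6 ∷ 0 ∷ 6 ∷ 0 ∷ 6 ∷ 0 ∷ 6 ∷ 0 ∷ 6 ∷ 0 ∷ 6 ∷ 0 ∷ 6 ∷ 0 ∷ 6 ∷ 0 ∷ 6 ∷ 0 ∷ 6 ∷ 0 ∷ 6 ∷ 0 ∷ 6 ∷ 0 ∷ 6 ∷
  0 ∷ 6 ∷ 0 ∷ 6 ∷ 0 ∷ 6 ∷ 0 ∷ 6 ∷ 0 ∷ 6 ∷ 0 ∷ 6 ∷ 0 ∷ 6 ∷ 0 ∷ 6 ∷ 0 ∷ 6 ∷ 0 ∷ 6 ∷ 7 ∷ 34 ∷ 7 ∷ 34 ∷ 0 ∷ 6 ∷ 0 ∷ 6 ∷ 14 ∷ 42 ∷ 14 ∷ 42 ∷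
  0 ∷ 6 ∷ 0 ∷ 6 ∷ 0 ∷ 6 ∷ 0 ∷ 6 ∷ 0 ∷ 6 ∷ 0 ∷ 6 ∷ 0 ∷ 6 ∷ 0 ∷ 6 ∷ 0 ∷ 6 ∷ 0 ∷ 6 ∷ 7 ∷ 34 ∷ 7 ∷ 34 ∷ 0 ∷ 6 ∷ 0 ∷ 6 ∷ 14 ∷ 42 ∷ 14 ∷ 42 ∷
  0 ∷ 6 ∷ 0 ∷ 6 ∷ 0 ∷ 6 ∷ 0 ∷ 6 ∷ 2 ∷ 35 ∷ 2 ∷ 35 ∷ 15 ∷ 43 ∷ 15 ∷ 43 ∷ 0 ∷ 6 ∷ 0 ∷ 6 ∷ 0 ∷ 6 ∷ 0 ∷ 6 ∷ 2 ∷ 35 ∷ 2 ∷ 35 ∷ 15 ∷ 43 ∷ 15 ∷ 43 ∷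
  0 ∷ 6 ∷ 0 ∷ 6 ∷ 0 ∷ 6 ∷ 0 ∷ 6 ∷ 2 ∷ 35 ∷ 2 ∷ 35 ∷ 15 ∷ 43 ∷ 15 ∷ 43 ∷ 0 ∷ 6 ∷ 0 ∷ 6 ∷ 0 ∷ 6 ∷ 0 ∷ 6 ∷ 2 ∷ 35 ∷ 2 ∷ 35 ∷ 15 ∷ 43 ∷ 15 ∷ 43 ∷
  0 ∷ 6 ∷ 0 ∷ 6 ∷ 0 ∷ 6 ∷ 0 ∷ 6 ∷ 5 ∷ 44 ∷ 5 ∷ 44 ∷ 28 ∷ 60 ∷ 28 ∷ 60 ∷ 0 ∷ 16 ∷ 0 ∷ 16 ∷ 17 ∷ 45 ∷ 17 ∷ 45 ∷ 5 ∷ 44 ∷ 5 ∷ 44 ∷ 59 ∷ 79 ∷ 59 ∷ 79 ∷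
  0 ∷ 6 ∷ 0 ∷ 6 ∷ 0 ∷ 6 ∷ 0 ∷ 6 ∷ 5 ∷ 44 ∷ 5 ∷ 44 ∷ 28 ∷ 60 ∷ 28 ∷ 60 ∷ 0 ∷ 16 ∷ 0 ∷ 16 ∷ 17 ∷ 45 ∷ 17 ∷ 45 ∷ 5 ∷ 44 ∷ 5 ∷ 44 ∷ 59 ∷ 79 ∷ 59 ∷ 79 ∷
  8 ∷ 46 ∷ 8 ∷ 46 ∷ 8 ∷ 46 ∷ 8 ∷ 46 ∷ 8 ∷ 46 ∷ 8 ∷ 46 ∷ 8 ∷ 46 ∷ 8 ∷ 46 ∷ 8 ∷ 46 ∷ 8 ∷ 46 ∷ 8 ∷ 46 ∷ 8 ∷ 46 ∷ 8 ∷ 46 ∷ 8 ∷ 46 ∷ 8 ∷ 46 ∷ 8 ∷ 46 ∷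
  8 ∷ 46 ∷ 8 ∷ 46 ∷ 8 ∷ 46 ∷ 8 ∷ 46 ∷ 8 ∷ 46 ∷ 8 ∷ 46 ∷ 8 ∷ 46 ∷ 8 ∷ 46 ∷ 8 ∷ 46 ∷ 8 ∷ 46 ∷ 8 ∷ 46 ∷ 8 ∷ 46 ∷ 8 ∷ 46 ∷ 8 ∷ 46 ∷ 8 ∷ 46 ∷ 8 ∷ 46 ∷
  8 ∷ 46 ∷ 8 ∷ 46 ∷ 8 ∷ 46 ∷ 8 ∷ 46 ∷ 8 ∷ 46 ∷ 8 ∷ 46 ∷ 8 ∷ 46 ∷ 8 ∷ 46 ∷ 8 ∷ 58 ∷ 8 ∷ 58 ∷ 36 ∷ 76 ∷ 36 ∷ 76 ∷ 18 ∷ 61 ∷ 18 ∷ 61 ∷ 47 ∷ 80 ∷ 47 ∷ 80 ∷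
  8 ∷ 46 ∷ 8 ∷ 46 ∷ 8 ∷ 46 ∷ 8 ∷ 46 ∷ 8 ∷ 46 ∷ 8 ∷ 46 ∷ 8 ∷ 46 ∷ 8 ∷ 46 ∷ 8 ∷ 58 ∷ 8 ∷ 58 ∷ 36 ∷ 76 ∷ 36 ∷ 76 ∷ 18 ∷ 61 ∷ 18 ∷ 61 ∷ 47 ∷ 80 ∷ 47 ∷ 80 ∷
  8 ∷ 46 ∷ 8 ∷ 46 ∷ 8 ∷ 46 ∷ 8 ∷ 46 ∷ 37 ∷ 81 ∷ 37 ∷ 81 ∷ 48 ∷ 81 ∷ 48 ∷ 81 ∷ 8 ∷ 46 ∷ 8 ∷ 46 ∷ 8 ∷ 46 ∷ 8 ∷ 46 ∷ 37 ∷ 81 ∷ 37 ∷ 81 ∷ 48 ∷ 81 ∷ 48 ∷ 81 ∷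
  8 ∷ 46 ∷ 8 ∷ 46 ∷ 8 ∷ 46 ∷ 8 ∷ 46 ∷ 37 ∷ 81 ∷ 37 ∷ 81 ∷ 48 ∷ 81 ∷ 48 ∷ 81 ∷ 8 ∷ 46 ∷ 8 ∷ 46 ∷ 8 ∷ 46 ∷ 8 ∷ 46 ∷ 37 ∷ 81 ∷ 37 ∷ 81 ∷ 48 ∷ 81 ∷ 48 ∷ 81 ∷
  8 ∷ 46 ∷ 8 ∷ 46 ∷ 8 ∷ 46 ∷ 8 ∷ 46 ∷ 49 ∷ 89 ∷ 49 ∷ 89 ∷ 62 ∷ 89 ∷ 62 ∷ 89 ∷ 8 ∷ 63 ∷ 8 ∷ 63 ∷ 50 ∷ 82 ∷ 50 ∷ 82 ∷ 49 ∷ 89 ∷ 49 ∷ 89 ∷ 83 ∷ 93 ∷ 83 ∷ 93 ∷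
  8 ∷ 46 ∷ 8 ∷ 46 ∷ 8 ∷ 46 ∷ 8 ∷ 46 ∷ 49 ∷ 89 ∷ 49 ∷ 89 ∷ 62 ∷ 89 ∷ 62 ∷ 89 ∷ 8 ∷ 63 ∷ 8 ∷ 63 ∷ 50 ∷ 82 ∷ 50 ∷ 82 ∷ 49 ∷ 89 ∷ 49 ∷ 89 ∷ 83 ∷ 93 ∷ 83 ∷ 93 ∷ []
table asc =
  1 ∷ 1 ∷ 1 ∷ 1 ∷ 9 ∷ 9 ∷ 9 ∷ 9 ∷ 1 ∷ 1 ∷ 3 ∷ 10 ∷ 9 ∷ 9 ∷ 38 ∷ 51 ∷ 1 ∷ 1 ∷ 1 ∷ 1 ∷ 9 ∷ 9 ∷ 9 ∷ 9 ∷ 1 ∷ 1 ∷ 3 ∷ 10 ∷ 9 ∷ 21 ∷ 38 ∷ 51 ∷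
  1 ∷ 1 ∷ 1 ∷ 1 ∷ 9 ∷ 9 ∷ 9 ∷ 9 ∷ 1 ∷ 1 ∷ 3 ∷ 10 ∷ 9 ∷ 9 ∷ 38 ∷ 51 ∷ 1 ∷ 1 ∷ 1 ∷ 1 ∷ 9 ∷ 9 ∷ 9 ∷ 9 ∷ 1 ∷ 1 ∷ 3 ∷ 10 ∷ 9 ∷ 21 ∷ 38 ∷ 51 ∷
  1 ∷ 1 ∷ 1 ∷ 1 ∷ 9 ∷ 9 ∷ 9 ∷ 9 ∷ 1 ∷ 1 ∷ 3 ∷ 10 ∷ 9 ∷ 9 ∷ 38 ∷ 51 ∷ 1 ∷ 1 ∷ 1 ∷ 1 ∷ 9 ∷ 9 ∷ 9 ∷ 9 ∷ 1 ∷ 1 ∷ 3 ∷ 10 ∷ 9 ∷ 21 ∷ 38 ∷ 51 ∷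
  1 ∷ 1 ∷ 1 ∷ 1 ∷ 9 ∷ 9 ∷ 9 ∷ 9 ∷ 1 ∷ 1 ∷ 3 ∷ 10 ∷ 9 ∷ 9 ∷ 38 ∷ 51 ∷ 1 ∷ 1 ∷ 1 ∷ 1 ∷ 9 ∷ 9 ∷ 9 ∷ 9 ∷ 1 ∷ 1 ∷ 3 ∷ 10 ∷ 9 ∷ 21 ∷ 38 ∷ 51 ∷
  1 ∷ 1 ∷ 1 ∷ 1 ∷ 9 ∷ 9 ∷ 9 ∷ 9 ∷ 1 ∷ 1 ∷ 3 ∷ 10 ∷ 9 ∷ 9 ∷ 38 ∷ 51 ∷ 1 ∷ 1 ∷ 1 ∷ 1 ∷ 9 ∷ 9 ∷ 9 ∷ 9 ∷ 1 ∷ 1 ∷ 3 ∷ 10 ∷ 9 ∷ 21 ∷ 38 ∷ 51 ∷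
  4 ∷ 11 ∷ 4 ∷ 11 ∷ 39 ∷ 39 ∷ 39 ∷ 39 ∷ 4 ∷ 11 ∷ 32 ∷ 40 ∷ 39 ∷ 39 ∷ 74 ∷ 77 ∷ 4 ∷ 19 ∷ 4 ∷ 19 ∷ 39 ∷ 52 ∷ 39 ∷ 52 ∷ 4 ∷ 22 ∷ 33 ∷ 53 ∷ 39 ∷ 64 ∷ 75 ∷ 84 ∷
  1 ∷ 1 ∷ 1 ∷ 1 ∷ 9 ∷ 9 ∷ 9 ∷ 9 ∷ 1 ∷ 1 ∷ 3 ∷ 10 ∷ 9 ∷ 9 ∷ 38 ∷ 51 ∷ 1 ∷ 1 ∷ 1 ∷ 1 ∷ 9 ∷ 9 ∷ 9 ∷ 9 ∷ 1 ∷ 1 ∷ 3 ∷ 10 ∷ 9 ∷ 21 ∷ 38 ∷ 51 ∷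
  4 ∷ 11 ∷ 4 ∷ 11 ∷ 39 ∷ 39 ∷ 39 ∷ 39 ∷ 4 ∷ 11 ∷ 32 ∷ 40 ∷ 39 ∷ 39 ∷ 74 ∷ 77 ∷ 4 ∷ 19 ∷ 4 ∷ 19 ∷ 39 ∷ 52 ∷ 39 ∷ 52 ∷ 4 ∷ 22 ∷ 33 ∷ 53 ∷ 39 ∷ 64 ∷ 75 ∷ 84 ∷
  1 ∷ 1 ∷ 1 ∷ 1 ∷ 9 ∷ 9 ∷ 9 ∷ 9 ∷ 1 ∷ 1 ∷ 12 ∷ 23 ∷ 9 ∷ 9 ∷ 38 ∷ 51 ∷ 1 ∷ 24 ∷ 1 ∷ 24 ∷ 9 ∷ 54 ∷ 9 ∷ 54 ∷ 1 ∷ 29 ∷ 20 ∷ 65 ∷ 9 ∷ 66 ∷ 55 ∷ 85 ∷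
  1 ∷ 1 ∷ 1 ∷ 1 ∷ 9 ∷ 9 ∷ 9 ∷ 9 ∷ 1 ∷ 1 ∷ 12 ∷ 23 ∷ 9 ∷ 9 ∷ 38 ∷ 51 ∷ 1 ∷ 24 ∷ 1 ∷ 24 ∷ 9 ∷ 54 ∷ 9 ∷ 54 ∷ 1 ∷ 29 ∷ 20 ∷ 65 ∷ 9 ∷ 66 ∷ 55 ∷ 85 ∷
  1 ∷ 1 ∷ 1 ∷ 1 ∷ 9 ∷ 9 ∷ 9 ∷ 9 ∷ 1 ∷ 1 ∷ 12 ∷ 23 ∷ 9 ∷ 9 ∷ 38 ∷ 51 ∷ 1 ∷ 24 ∷ 1 ∷ 24 ∷ 9 ∷ 54 ∷ 9 ∷ 54 ∷ 1 ∷ 29 ∷ 20 ∷ 65 ∷ 9 ∷ 66 ∷ 55 ∷ 85 ∷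
  1 ∷ 1 ∷ 1 ∷ 1 ∷ 9 ∷ 9 ∷ 9 ∷ 9 ∷ 1 ∷ 1 ∷ 12 ∷ 23 ∷ 9 ∷ 9 ∷ 38 ∷ 51 ∷ 1 ∷ 24 ∷ 1 ∷ 24 ∷ 9 ∷ 54 ∷ 9 ∷ 54 ∷ 1 ∷ 29 ∷ 20 ∷ 65 ∷ 9 ∷ 66 ∷ 55 ∷ 85 ∷
  1 ∷ 1 ∷ 1 ∷ 1 ∷ 9 ∷ 9 ∷ 9 ∷ 9 ∷ 1 ∷ 1 ∷ 12 ∷ 23 ∷ 9 ∷ 9 ∷ 38 ∷ 51 ∷ 1 ∷ 30 ∷ 1 ∷ 30 ∷ 25 ∷ 67 ∷ 25 ∷ 67 ∷ 1 ∷ 31 ∷ 26 ∷ 71 ∷ 25 ∷ 72 ∷ 68 ∷ 90 ∷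
  13 ∷ 27 ∷ 13 ∷ 27 ∷ 56 ∷ 56 ∷ 56 ∷ 56 ∷ 13 ∷ 27 ∷ 41 ∷ 69 ∷ 56 ∷ 56 ∷ 78 ∷ 86 ∷ 13 ∷ 70 ∷ 13 ∷ 70 ∷ 56 ∷ 87 ∷ 56 ∷ 87 ∷ 13 ∷ 73 ∷ 57 ∷ 91 ∷ 56 ∷ 92 ∷ 88 ∷ 94 ∷
  1 ∷ 1 ∷ 1 ∷ 1 ∷ 9 ∷ 9 ∷ 9 ∷ 9 ∷ 1 ∷ 1 ∷ 12 ∷ 23 ∷ 9 ∷ 9 ∷ 38 ∷ 51 ∷ 1 ∷ 30 ∷ 1 ∷ 30 ∷ 25 ∷ 67 ∷ 25 ∷ 67 ∷ 1 ∷ 31 ∷ 26 ∷ 71 ∷ 25 ∷ 72 ∷ 68 ∷ 90 ∷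
  13 ∷ 27 ∷ 13 ∷ 27 ∷ 56 ∷ 56 ∷ 56 ∷ 56 ∷ 13 ∷ 27 ∷ 41 ∷ 69 ∷ 56 ∷ 56 ∷ 78 ∷ 86 ∷ 13 ∷ 70 ∷ 13 ∷ 70 ∷ 56 ∷ 87 ∷ 56 ∷ 87 ∷ 13 ∷ 73 ∷ 57 ∷ 91 ∷ 56 ∷ 92 ∷ 88 ∷ 94 ∷ []

nth : ∀ {A : Set} → A → List A → ℕ → A
nth d []       _       = d
nth d (x ∷ xs) zero    = x
nth d (x ∷ xs) (suc n) = nth d xs n

-- Makes `nth` total. It copies the first entry of the table, hence passes the same tests.
fallback : Language
fallback = language (# 0) desc 0 (solved catalan (1 ∷ 1 ∷ 1 ∷ []) ((8 , 0 ∷ 1 ∷ []) ∷ []))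

languageOf : Kind → Shading 2 → Language
languageOf k R = nth fallback languages (nth 0 (table k) (codeOf R))

automatonOf : Language → Automaton State
automatonOf (language _ k m _) = patternAutomaton k (shadingOf m)

_==²_ : State × State → State × State → Bool
(a , b) ==² (c , d) = (a ==ˢ c) ∧ (b ==ˢ d)

==²-sound : ∀ {a b} → T (a ==² b) → a ≡ b
==²-sound {a , b} {c , d} t = cong₂ _,_ (==ˢ-sound (proj₁ (∧-split {a ==ˢ c} t))) (==ˢ-sound (proj₂ (∧-split {a ==ˢ c} t)))

accepting : State → Bool
accepting s = not (State.o s)

module _ (A B : Automaton State) where
  open Reachability _==²_ ==²-sound (A ⊗ B)
  -- A set of pairs closed under the product automaton on which acceptance agrees is a bisimulation.
  -- The list is a parameter so that soundness never looks into the computed `states`.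
  bisimilarOn : List (State × State) → Bool
  bisimilarOn L = closed L ∧ all (λ (s , t) → iff (accepting s) (accepting t)) L
  bisimilar : Bool
  bisimilar = bisimilarOn states

allSubsets : ∀ n → (Vec Bool n → Bool) → Bool
allSubsets zero    f = f []
allSubsets (suc n) f = allSubsets n (f ∘ (true ∷_)) ∧ allSubsets n (f ∘ (false ∷_))

allShadings : (Shading 2 → Bool) → Bool
allShadings f = allSubsets 3 λ a → allSubsets 3 λ b → allSubsets 3 λ c → f (a ∷ b ∷ c ∷ [])

coincides : Kind → Shading 2 → Bool
coincides k R = bisimilar (patternAutomaton k R) (automatonOf (languageOf k R))

-- Counting by classes

accepts? : Automaton State → Tree → Bool
accepts? A t = accepting (Automaton.run A t)

-- The length of a list, because avoiders are later numbered by the indices of exactly this list.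
counts : Automaton State → Series
counts A n = length (filterᵇ (accepts? A) (trees n))

counts≗gf : ∀ A → counts A ≗ gf (ind ∘ accepts? A)
counts≗gf A n = length-filterᵇ (accepts? A) (trees n)

counts-cong : ∀ A B → (∀ t → accepts? A t ≡ accepts? B t) → counts A ≗ counts B
counts-cong A B p n = trans (counts≗gf A n) (trans (gf-cong (λ t → cong ind (p t)) n) (sym (counts≗gf B n)))

bisimilarOn-sound : ∀ A B L → T (bisimilarOn A B L) → ∀ t → accepts? A t ≡ accepts? B t
bisimilarOn-sound A B L ok t = iff-sound (subst (λ (a , b) → T (iff (accepting a) (accepting b))) (run-⊗ A B t)
  (All.lookup (all⁺ _ L (proj₂ (∧-split {closed L} ok))) (run∈ L (proj₁ (∧-split {closed L} ok)) t)))
  where open Reachability _==²_ ==²-sound (A ⊗ B)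

bisimilar-sound : ∀ A B → T (bisimilar A B) → ∀ t → accepts? A t ≡ accepts? B t
bisimilar-sound A B = bisimilarOn-sound A B (Reachability.states _==²_ ==²-sound (A ⊗ B))

allSubsets-sound : ∀ n (f : Vec Bool n → Bool) → T (allSubsets n f) → ∀ v → T (f v)
allSubsets-sound zero    f p []          = p
allSubsets-sound (suc n) f p (true  ∷ v) =
  allSubsets-sound n (f ∘ (true ∷_)) (proj₁ (∧-split {allSubsets n (f ∘ (true ∷_))} p)) v
allSubsets-sound (suc n) f p (false ∷ v) =
  allSubsets-sound n (f ∘ (false ∷_)) (proj₂ (∧-split {allSubsets n (f ∘ (true ∷_))} p)) v

allShadings-sound : ∀ f → T (allShadings f) → ∀ R → T (f R)
allShadings-sound f p (a ∷ b ∷ c ∷ []) =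
  allSubsets-sound 3 (λ c → f (a ∷ b ∷ c ∷ []))
    (allSubsets-sound 3 (λ b → allSubsets 3 λ c → f (a ∷ b ∷ c ∷ []))
      (allSubsets-sound 3 (λ a → allSubsets 3 λ b → allSubsets 3 λ c → f (a ∷ b ∷ c ∷ [])) p a) b) c

-- The large tests are stated as equations with `true`, proved by `refl` inside blocks that unfold
-- the opaque definitions. Elsewhere the tests stay unevaluated, and this turns their results into
-- the form that the soundness lemmas take.
by-evaluation : ∀ {b} → b ≡ true → T b
by-evaluation refl = tt

opaque
  unfolding Reachability.states

  -- For each kind, a bisimulation between each of the 512 shadings and its entry in the table.
  all-coincide : ∀ k → allShadings (coincides k) ≡ true
  all-coincide asc  = refl
  all-coincide desc = refl

counts-languageOf : ∀ k R → counts (patternAutomaton k R) ≗ counts (automatonOf (languageOf k R))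
counts-languageOf k R = counts-cong A B (bisimilar-sound A B
  (allShadings-sound (coincides k) (by-evaluation (all-coincide k)) R))
  where
  A = patternAutomaton k R
  B = automatonOf (languageOf k R)

-- Equality of counting series within a class

-- The series of the state reached by the empty tree is 1.
values : Poly → List (ℕ × Poly) → List (State × Poly)
values D N = (stateOf 1 , D) ∷ map (λ (m , p) → stateOf m , p) N

module _ (A : Automaton State) (Φ D : Poly) (N : List (ℕ × Poly)) where
  open Reachability _==ˢ_ ==ˢ-sound A
  open StateSeries _==ˢ_ A accepting (values D N) Φ D

  solvesOn : List State → Bool
  solvesOn L = closed L ∧ (covering L ∧ valid)

  solves : Bool
  solves = solvesOn states

  solvesOn-sound : ∀ L → T (solvesOn L) → Inversion.eval Φ D ⊛ counts A ≗ Inversion.eval Φ numerator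
  solvesOn-sound L ok n = trans (⊛-cong {Inversion.eval Φ D} (λ _ → refl) (counts≗gf A) n)
    (accepted-rational L (run∈ L (proj₁ ok₁)) (proj₁ ok₂) (proj₂ ok₂) n)
    where
    ok₁ = ∧-split {closed L} ok
    ok₂ = ∧-split {covering L} (proj₂ ok₁)

  solves-sound : T solves → Inversion.eval Φ D ⊛ counts A ≗ Inversion.eval Φ numerator
  solves-sound = solvesOn-sound states

-- Literal equality of lists, stricter than `_==_`: the two parameters t must be the same series,
-- and `Inversion` is built from the list Φ itself.
_≋_ : Poly → Poly → Bool
[]      ≋ []      = true
(a ∷ p) ≋ (b ∷ q) = (a ≡ᵇ b) ∧ (p ≋ q)
_       ≋ _       = false

≋-sound : ∀ p q → T (p ≋ q) → p ≡ q
≋-sound []      []      _ = refl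
≋-sound (a ∷ p) (b ∷ q) e = cong₂ _∷_ (≡ᵇ⇒≡ a b (proj₁ (∧-split {a ≡ᵇ b} e))) (≋-sound p q (proj₂ (∧-split {a ≡ᵇ b} e)))

sameKind : Kind → Kind → Bool
sameKind asc  asc  = true
sameKind desc desc = true
sameKind _    _    = false

sameKind-sound : ∀ k k′ → T (sameKind k k′) → k ≡ k′
sameKind-sound asc  asc  _ = refl
sameKind-sound desc desc _ = refl

module _ (A A′ : Automaton State) (Φ D : Poly) (N : List (ℕ × Poly)) (Φ′ D′ : Poly) (N′ : List (ℕ × Poly)) where
  private
    P P′ : Poly
    P  = StateSeries.numerator _==ˢ_ A accepting (values D N) Φ D
    P′ = StateSeries.numerator _==ˢ_ A′ accepting (values D′ N′) Φ′ D′

  agree : Bool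
  agree = (Φ ≋ Φ′) ∧ (solves A Φ D N ∧ (solves A′ Φ′ D′ N′ ∧
    (isOne D ∧ (isOne D′ ∧ ((D′ ⊠ P) == (D ⊠ P′))))))

  agree-sound : T agree → counts A ≗ counts A′
  agree-sound ok = same-Φ (≋-sound Φ Φ′ (proj₁ ok₁)) (solves-sound A′ Φ′ D′ N′ (proj₁ ok₃))
    where
    ok₁ = ∧-split {Φ ≋ Φ′} ok
    ok₂ = ∧-split {solves A Φ D N} (proj₂ ok₁)
    ok₃ = ∧-split {solves A′ Φ′ D′ N′} (proj₂ ok₂)
    same-Φ : ∀ {Φ′} → Φ ≡ Φ′ → Inversion.eval Φ′ D′ ⊛ counts A′ ≗ Inversion.eval Φ′ P′ → counts A ≗ counts A′
    same-Φ refl s = rational-unique Φ {D} {D′} {P} {P′} (solves-sound A Φ D N (proj₁ ok₂)) s (proj₂ ok₃)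

-- An unsolved language is the representative of its own class, so the last clause only has to
-- recognise a language as itself.
equivalent : Language → Language → Bool
equivalent ℓ@(language _ _ _ (solved Φ D N)) ℓ′@(language _ _ _ (solved Φ′ D′ N′)) =
  agree (automatonOf ℓ) (automatonOf ℓ′) Φ D N Φ′ D′ N′
equivalent (language _ k m _) (language _ k′ m′ _) = sameKind k k′ ∧ (m ≡ᵇ m′)

samePattern-sound : ∀ k k′ m m′ → T (sameKind k k′ ∧ (m ≡ᵇ m′)) →
  counts (patternAutomaton k (shadingOf m)) ≗ counts (patternAutomaton k′ (shadingOf m′))
samePattern-sound k k′ m m′ ok n = cong₂ (λ k m → counts (patternAutomaton k (shadingOf m)) n)
  (sameKind-sound k k′ (proj₁ ok′)) (≡ᵇ⇒≡ m m′ (proj₂ ok′))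
  where ok′ = ∧-split {sameKind k k′} ok

equivalent-sound : ∀ ℓ ℓ′ → T (equivalent ℓ ℓ′) → counts (automatonOf ℓ) ≗ counts (automatonOf ℓ′)
equivalent-sound ℓ@(language _ _ _ (solved Φ D N)) ℓ′@(language _ _ _ (solved Φ′ D′ N′)) =
  agree-sound (automatonOf ℓ) (automatonOf ℓ′) Φ D N Φ′ D′ N′
equivalent-sound (language _ k m unsolved) (language _ k′ m′ _) = samePattern-sound k k′ m m′
equivalent-sound (language _ k m (solved _ _ _)) (language _ k′ m′ unsolved) = samePattern-sound k k′ m m′

firstOf : ∀ (c : Fin 23) → List Language → Language
firstOf c []       = fallback
firstOf c (ℓ ∷ ℓs) = if ⌊ c Fin.≟ Language.class ℓ ⌋ then ℓ else firstOf c ℓs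

opaque
  representative : Fin 23 → Language
  representative c = firstOf c languages

equivalentToRepresentative : Language → Bool
equivalentToRepresentative ℓ = equivalent ℓ (representative (Language.class ℓ))

opaque
  unfolding Reachability.states representative

  all-equivalent : all equivalentToRepresentative languages ≡ true
  all-equivalent = refl

  fallback-equivalent : equivalentToRepresentative fallback ≡ true
  fallback-equivalent = refl

nth-All : ∀ {A : Set} {P : A → Set} {d xs} → P d → All P xs → ∀ n → P (nth d xs n)
nth-All pd []       n       = pd
nth-All pd (p ∷ ps) zero    = p
nth-All pd (p ∷ ps) (suc n) = nth-All pd ps n

opaque
  classOf : Kind → Shading 2 → Fin 23
  classOf k R = Language.class (languageOf k R)

classAutomaton : Fin 23 → Automaton State
classAutomaton c = automatonOf (representative c)

opaque
  unfolding classOf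

  counts-class : ∀ k R → counts (patternAutomaton k R) ≗ counts (classAutomaton (classOf k R))
  counts-class k R n = trans (counts-languageOf k R n)
    (equivalent-sound (languageOf k R) (representative (classOf k R))
      (nth-All {P = T ∘ equivalentToRepresentative} (by-evaluation fallback-equivalent) (all⁺ equivalentToRepresentative languages (by-evaluation all-equivalent)) (nth 0 (table k) (codeOf R))) n)

-- No smaller length separates all classes.
countsAtSix : Vec ℕ 23
countsAtSix = 1 ∷ 21 ∷ 35 ∷ 42 ∷ 61 ∷ 68 ∷ 85 ∷ 93 ∷ 117 ∷ 43 ∷ 53 ∷ 75 ∷ 90 ∷ 95 ∷ 98 ∷ 109 ∷ 127 ∷ 97 ∷
              105 ∷ 108 ∷ 118 ∷ 131 ∷ 132 ∷ []

opaque
  unfolding representative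

  counts-at-six : Vec.tabulate (λ c → counts (classAutomaton c) 6) ≡ countsAtSix
  counts-at-six = refl

lookup-countsAtSix : ∀ c → counts (classAutomaton c) 6 ≡ Vec.lookup countsAtSix c
lookup-countsAtSix c = trans (sym (lookup∘tabulate (λ c → counts (classAutomaton c) 6) c)) (cong (λ v → Vec.lookup v c) counts-at-six)

countsAtSix-unique : UniqueVec.Unique countsAtSix
countsAtSix-unique = from-yes (AllPairs.allPairs? (λ a b → ¬? (a ≟ b)) countsAtSix)

counts-injective : ∀ c c′ → counts (classAutomaton c) ≗ counts (classAutomaton c′) → c ≡ c′
counts-injective c c′ p = lookup-injective countsAtSix-unique c c′
  (trans (sym (lookup-countsAtSix c)) (trans (p 6) (lookup-countsAtSix c′)))

patternClass : Fin 23 → Fin 23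
patternClass c = classOf (Language.kind (representative c)) (shadingOf (Language.code (representative c)))

opaque
  unfolding representative classOf

  -- Every class is inhabited: the table sends the pattern of the representative of c back to c.
  -- Surjectivity of the classification rests on this.
  patternClasses : Vec.tabulate patternClass ≡ Vec.tabulate id
  patternClasses = refl

patternClass-id : ∀ c → patternClass c ≡ c
patternClass-id c = trans (sym (lookup∘tabulate patternClass c))
  (trans (cong (λ v → Vec.lookup v c) patternClasses) (lookup∘tabulate id c))

-- Trees as permutations

inorder postorder : ∀ {t} → Node t → ℕ
inorder (inL x)              = inorder x
inorder {node l r} root      = size l
inorder {node l r} (inR x)   = size l + suc (inorder x)
postorder (inL x)            = postorder x
postorder {node l r} root    = size l + size r
postorder {node l r} (inR x) = size l + postorder x

inorder<size : ∀ {t} (x : Node t) → inorder x < size t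
inorder<size (inL x)            = m≤n⇒m≤n+o _ (inorder<size x)
inorder<size {node l r} root    = m<m+n (size l) z<s
inorder<size {node l r} (inR x) = +-monoʳ-< (size l) (s<s (inorder<size x))

postorder<size : ∀ {t} (x : Node t) → postorder x < size t
postorder<size (inL x)            = m≤n⇒m≤n+o _ (postorder<size x)
postorder<size {node l r} root    = +-monoʳ-< (size l) (n<1+n (size r))
postorder<size {node l r} (inR x) = +-monoʳ-< (size l) (m<n⇒m<1+n (postorder<size x))

nodeAt : ∀ t {i} → i < size t → ∃ λ (x : Node t) → inorder x ≡ i
nodeAt (node l r) {i} p with <-cmp i (size l)
... | tri< i<l _ _ = let x , e = nodeAt l i<l in inL x , e
... | tri≈ _ e _   = root , sym e
... | tri> _ _ l<i with m≤n⇒∃[o]m+o≡n l<i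
...   | k , refl = let x , e = nodeAt r (+-cancelˡ-< (suc (size l)) _ _ (subst (suc (size l) + k <_) (+-suc _ _) p))
                   in inR x , trans (+-suc _ _) (cong (λ j → suc (size l + j)) e)

nodeOf : ∀ t {j} → j < size t → ∃ λ (x : Node t) → postorder x ≡ j
nodeOf (node l r) {j} p with <-≤-connex j (size l)
... | inj₁ j<l = let x , e = nodeOf l j<l in inL x , e
... | inj₂ l≤j with m≤n⇒∃[o]m+o≡n l≤j
...   | k , refl with m<1+n⇒m<n∨m≡n (+-cancelˡ-< (size l) k (suc (size r)) p)
...     | inj₁ k<r  = let x , e = nodeOf r k<r in inR x , cong (size l +_) e
...     | inj₂ refl = root , refl

-- In the uses below, the first number belongs to the node that is seen, the second to the node from
-- which it is seen, in accordance with `direction`.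
Compares : Order → ℕ → ℕ → Set
Compares lt m n = m < n
Compares eq m n = m ≡ n
Compares gt m n = n < m

Compares-shift : ∀ o k {m n} → Compares o m n → Compares o (k + m) (k + n)
Compares-shift lt k p = +-monoʳ-< k p
Compares-shift eq k p = cong (k +_) p
Compares-shift gt k p = +-monoʳ-< k p

Compares-suc : ∀ o {m n} → Compares o m n → Compares o (suc m) (suc n)
Compares-suc o = Compares-shift o 1

Compares-lt : ∀ o {m n} → Compares o m n → m < n → o ≡ lt
Compares-lt lt _ _ = refl
Compares-lt eq p q = contradiction p (<⇒≢ q)
Compares-lt gt p q = contradiction p (<-asym q)

Compares-gt : ∀ o {m n} → Compares o m n → n < m → o ≡ gt
Compares-gt lt p q = contradiction p (<-asym q)
Compares-gt eq p q = contradiction (sym p) (<⇒≢ q)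
Compares-gt gt _ _ = refl

Compares-eq : ∀ o {m n} → Compares o m n → m ≡ n → o ≡ eq
Compares-eq lt p q = contradiction q (<⇒≢ p)
Compares-eq eq _ _ = refl
Compares-eq gt p q = contradiction (sym q) (<⇒≢ p)

inorder-compares : ∀ {t} (x y : Node t) → Compares (horizontal (direction x y)) (inorder y) (inorder x)
inorder-compares (inL x) (inL y) = inorder-compares x y
inorder-compares (inL x) root    = inorder<size x
inorder-compares (inL x) (inR y) = m≤n⇒m≤n+o _ (inorder<size x)
inorder-compares root    (inL y) = inorder<size y
inorder-compares root    root    = refl
inorder-compares {node l r} root    (inR y) = m<m+n (size l) z<s
inorder-compares (inR x) (inL y) = m≤n⇒m≤n+o _ (inorder<size y)
inorder-compares {node l r} (inR x) root    = m<m+n (size l) z<s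
inorder-compares {node l r} (inR x) (inR y) =
  Compares-shift (horizontal (direction x y)) (size l) (Compares-suc (horizontal (direction x y)) (inorder-compares x y))

postorder-compares : ∀ {t} (x y : Node t) → Compares (vertical (direction x y)) (postorder y) (postorder x)
postorder-compares (inL x) (inL y) = postorder-compares x y
postorder-compares (inL x) root    = m≤n⇒m≤n+o _ (postorder<size x)
postorder-compares (inL x) (inR y) = m≤n⇒m≤n+o _ (postorder<size x)
postorder-compares root    (inL y) = m≤n⇒m≤n+o _ (postorder<size y)
postorder-compares root    root    = refl
postorder-compares {node l r} root    (inR y) = +-monoʳ-< (size l) (postorder<size y)
postorder-compares (inR x) (inL y) = m≤n⇒m≤n+o _ (postorder<size y)
postorder-compares {node l r} (inR x) root    = +-monoʳ-< (size l) (postorder<size x)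
postorder-compares {node l r} (inR x) (inR y) =
  Compares-shift (vertical (direction x y)) (size l) (postorder-compares x y)

horizontal-eq : ∀ {d} → horizontal d ≡ eq → d ≡ same
horizontal-eq {same} _ = refl

vertical-eq : ∀ {d} → vertical d ≡ eq → d ≡ same
vertical-eq {same} _ = refl

direction-same : ∀ {t} (x y : Node t) → direction x y ≡ same → x ≡ y
direction-same (inL x) (inL y) e = cong inL (direction-same x y e)
direction-same root    root    e = refl
direction-same (inR x) (inR y) e = cong inR (direction-same x y e)

inorder-injective : ∀ {t} (x y : Node t) → inorder x ≡ inorder y → x ≡ y
inorder-injective x y e = direction-same x y (horizontal-eq (Compares-eq _ (inorder-compares x y) (sym e)))

postorder-injective : ∀ {t} (x y : Node t) → postorder x ≡ postorder y → x ≡ y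
postorder-injective x y e = direction-same x y (vertical-eq (Compares-eq _ (postorder-compares x y) (sym e)))

-- A relation, with positions compared as natural numbers, so that permutations of `Fin n` and trees
-- of size n meet without transport along `size≡`.
record Shape {n} (t : Tree) (π : Permutation′ n) : Set where
  constructor shape
  field
    size≡ : size t ≡ n
    fits  : ∀ x i → toℕ i ≡ inorder {t} x → toℕ (π ⟨$⟩ʳ i) ≡ postorder x

Shape-functional : ∀ {n t} {π ρ : Permutation′ n} → Shape t π → Shape t ρ → π ≈ ρ
Shape-functional {t = t} (shape refl p) (shape _ q) i =
  let x , e = nodeAt t (toℕ<n i) in toℕ-injective (trans (p x i (sym e)) (sym (q x i (sym e))))

Shape-resp-≈ : ∀ {n t} {π ρ : Permutation′ n} → π ≈ ρ → Shape t π → Shape t ρ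
Shape-resp-≈ e (shape s p) = shape s λ x i q → trans (cong toℕ (sym (e i))) (p x i q)

-- The root has the largest postorder number, and its inorder number is the size of the left
-- subtree. So both trees split at the same place, and the subtrees are compared recursively.
tree-unique : ∀ t t′ → size t ≡ size t′ →
              (∀ (x : Node t) (x′ : Node t′) → inorder x ≡ inorder x′ → postorder x ≡ postorder x′) → t ≡ t′
tree-unique leaf       leaf         _ _ = refl
tree-unique leaf       (node l r)   e _ = contradiction e (<⇒≢ (≤-<-trans z≤n (m<m+n (size l) z<s)))
tree-unique (node l r) leaf         e _ = contradiction (sym e) (<⇒≢ (≤-<-trans z≤n (m<m+n (size l) z<s)))
tree-unique (node l r) (node l′ r′) e p = cong₂ node
  (tree-unique l l′ sl λ x x′ → p (inL x) (inL x′))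
  (tree-unique r r′ sr λ x x′ q → +-cancelˡ-≡ (size l) _ _
    (trans (p (inR x) (inR x′) (cong₂ _+_ sl (cong suc q))) (cong (_+ postorder x′) (sym sl))))
  where
  top : size l + size r ≡ size l′ + size r′
  top = suc-injective (trans (sym (+-suc (size l) (size r))) (trans e (+-suc (size l′) (size r′))))
  is-root : ∀ (x : Node (node l′ r′)) → postorder x ≡ size l′ + size r′ → inorder x ≡ size l′
  is-root (inL x) q = contradiction q (<⇒≢ (m≤n⇒m≤n+o _ (postorder<size x)))
  is-root root    q = refl
  is-root (inR x) q = contradiction q (<⇒≢ (+-monoʳ-< (size l′) (postorder<size x)))
  sl : size l ≡ size l′
  sl = let x′ , e′ = nodeAt (node l′ r′) (subst (size l <_) e (m<m+n (size l) z<s))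
       in trans (sym e′) (is-root x′ (trans (sym (p root x′ (sym e′))) top))
  sr : size r ≡ size r′
  sr = +-cancelˡ-≡ (size l) _ _ (trans top (cong (_+ size r′) (sym sl)))

Shape-injective : ∀ {n t t′} {π : Permutation′ n} → Shape t π → Shape t′ π → t ≡ t′
Shape-injective {t = t} {t′} (shape refl p) (shape s q) = tree-unique t t′ (sym s) λ x x′ e →
  let i = fromℕ< (inorder<size x) ; ix = toℕ-fromℕ< (inorder<size x)
  in trans (sym (p x i ix)) (q x′ i (trans ix e))

toPermutation : ∀ t → Permutation′ (size t)
toPermutation t = permutation value position value-position position-value
  where
  value position : Fin (size t) → Fin (size t)
  value i    = fromℕ< (postorder<size (proj₁ (nodeAt t (toℕ<n i))))
  position j = fromℕ< (inorder<size (proj₁ (nodeOf t (toℕ<n j))))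
  value-position : ∀ i → value (position i) ≡ i
  value-position i = toℕ-injective (trans (toℕ-fromℕ< _) (trans
    (cong postorder (inorder-injective (proj₁ (nodeAt t (toℕ<n (position i)))) (proj₁ (nodeOf t (toℕ<n i)))
      (trans (proj₂ (nodeAt t (toℕ<n (position i)))) (toℕ-fromℕ< _))))
    (proj₂ (nodeOf t (toℕ<n i)))))
  position-value : ∀ i → position (value i) ≡ i
  position-value i = toℕ-injective (trans (toℕ-fromℕ< _) (trans
    (cong inorder (postorder-injective (proj₁ (nodeOf t (toℕ<n (value i)))) (proj₁ (nodeAt t (toℕ<n i)))
      (trans (proj₂ (nodeOf t (toℕ<n (value i)))) (toℕ-fromℕ< _))))
    (proj₂ (nodeAt t (toℕ<n i)))))

toPermutation-Shape : ∀ t → Shape t (toPermutation t)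
toPermutation-Shape t = shape refl λ x i e → trans (toℕ-fromℕ< _)
  (cong postorder (inorder-injective (proj₁ (nodeAt t (toℕ<n i))) x (trans (proj₂ (nodeAt t (toℕ<n i))) e)))

-- Occurrences in permutations

some-sound : ∀ t {f : Node t → Bool} → T (some t f) → ∃ λ x → T (f x)
some-sound (node l r) {f} p with some l (f ∘ inL) in eq | f root in eq′
... | true  | _     = let x , q = some-sound l (subst T (sym eq) tt) in inL x , q
... | false | true  = root , subst T (sym eq′) tt
... | false | false = let x , q = some-sound r p in inR x , q

some-complete : ∀ t {f : Node t → Bool} x → T (f x) → T (some t f)
some-complete (node l r) {f} x p with some l (f ∘ inL) in eq | f root in eq′ | x
... | true  | _     | _     = tt
... | false | true  | _     = tt
... | false | _     | inL y = contradiction (some-complete l {f ∘ inL} y p) (subst T eq)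
... | false | false | root  = contradiction p (subst T eq′)
... | false | false | inR y = some-complete r {f ∘ inR} y p

every-sound : ∀ t {f : Node t → Bool} → T (every t f) → ∀ x → T (f x)
every-sound (node l r) {f} p (inL x) = every-sound l (proj₁ (∧-split {every l (f ∘ inL)} p)) x
every-sound (node l r) {f} p root    = proj₁ (∧-split {f root} (proj₂ (∧-split {every l (f ∘ inL)} p)))
every-sound (node l r) {f} p (inR x) = every-sound r (proj₂ (∧-split {f root} (proj₂ (∧-split {every l (f ∘ inL)} p)))) x

∧-join : ∀ {a b} → T a → T b → T (a ∧ b)
∧-join {true} _ q = q

every-complete : ∀ t {f : Node t → Bool} → (∀ x → T (f x)) → T (every t f)
every-complete leaf       p = tt
every-complete (node l r) p = ∧-join (every-complete l (p ∘ inL)) (∧-join (p root) (every-complete r (p ∘ inR)))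

module _ {k n} {α : Fin k → Fin n} where

  increasing⇒OPI : (∀ i j → i Fin.< j → α i Fin.< α j) → OrderPreservingInjection α
  increasing⇒OPI inc = (λ {i} {j} → inj i j) , (λ {i} {j} → mono i j)
    where
    inj : ∀ i j → α i ≡ α j → i ≡ j
    inj i j e with Fin.<-cmp i j
    ... | tri< i<j _ _ = contradiction (cong toℕ e) (<⇒≢ (inc i j i<j))
    ... | tri≈ _ i≡j _ = i≡j
    ... | tri> _ _ j<i = contradiction (cong toℕ (sym e)) (<⇒≢ (inc j i j<i))
    mono : ∀ i j → i Fin.≤ j → α i Fin.≤ α j
    mono i j i≤j with m≤n⇒m<n∨m≡n i≤j
    ... | inj₁ i<j = <⇒≤ (inc i j i<j)
    ... | inj₂ i≡j = ≤-reflexive (cong (toℕ ∘ α) (toℕ-injective i≡j))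

  OPI⇒increasing : OrderPreservingInjection α → ∀ i j → i Fin.< j → α i Fin.< α j
  OPI⇒increasing (inj , mono) i j i<j = ≤∧≢⇒< (mono (<⇒≤ i<j)) λ e → <⇒≢ i<j (cong toℕ (inj (toℕ-injective e)))

increasing₂ : ∀ {n} {a b : Fin n} → a Fin.< b → OrderPreservingInjection (lookup (a ∷ b ∷ []))
increasing₂ a<b = increasing⇒OPI λ where
  0F 0F ()
  0F 1F _ → a<b
  1F 0F ()
  1F 1F (s≤s ())

increasing₃ : ∀ {n} {a b c : Fin n} → a Fin.< b → b Fin.< c → OrderPreservingInjection (lookup (a ∷ b ∷ c ∷ []))
increasing₃ a<b b<c = increasing⇒OPI λ where
  0F 0F ()
  0F 1F _ → a<b
  0F 2F _ → <-trans a<b b<c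
  1F 0F ()
  1F 1F (s≤s ())
  1F 2F _ → b<c
  2F 0F ()
  2F 1F (s≤s ())
  2F 2F (s≤s (s≤s ()))

module _ {n} (α : Fin 2 → Fin n) {x : Fin n} where

  gap⇒Gap : ∀ o o′ → Compares o (toℕ x) (toℕ (α 0F)) → Compares o′ (toℕ x) (toℕ (α 1F)) →
            ∀ i → gap o o′ ≡ just i → Gap α i x
  gap⇒Gap lt _  p q 0F refl = z<s , s<s p
  gap⇒Gap gt lt p q 1F refl = s<s p , s<s q
  gap⇒Gap gt gt p q 2F refl = s<s q , s<s (toℕ<n x)

  Gap⇒gap : ∀ o o′ → Compares o (toℕ x) (toℕ (α 0F)) → Compares o′ (toℕ x) (toℕ (α 1F)) →
            α 0F Fin.< α 1F → ∀ i → Gap α i x → gap o o′ ≡ just i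
  Gap⇒gap o o′ p q α< 0F (_ , b) rewrite Compares-lt o p (s<s⁻¹ b) = refl
  Gap⇒gap o o′ p q α< 1F (a , b) rewrite Compares-gt o p (s<s⁻¹ a) | Compares-lt o′ q (s<s⁻¹ b) = refl
  Gap⇒gap o o′ p q α< 2F (a , _) rewrite Compares-gt o p (<-trans α< (s<s⁻¹ a)) | Compares-gt o′ q (s<s⁻¹ a) = refl

-- Only the values of τ matter for occurrences. Classifying by values avoids equations between
-- permutations, which also contain inverses and proofs.
data IsKind (τ : Permutation′ 2) : Kind → Set where
  is-asc  : τ ⟨$⟩ʳ 0F ≡ 0F → τ ⟨$⟩ʳ 1F ≡ 1F → IsKind τ asc
  is-desc : τ ⟨$⟩ʳ 0F ≡ 1F → τ ⟨$⟩ʳ 1F ≡ 0F → IsKind τ desc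

classify : ∀ τ → ∃ (IsKind τ)
classify τ with τ ⟨$⟩ʳ 0F in e | τ ⟨$⟩ʳ 1F in e′
... | 0F | 1F = asc , is-asc e e′
... | 1F | 0F = desc , is-desc e e′
... | 0F | 0F with () ← Injection.injective (↔⇒↣ τ) (trans e (sym e′))
... | 1F | 1F with () ← Injection.injective (↔⇒↣ τ) (trans e (sym e′))

kindOf : Permutation′ 2 → Kind
kindOf = proj₁ ∘ classify

module _ {n t} {π : Permutation′ n} (sh : Shape t π) where
  open Shape sh

  position : Node t → Fin n
  position x = fromℕ< (subst (inorder x <_) size≡ (inorder<size x))

  toℕ-position : ∀ x → toℕ (position x) ≡ inorder x
  toℕ-position x = toℕ-fromℕ< _

  value≡ : ∀ x → toℕ (π ⟨$⟩ʳ position x) ≡ postorder x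
  value≡ x = fits x (position x) (toℕ-position x)

  nodeFor : ∀ i → ∃ λ x → position x ≡ i
  nodeFor i = let x , e = nodeAt t (subst (toℕ i <_) (sym size≡) (toℕ<n i))
              in x , toℕ-injective (trans (toℕ-position x) e)

  positions-compare : ∀ x z → Compares (horizontal (direction x z)) (toℕ (position z)) (toℕ (position x))
  positions-compare x z rewrite toℕ-position x | toℕ-position z = inorder-compares x z

  values-compare : ∀ x z → Compares (vertical (direction x z)) (toℕ (π ⟨$⟩ʳ position z)) (toℕ (π ⟨$⟩ʳ position x))
  values-compare x z rewrite value≡ x | value≡ z = postorder-compares x z

  module _ (R : Shading 2) where

    occurs⇒occurrence : ∀ {τ k} → IsKind τ k → T (occurs k R t) → ¬ Avoids π (mesh τ R)
    occurs⇒occurrence {τ} {k} kd occ avoids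
      with x , occ ← some-sound t occ
      with y , occ ← some-sound t occ
      with isPair , clear ← ∧-split {pairDirection k (direction x y)} occ =
      construct {x} {y} kd isPair (every-sound t clear)
      where
      construct : ∀ {x y k} → IsKind τ k → T (pairDirection k (direction x y)) →
                  (∀ z → T (allowed k R (direction x z) (direction y z))) → ⊥
      construct {x} {y} (is-asc e₀ e₁) pair clear with direction x y | positions-compare x y | values-compare x y
      ... | ne | px<py | vx<vy = avoids _ record
        { ω⊆G     = λ { (0F , _ , refl , refl , refl) → cong (lookup (vx ∷ vy ∷ [])) (sym e₀)
                      ; (1F , _ , refl , refl , refl) → cong (lookup (vx ∷ vy ∷ [])) (sym e₁) }
        ; α       = lookup (position x ∷ position y ∷ [])
        ; β       = lookup (vx ∷ vy ∷ [])
        ; α-mono  = increasing₂ px<py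
        ; β-mono  = increasing₂ vx<vy
        ; ω≐image = (λ m → m) , (λ m → m)
        ; empty   = λ { i j ij∈R (p , _) ((gi , gj) , refl) → blocked i j ij∈R p gi gj }
        }
        where
        vx = π ⟨$⟩ʳ position x
        vy = π ⟨$⟩ʳ position y
        blocked : ∀ i j → (i , j) ∈ˢ R → ∀ p → Gap (lookup (position x ∷ position y ∷ [])) i p →
                  Gap (lookup (vx ∷ vy ∷ [])) j (π ⟨$⟩ʳ p) → ⊥
        blocked i j ij∈R p gi gj with nodeFor p
        ... | z , refl = subst (T ∘ not) ([]=⇒lookup ij∈R) (subst T (cong₂ (unshaded R)
                (Gap⇒gap (lookup (position x ∷ position y ∷ [])) _ _ (positions-compare x z) (positions-compare y z) px<py i gi)
                (Gap⇒gap (lookup (vx ∷ vy ∷ [])) _ _ (values-compare x z) (values-compare y z) vx<vy j gj)) (clear z))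
      construct {x} {y} (is-desc e₀ e₁) pair clear with direction x y | positions-compare x y | values-compare x y
      ... | se | px<py | vy<vx = avoids _ record
        { ω⊆G     = λ { (0F , _ , refl , refl , refl) → cong (lookup (vy ∷ vx ∷ [])) (sym e₀)
                      ; (1F , _ , refl , refl , refl) → cong (lookup (vy ∷ vx ∷ [])) (sym e₁) }
        ; α       = lookup (position x ∷ position y ∷ [])
        -- The values must be listed in increasing order, and in a descent the right point is the
        -- lower one.
        ; β       = lookup (vy ∷ vx ∷ [])
        ; α-mono  = increasing₂ px<py
        ; β-mono  = increasing₂ vy<vx
        ; ω≐image = (λ m → m) , (λ m → m)
        ; empty   = λ { i j ij∈R (p , _) ((gi , gj) , refl) → blocked i j ij∈R p gi gj }
        }
        where
        vx = π ⟨$⟩ʳ position x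
        vy = π ⟨$⟩ʳ position y
        blocked : ∀ i j → (i , j) ∈ˢ R → ∀ p → Gap (lookup (position x ∷ position y ∷ [])) i p →
                  Gap (lookup (vy ∷ vx ∷ [])) j (π ⟨$⟩ʳ p) → ⊥
        blocked i j ij∈R p gi gj with nodeFor p
        ... | z , refl = subst (T ∘ not) ([]=⇒lookup ij∈R) (subst T (cong₂ (unshaded R)
                (Gap⇒gap (lookup (position x ∷ position y ∷ [])) _ _ (positions-compare x z) (positions-compare y z) px<py i gi)
                (Gap⇒gap (lookup (vy ∷ vx ∷ [])) _ _ (values-compare y z) (values-compare x z) vy<vx j gj)) (clear z))

    occurrence⇒occurs : ∀ {τ k} → IsKind τ k → ∀ {ω} → IsOccurrence (mesh τ R) π ω → T (occurs k R t)
    occurrence⇒occurs {τ} kd {ω} occ = go kd (nodeFor (α 0F)) (nodeFor (α 1F))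
      where
      open IsOccurrence occ
      image : ∀ i → π ⟨$⟩ʳ α i ≡ β (τ ⟨$⟩ʳ i)
      image i = ω⊆G (proj₂ ω≐image (i , τ ⟨$⟩ʳ i , refl , refl , refl))
      α< : α 0F Fin.< α 1F
      α< = OPI⇒increasing α-mono 0F 1F z<s
      β< : β 0F Fin.< β 1F
      β< = OPI⇒increasing β-mono 0F 1F z<s
      unblocked : ∀ {p} c r → (∀ i → c ≡ just i → Gap α i p) → (∀ j → r ≡ just j → Gap β j (π ⟨$⟩ʳ p)) →
                  T (unshaded R c r)
      unblocked nothing  _        _  _  = tt
      unblocked (just i) nothing  _  _  = tt
      unblocked (just i) (just j) gi gj with lookup (lookup R i) j in eq
      ... | false = tt
      ... | true  = empty i j (lookup⇒[]= j _ eq) _ ((gi i refl , gj j refl) , refl)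
      go : ∀ {k} → IsKind τ k → (∃ λ x → position x ≡ α 0F) → (∃ λ y → position y ≡ α 1F) → T (occurs k R t)
      go (is-asc e₀ e₁) (x , ex) (y , ey) = some-complete t x (some-complete t y (∧-join pair (every-complete t clear)))
        where
        vx : π ⟨$⟩ʳ position x ≡ β 0F
        vx = trans (cong (π ⟨$⟩ʳ_) ex) (trans (image 0F) (cong β e₀))
        vy : π ⟨$⟩ʳ position y ≡ β 1F
        vy = trans (cong (π ⟨$⟩ʳ_) ey) (trans (image 1F) (cong β e₁))
        pair : T (pairDirection asc (direction x y))
        pair with direction x y | Compares-gt _ (positions-compare x y) (subst₂ Fin._<_ (sym ex) (sym ey) α<)
                | Compares-gt _ (values-compare x y) (subst₂ Fin._<_ (sym vx) (sym vy) β<)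
        ... | ne | refl | refl = tt
        clear : ∀ z → T (allowed asc R (direction x z) (direction y z))
        clear z = unblocked (column asc (direction x z) (direction y z)) (row asc (direction x z) (direction y z))
          (gap⇒Gap α _ _ (subst (λ p → Compares _ _ (toℕ p)) ex (positions-compare x z))
                       (subst (λ p → Compares _ _ (toℕ p)) ey (positions-compare y z)))
          (gap⇒Gap β _ _ (subst (λ p → Compares _ _ (toℕ p)) vx (values-compare x z))
                       (subst (λ p → Compares _ _ (toℕ p)) vy (values-compare y z)))
      go (is-desc e₀ e₁) (x , ex) (y , ey) = some-complete t x (some-complete t y (∧-join pair (every-complete t clear)))
        where
        vx : π ⟨$⟩ʳ position x ≡ β 1F
        vx = trans (cong (π ⟨$⟩ʳ_) ex) (trans (image 0F) (cong β e₀))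
        vy : π ⟨$⟩ʳ position y ≡ β 0F
        vy = trans (cong (π ⟨$⟩ʳ_) ey) (trans (image 1F) (cong β e₁))
        pair : T (pairDirection desc (direction x y))
        pair with direction x y | Compares-gt _ (positions-compare x y) (subst₂ Fin._<_ (sym ex) (sym ey) α<)
                | Compares-lt _ (values-compare x y) (subst₂ Fin._<_ (sym vy) (sym vx) β<)
        ... | se | refl | refl = tt
        clear : ∀ z → T (allowed desc R (direction x z) (direction y z))
        clear z = unblocked (column desc (direction x z) (direction y z)) (row desc (direction x z) (direction y z))
          (gap⇒Gap α _ _ (subst (λ p → Compares _ _ (toℕ p)) ex (positions-compare x z))
                       (subst (λ p → Compares _ _ (toℕ p)) ey (positions-compare y z)))
          (gap⇒Gap β _ _ (subst (λ p → Compares _ _ (toℕ p)) vy (values-compare y z))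
                       (subst (λ p → Compares _ _ (toℕ p)) vx (values-compare x z)))

  -- A node `se` of x is in the right subtree of x. A node `ne` of x is an ancestor that has x on
  -- its left, or is in the right subtree of such an ancestor, and so comes after the whole subtree
  -- of x in inorder.
  no-231 : ∀ {t} (x y z : Node t) → direction x y ≡ ne → direction x z ≡ se → horizontal (direction y z) ≢ gt
  no-231 (inL x) (inL y) (inL z) p q r = no-231 x y z p q r
  no-231 (inR x) (inR y) (inR z) p q r = no-231 x y z p q r
  no-231 (inL x) (inL y) root    p () r
  no-231 (inL x) (inL y) (inR z) p () r
  no-231 (inL x) root    (inL z) p q ()
  no-231 (inL x) root    root    p () r
  no-231 (inL x) root    (inR z) p () r
  no-231 (inL x) (inR y) (inL z) p q ()
  no-231 (inL x) (inR y) root    p () r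
  no-231 (inL x) (inR y) (inR z) p () r
  no-231 root    (inR y) (inR z) () q r
  no-231 (inR x) root    _       () q r

  Shape⇒avoids-231 : Avoids π (classical perm231)
  Shape⇒avoids-231 ω occ = go (nodeFor (α 0F)) (nodeFor (α 1F)) (nodeFor (α 2F))
    where
    open IsOccurrence occ
    image : ∀ i → π ⟨$⟩ʳ α i ≡ β (perm231 ⟨$⟩ʳ i)
    image i = ω⊆G (proj₂ ω≐image (i , perm231 ⟨$⟩ʳ i , refl , refl , refl))
    α-inc = OPI⇒increasing α-mono
    β-inc = OPI⇒increasing β-mono
    go : (∃ λ x → position x ≡ α 0F) → (∃ λ y → position y ≡ α 1F) → (∃ λ z → position z ≡ α 2F) → ⊥
    go (x , ex) (y , ey) (z , ez) = no-231 x y z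
      (both-ne (Compares-gt _ (positions-compare x y) (subst₂ Fin._<_ (sym ex) (sym ey) (α-inc 0F 1F z<s)))
               (Compares-gt _ (values-compare x y) (subst₂ Fin._<_ (sym vx) (sym vy) (β-inc 1F 2F (s<s z<s)))))
      (both-se (Compares-gt _ (positions-compare x z) (subst₂ Fin._<_ (sym ex) (sym ez) (α-inc 0F 2F z<s)))
               (Compares-lt _ (values-compare x z) (subst₂ Fin._<_ (sym vz) (sym vx) (β-inc 0F 1F z<s))))
      (Compares-gt _ (positions-compare y z) (subst₂ Fin._<_ (sym ey) (sym ez) (α-inc 1F 2F (s<s z<s))))
      where
      vx = trans (cong (π ⟨$⟩ʳ_) ex) (image 0F)
      vy = trans (cong (π ⟨$⟩ʳ_) ey) (image 1F)
      vz = trans (cong (π ⟨$⟩ʳ_) ez) (image 2F)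
      both-ne : ∀ {d} → horizontal d ≡ gt → vertical d ≡ gt → d ≡ ne
      both-ne {ne} _ _ = refl
      both-se : ∀ {d} → horizontal d ≡ gt → vertical d ≡ lt → d ≡ se
      both-se {se} _ _ = refl

avoids-231 : ∀ {n} {π : Permutation′ n} → Avoids π (classical perm231) → ∀ {a b c} → a Fin.< b → b Fin.< c →
             π ⟨$⟩ʳ c Fin.< π ⟨$⟩ʳ a → ¬ (π ⟨$⟩ʳ a Fin.< π ⟨$⟩ʳ b)
avoids-231 {π = π} avoids {a} {b} {c} a<b b<c vc<va va<vb = avoids _ record
  { ω⊆G     = λ { (0F , _ , refl , refl , refl) → refl
                ; (1F , _ , refl , refl , refl) → refl
                ; (2F , _ , refl , refl , refl) → refl }
  ; α       = lookup (a ∷ b ∷ c ∷ [])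
  ; β       = lookup ((π ⟨$⟩ʳ c) ∷ (π ⟨$⟩ʳ a) ∷ (π ⟨$⟩ʳ b) ∷ [])
  ; α-mono  = increasing₃ a<b b<c
  ; β-mono  = increasing₃ vc<va va<vb
  ; ω≐image = (λ m → m) , (λ m → m)
  ; empty   = λ i j ij∈ _ _ → ∉⊥ (subst (j Sub.∈_) (lookup-replicate i Sub.⊥) ij∈)
  }

-- Every 231-avoiding permutation has a tree

-- Says only that f, on the segment that starts at a, is ordered like postorder: a segment of a
-- permutation has no canonical set of values. The values themselves are recovered for the whole
-- permutation by `h≡postorder`.
Realises : (ℕ → ℕ) → ℕ → Tree → Set
Realises f a t = ∀ (x y : Node t) → Compares (vertical (direction x y)) (f (a + inorder y)) (f (a + inorder x))

module Decomposition (n : ℕ) (f : ℕ → ℕ)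
  (f-injective : ∀ {i j} → i < n → j < n → f i ≡ f j → i ≡ j)
  (f-avoids : ∀ {i j k} → i < j → j < k → k < n → f k < f i → ¬ (f i < f j)) where

  record Maximum (a k : ℕ) : Set where
    constructor maximum
    field
      before after : ℕ
      total≡  : before + suc after ≡ suc k
      greatest : ∀ d → d < suc k → f (a + d) ≤ f (a + before)

  argmax : ∀ k a → Maximum a k
  argmax zero    a = maximum 0 0 refl λ { zero _ → ≤-refl ; (suc _) (s≤s ()) }
  argmax (suc k) a with argmax k a
  ... | maximum i j e g with ≤-total (f (a + suc k)) (f (a + i))
  ...   | inj₁ last≤ = maximum i (suc j) (trans (+-suc i (suc j)) (cong suc e)) λ d d< → extended d (m<1+n⇒m<n∨m≡n d<)
    where
    extended : ∀ d → d < suc k ⊎ d ≡ suc k → f (a + d) ≤ f (a + i)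
    extended d (inj₁ d<)   = g d d<
    extended d (inj₂ refl) = last≤
  ...   | inj₂ ≤last = maximum (suc k) 0 (+-comm (suc k) 1) λ d d< → extended d (m<1+n⇒m<n∨m≡n d<)
    where
    extended : ∀ d → d < suc k ⊎ d ≡ suc k → f (a + d) ≤ f (a + suc k)
    extended d (inj₁ d<)   = ≤-trans (g d d<) ≤last
    extended d (inj₂ refl) = ≤-refl

  -- m is fuel.
  decompose : ∀ m k a → k ≤ m → a + k ≤ n → ∃ λ t → size t ≡ k × Realises f a t
  decompose m       zero    a _       _   = leaf , refl , λ ()
  decompose (suc m) (suc k) a (s≤s k≤m) a+k≤n with argmax k a
  ... | maximum i j i+1+j≡1+k g
    with decompose m i a (≤-trans i≤k k≤m) (≤-trans (+-monoʳ-≤ a (≤-trans i≤k (n≤1+n k))) a+k≤n)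
       | decompose m j (a + suc i) (≤-trans j≤k k≤m) (≤-trans (≤-reflexive positions) a+k≤n)
    where
    i+j≡k : i + j ≡ k
    i+j≡k = suc-injective (trans (sym (+-suc i j)) i+1+j≡1+k)
    i≤k : i ≤ k
    i≤k = subst (i ≤_) i+j≡k (m≤m+n i j)
    j≤k : j ≤ k
    j≤k = subst (j ≤_) i+j≡k (m≤n+m j i)
    positions : a + suc i + j ≡ a + suc k
    positions = trans (+-assoc a (suc i) j) (cong (λ k → a + suc k) i+j≡k)
  ...   | l , refl , L | r , refl , R = node l r , i+1+j≡1+k , realises
    where
    right≡ : ∀ (y : Node r) → a + inorder {node l r} (inR y) ≡ a + suc i + inorder y
    right≡ y = lem a i (inorder y)
      where lem : ∀ a i y → a + (i + suc y) ≡ a + suc i + y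
            lem = solve-∀
    pos< : ∀ (x : Node (node l r)) → a + inorder x < n
    pos< x = <-≤-trans (+-monoʳ-< a (subst (inorder x <_) i+1+j≡1+k (inorder<size x))) a+k≤n
    distinct : ∀ (x y : Node (node l r)) → inorder x < inorder y → f (a + inorder x) ≢ f (a + inorder y)
    distinct x y x<y e = <⇒≢ x<y (+-cancelˡ-≡ a _ _ (f-injective (pos< x) (pos< y) e))
    at-most : ∀ (x : Node (node l r)) → f (a + inorder x) ≤ f (a + i)
    at-most x = g (inorder x) (subst (inorder x <_) i+1+j≡1+k (inorder<size x))
    left<root : ∀ x → f (a + inorder x) < f (a + i)
    left<root x = ≤∧≢⇒< (at-most (inL x)) (distinct (inL x) root (inorder<size x))
    right<root : ∀ y → f (a + inorder {node l r} (inR y)) < f (a + i)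
    right<root y = ≤∧≢⇒< (at-most (inR y)) (distinct root (inR y) (m<m+n i z<s) ∘ sym)
    left<right : ∀ x y → f (a + inorder x) < f (a + inorder {node l r} (inR y))
    left<right x y with <-cmp (f (a + inorder x)) (f (a + inorder {node l r} (inR y)))
    ... | tri< x<y _ _ = x<y
    ... | tri≈ _ x≡y _ = contradiction x≡y (distinct (inL x) (inR y) (m≤n⇒m≤n+o _ (inorder<size x)))
    -- Otherwise x, the maximum and y would form an occurrence of 231.
    ... | tri> _ _ y<x = contradiction (left<root x)
      (f-avoids (+-monoʳ-< a (inorder<size x)) (+-monoʳ-< a (m<m+n i z<s)) (pos< (inR y)) y<x)
    realises : Realises f a (node l r)
    realises (inL x) (inL y) = L x y
    realises (inL x) root    = left<root x
    realises (inL x) (inR y) = left<right x y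
    realises root    (inL y) = left<root y
    realises root    root    = refl
    realises root    (inR y) = right<root y
    realises (inR x) (inL y) = left<right y x
    realises (inR x) root    = right<root x
    realises (inR x) (inR y) rewrite right≡ x | right≡ y = R x y

module _ {t} (h : Node t → ℕ) (h< : ∀ x → h x < size t)
         (h-compares : ∀ x y → Compares (vertical (direction x y)) (h y) (h x)) where

  h-increasing : ∀ x y → postorder x < postorder y → h x < h y
  h-increasing x y p with vertical (direction x y) | Compares-gt _ (postorder-compares x y) p | h-compares x y
  ... | gt | refl | q = q

  postorder≤h : ∀ p x → postorder x ≡ p → p ≤ h x
  postorder≤h zero    x e = z≤n
  postorder≤h (suc p) x e =
    let y , e′ = nodeOf t (<-trans (n<1+n p) (subst (_< size t) e (postorder<size x)))
    in ≤-<-trans (postorder≤h p y e′) (h-increasing y x (subst₂ _<_ (sym e′) (sym e) (n<1+n p)))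

  h≤postorder : ∀ d x → postorder x + suc d ≡ size t → h x + suc d ≤ size t
  h≤postorder zero    x e = subst (_≤ size t) (+-comm 1 (h x)) (h< x)
  h≤postorder (suc d) x e =
    let y , e′ = nodeOf t (subst (suc (postorder x) <_) e (subst (_< postorder x + suc (suc d)) (+-comm (postorder x) 1) (+-monoʳ-< (postorder x) (s<s z<s))))
    in ≤-trans (subst (_≤ h y + suc d) (sym (+-suc (h x) (suc d))) (+-monoˡ-≤ (suc d) (h-increasing x y (subst (postorder x <_) (sym e′) (n<1+n _)))))
         (h≤postorder d y (trans (cong (_+ suc d) e′) (trans (sym (+-suc (postorder x) (suc d))) e)))

  -- As a function of the postorder number, h is a strictly increasing map of an initial segment of
  -- ℕ into itself, hence the identity. The lower bound is an induction from the first node, the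
  -- upper bound an induction from the last.
  h≡postorder : ∀ x → h x ≡ postorder x
  h≡postorder x with m≤n⇒∃[o]m+o≡n (postorder<size x)
  ... | d , e = ≤-antisym (+-cancelʳ-≤ (suc d) (h x) (postorder x) (≤-trans (h≤postorder d x e′) (≤-reflexive (sym e′))))
                          (postorder≤h _ x refl)
    where e′ : postorder x + suc d ≡ size t
          e′ = trans (+-suc (postorder x) d) e

module _ {n} (π : Permutation′ n) (avoids : Avoids π (classical perm231)) where

  value : ℕ → ℕ
  value i with i <? n
  ... | yes i<n = toℕ (π ⟨$⟩ʳ fromℕ< i<n)
  -- Any default will do: the hypotheses of `Decomposition` speak only of arguments below n.
  ... | no  _   = 0

  value-fromℕ< : ∀ {i} (i<n : i < n) → value i ≡ toℕ (π ⟨$⟩ʳ fromℕ< i<n)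
  value-fromℕ< {i} i<n with i <? n
  ... | yes p = cong (λ q → toℕ (π ⟨$⟩ʳ fromℕ< q)) (<-irrelevant p i<n)
  ... | no ¬p = contradiction i<n ¬p

  value-toℕ : ∀ i → value (toℕ i) ≡ toℕ (π ⟨$⟩ʳ i)
  value-toℕ i = trans (value-fromℕ< (toℕ<n i)) (cong (toℕ ∘ (π ⟨$⟩ʳ_)) (fromℕ<-toℕ i (toℕ<n i)))

  value-injective : ∀ {i j} → i < n → j < n → value i ≡ value j → i ≡ j
  value-injective p q e = subst₂ _≡_ (toℕ-fromℕ< p) (toℕ-fromℕ< q) (cong toℕ
    (Injection.injective (↔⇒↣ π) (toℕ-injective (trans (sym (value-fromℕ< p)) (trans e (value-fromℕ< q))))))

  value-avoids : ∀ {i j k} → i < j → j < k → k < n → value k < value i → ¬ (value i < value j)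
  value-avoids {i} {j} {k} i<j j<k k<n vk<vi vi<vj = avoids-231 avoids {fromℕ< i<n} {fromℕ< j<n} {fromℕ< k<n}
    (subst₂ _<_ (sym (toℕ-fromℕ< i<n)) (sym (toℕ-fromℕ< j<n)) i<j)
    (subst₂ _<_ (sym (toℕ-fromℕ< j<n)) (sym (toℕ-fromℕ< k<n)) j<k)
    (subst₂ _<_ (value-fromℕ< k<n) (value-fromℕ< i<n) vk<vi)
    (subst₂ _<_ (value-fromℕ< i<n) (value-fromℕ< j<n) vi<vj)
    where
    j<n = <-trans j<k k<n
    i<n = <-trans i<j j<n

  hasShape : ∃ λ t → Shape t π
  hasShape with Decomposition.decompose n value value-injective value-avoids n n 0 ≤-refl ≤-refl
  ... | t , size≡ , R = t , shape size≡ λ x i e → trans (sym (value-toℕ i)) (trans (cong value e)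
        (h≡postorder (value ∘ inorder) bounded R x))
    where
    bounded : ∀ x → value (inorder x) < size t
    bounded x = let p = subst (inorder x <_) size≡ (inorder<size x)
                in subst₂ _<_ (sym (value-fromℕ< p)) (sym size≡) (toℕ<n _)

-- Counting avoiders

accepts?-occurs : ∀ k R t → accepts? (patternAutomaton k R) t ≡ not (occurs k R t)
accepts?-occurs k R t = cong (not ∘ State.o) (run-pattern k R t)

List-lookup-injective : ∀ {A : Set} {xs : List A} → Unique xs → ∀ i j → List.lookup xs i ≡ List.lookup xs j → i ≡ j
List-lookup-injective (p ∷ u) zero    zero    e = refl
List-lookup-injective (p ∷ u) zero    (suc j) e = contradiction e (All.lookup p (∈-lookup j))
List-lookup-injective (p ∷ u) (suc i) zero    e = contradiction (sym e) (All.lookup p (∈-lookup i))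
List-lookup-injective (p ∷ u) (suc i) (suc j) e = cong suc (List-lookup-injective u i j e)

module _ (p : MeshPattern 2) where
  open MeshPattern p
  private
    k = kindOf perm
    A = patternAutomaton k shading

  avoiderCount : ℕ → ℕ
  avoiderCount = counts A

  module _ {n t} {π : Permutation′ n} (sh : Shape t π) where

    avoids⇒accepts : Avoids π p → T (accepts? A t)
    avoids⇒accepts avoids rewrite accepts?-occurs k shading t with occurs k shading t in e
    ... | false = tt
    ... | true  = occurs⇒occurrence sh shading (proj₂ (classify perm)) (subst T (sym e) tt) avoids

    accepts⇒avoids : T (accepts? A t) → Avoids π p
    accepts⇒avoids acc ω occ rewrite accepts?-occurs k shading t with occurs k shading t in e
    ... | false = subst T e (occurrence⇒occurs sh shading (proj₂ (classify perm)) occ)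

  -- An avoider is numbered by the index of its tree among the accepted trees. The tree is obtained
  -- from a particular permutation and a proof of avoidance; pointwise equal permutations get the
  -- same index because a permutation has at most one tree, and the converse holds because a tree
  -- has at most one permutation.
  Av-count : ∀ n → ∣ Av n ((_ , classical perm231) ∷ (_ , p) ∷ []) ∣≡ avoiderCount n
  Av-count n = record
    { to        = to
    ; cong      = λ {σ} {ρ} e → List-lookup-injective selected-unique _ _ (trans (lookup-to σ)
                    (trans (Shape-injective (Shape-resp-≈ e (shapeOf σ)) (shapeOf ρ)) (sym (lookup-to ρ))))
    ; bijective =
        (λ {σ} {ρ} e → Shape-functional (shapeOf σ)
           (subst (λ t → Shape t (proj₁ ρ)) (trans (sym (lookup-to ρ)) (trans (cong (List.lookup selected) (sym e)) (lookup-to σ))) (shapeOf ρ)))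
      , λ i → from i , λ {σ} e → List-lookup-injective selected-unique _ _ (trans (lookup-to σ)
           (Shape-injective (shapeOf σ) (Shape-resp-≈ (λ j → sym (e j)) (from-shape i))))
    }
    where
    Avoiders = Σ[ π ∈ Permutation′ n ] All (λ (_ , p) → Avoids π p) ((_ , classical perm231) ∷ (_ , p) ∷ [])
    selected : List Tree
    selected = filterᵇ (accepts? A) (trees n)
    selected-unique : Unique selected
    selected-unique = Unique.filter⁺ (T? ∘ accepts? A) (trees-unique n)
    treeOf : Avoiders → Tree
    treeOf (π , av ∷ _) = proj₁ (hasShape π av)
    shapeOf : ∀ σ → Shape (treeOf σ) (proj₁ σ)
    shapeOf (π , av ∷ _) = proj₂ (hasShape π av)
    treeOf∈ : ∀ σ → treeOf σ ∈ selected
    treeOf∈ σ@(π , _ ∷ av ∷ []) = ∈-filter⁺ (T? ∘ accepts? A)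
      (subst (λ n → treeOf σ ∈ trees n) (Shape.size≡ (shapeOf σ)) (∈-trees (treeOf σ))) (avoids⇒accepts (shapeOf σ) av)
    to : Avoiders → Fin (length selected)
    to σ = Any.index (treeOf∈ σ)
    lookup-to : ∀ σ → List.lookup selected (to σ) ≡ treeOf σ
    lookup-to σ = sym (lookup-index (treeOf∈ σ))
    fromTree : ∀ {n} t → size t ≡ n → ∃ λ (π : Permutation′ n) → Shape t π
    fromTree t refl = toPermutation t , toPermutation-Shape t
    at : ∀ i → List.lookup selected i ∈ trees n × T (accepts? A (List.lookup selected i))
    at i = ∈-filter⁻ (T? ∘ accepts? A) {xs = trees n} (∈-lookup i)
    realised : ∀ i → ∃ λ (π : Permutation′ n) → Shape (List.lookup selected i) π
    realised i = fromTree (List.lookup selected i) (∈-trees⇒size (proj₁ (at i)))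
    from : Fin (length selected) → Avoiders
    from i = proj₁ (realised i) , Shape⇒avoids-231 (proj₂ (realised i)) ∷ accepts⇒avoids (proj₂ (realised i)) (proj₂ (at i)) ∷ []
    from-shape : ∀ i → Shape (List.lookup selected i) (proj₁ (from i))
    from-shape i = proj₂ (realised i)

-- The quotient by Wilf-equivalence

cardinality-unique : ∀ {a ℓ} {A : Setoid a ℓ} {m m′} → ∣ A ∣≡ m → ∣ A ∣≡ m′ → m ≡ m′
cardinality-unique {A = A} f g = ≤-antisym (bounded f g) (bounded g f)
  where
  bounded : ∀ {m m′} → ∣ A ∣≡ m → ∣ A ∣≡ m′ → m ≤ m′
  bounded f g = Fin.injective⇒≤ {f = λ i → Bijection.to g (from i)} λ {i} {j} e →
    trans (sym (to-from i)) (trans (Bijection.cong f (Bijection.injective g e)) (to-from j))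
    where
    from = λ i → proj₁ (Bijection.surjective f i)
    to-from : ∀ i → Bijection.to f (from i) ≡ i
    to-from i = proj₂ (Bijection.surjective f i) (Setoid.refl A)

_∼_ : MeshPattern 2 → MeshPattern 2 → Set₁
_∼_ = WilfEquivalentUnder (classical perm231)

-- Wilf-equivalence supplies just some common cardinality m for each n. Identifying it with the
-- explicit counts makes transitivity a matter of equality of numbers.
∼⇒counts : ∀ {p q} → p ∼ q → avoiderCount p ≗ avoiderCount q
∼⇒counts {p} {q} w n = let m , f , g = w n in
  trans (cardinality-unique (Av-count p n) f) (cardinality-unique g (Av-count q n))

counts⇒∼ : ∀ {p q} → avoiderCount p ≗ avoiderCount q → p ∼ q
counts⇒∼ {p} {q} e n = avoiderCount p n , Av-count p n ,
  subst (∣ Av n ((_ , classical perm231) ∷ (_ , q) ∷ []) ∣≡_) (sym (e n)) (Av-count q n)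

wilfClass : MeshPattern 2 → Fin 23
wilfClass (mesh τ R) = classOf (kindOf τ) R

avoiderCount-class : ∀ p → avoiderCount p ≗ counts (classAutomaton (wilfClass p))
avoiderCount-class (mesh τ R) = counts-class (kindOf τ) R

permOf : Kind → Permutation′ 2
permOf asc  = Perm.id
permOf desc = Perm.reverse

kindOf-permOf : ∀ k → kindOf (permOf k) ≡ k
kindOf-permOf asc  = refl
kindOf-permOf desc = refl

patternOf : Fin 23 → MeshPattern 2
patternOf c = mesh (permOf (Language.kind (representative c))) (shadingOf (Language.code (representative c)))

wilfClass-patternOf : ∀ c → wilfClass (patternOf c) ≡ c
wilfClass-patternOf c = trans
  (cong (λ k → classOf k (shadingOf (Language.code (representative c)))) (kindOf-permOf (Language.kind (representative c))))
  (patternClass-id c)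

mainTheorem8 : HasExactlyClasses {A = MeshPattern 2} (WilfEquivalentUnder (classical perm231)) 23
mainTheorem8 = equivalence , record
  { to        = wilfClass
  ; cong      = λ {p} {q} w → counts-injective (wilfClass p) (wilfClass q) λ n →
                  trans (sym (avoiderCount-class p n)) (trans (∼⇒counts w n) (avoiderCount-class q n))
  ; bijective = (λ {p} {q} e → counts⇒∼ λ n → trans (avoiderCount-class p n)
                  (trans (cong (λ c → counts (classAutomaton c) n) e) (sym (avoiderCount-class q n))))
              -- Surjectivity concerns every pattern equivalent to the chosen one, so its class is
              -- first moved to that of `patternOf c` by comparing counts.
              , λ c → patternOf c , λ {p} w → trans (counts-injective (wilfClass p) (wilfClass (patternOf c)) λ n →
                  trans (sym (avoiderCount-class p n)) (trans (∼⇒counts w n) (avoiderCount-class (patternOf c) n)))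
                  (wilfClass-patternOf c)
  }
  where
  equivalence : IsEquivalence _∼_
  equivalence = record
    { refl  = counts⇒∼ λ _ → refl
    ; sym   = λ w → counts⇒∼ λ n → sym (∼⇒counts w n)
    ; trans = λ w w′ → counts⇒∼ λ n → trans (∼⇒counts w n) (∼⇒counts w′ n)
    }
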